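{- Let $\mathbf{C}$ be a finitary adhesive category with a strict initial object $\varnothing$, in which all final pullback complements (FPCs) along monomorphisms exist and monomorphisms are stable under FPCs. Then the canonical representation $\rho^{sq}_{\mathbf{C}}:\mathcal{R}^{sq}_{\mathbf{C}}\to \mathrm{End}_{\mathbb{R}}(\hat{\mathbf{C}})$ is a homomorphism of unital associative algebras; i.e. $\rho^{sq}_{\mathbf{C}}(\delta(\varnothing\leftarrow\varnothing\rightarrow\varnothing))=\mathrm{id}_{\hat{\mathbf{C}}}$ and $\rho^{sq}_{\mathbf{C}}(R_2\odot_{\mathcal{R}_{\mathbf{C}}}R_1)=\rho^{sq}_{\mathbf{C}}(R_2)\,\rho^{sq}_{\mathbf{C}}(R_1)$ for all $R_1,R_2\in\mathcal{R}_{\mathbf{C}}$.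
   Context: A category is adhesive if it has pushouts along monomorphisms, has pullbacks, and pushouts along monomorphisms are van Kampen squares; finitary if every object has finitely many subobjects; a strict initial object is an initial object $\varnothing$ such that every morphism $X\to\varnothing$ is an isomorphism. FPC: given $a:A\to B$, $c:B\to C$, a pair $(d:D\to C,b:A\to D)$ is an FPC of $(c,a)$ if $c\circ a=d\circ b$, the square is a pullback, and for all $x:E\to B$, $y:E\to F$, $z:F\to C$, $w:E\to A$ with $(E,x,y)$ a pullback of $(c,z)$ and $a\circ w=x$, there is a unique $w^*:F\to D$ with $d\circ w^*=z$, $w^*\circ y=b\circ w$. The assumption means: for composable monomorphisms $K\xrightarrow{i}I\xrightarrow{m}X$ an FPC of $(m,i)$ exists and consists of monomorphisms. $\mathrm{Lin}(\mathbf{C})$: isomorphism classes of spans of monomorphisms $p=(O\xleftarrow{o}K\xrightarrow{i}I)$. SqPO derivation: for $p$ and an object $X$, $\mathsf{M}_p(X)$ is the set of monomorphisms $m:I\to X$; for such $m$ let $(i':\overline{K}\to X,k:K\to\overline{K})$ be the FPC of $(m,i)$ and let $p_m(X)$ be the pushout of $O\xleftarrow{o}K\xrightarrow{k}\overline{K}$. SqPO composition: for $p_j=(O_j\xleftarrow{o_j}K_j\xrightarrow{i_j}I_j)$, a span of monomorphisms $\mathbf{m}=(I_2\xleftarrow{m_2}M_{21}\xrightarrow{m_1}O_1)$ (up to isomorphism of $M_{21}$ compatible with the legs) is in $\mathsf{M}_{p_2}(p_1)$ if, with $I_2\xrightarrow{n_2}N_{21}\xleftarrow{n_1}O_1$ its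 pushout, there is a pushout complement $K_1\xrightarrow{k_1}\overline{K}_1\xrightarrow{o_1'}N_{21}$ of $K_1\xrightarrow{o_1}O_1\xrightarrow{n_1}N_{21}$. Then take the FPC $(i_2':\overline{K}_2\to N_{21},k_2)$ of $(n_2,i_2)$, the pushouts $O_{21}$ of $O_2\xleftarrow{o_2}K_2\xrightarrow{k_2}\overline{K}_2$ (with $o_2'$) and $I_{21}$ of $I_1\xleftarrow{i_1}K_1\xrightarrow{k_1}\overline{K}_1$ (with $i_1'$), and the pullback $K_{21}$ (with $i_2''$, $o_1''$) of $\overline{K}_2\xrightarrow{i_2'}N_{21}\xleftarrow{o_1'}\overline{K}_1$; the composite is $p_2{}^{\mathbf{m}}\!\circ p_1:=(O_{21}\xleftarrow{o_2'\circ i_2''}K_{21}\xrightarrow{i_1'\circ o_1''}I_{21})$. Rule algebra $\mathcal{R}^{sq}_{\mathbf{C}}=(\mathcal{R}_{\mathbf{C}},\odot_{\mathcal{R}_{\mathbf{C}}})$: $\mathcal{R}_{\mathbf{C}}$ is the free $\mathbb{R}$-vector space with basis $\{\delta(p)\mid p\in\mathrm{Lin}(\mathbf{C})\}$, with $\delta(p_2)\odot_{\mathcal{R}_{\mathbf{C}}}\delta(p_1):=\sum_{\mathbf{m}\in\mathsf{M}_{p_2}(p_1)}\delta(p_2{}^{\mathbf{m}}\!\circ p_1)$ extended bilinearly. $\hat{\mathbf{C}}$ is the free $\mathbb{R}$-vector space with basis vectors $|X\rangle$ indexed by isomorphism classes of objects $X$. The canonical representation is defined on basis vectors by $\rho^{sq}_{\mathbf{C}}(\delta(p))|X\rangle:=\sum_{m\in\mathsf{M}_p(X)}|p_m(X)\rangle$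 (which is $0$ if $\mathsf{M}_p(X)=\emptyset$), extended linearly in both arguments.
   Formalization: The formal theorem also assumes that for all objects A, X the set of monomorphisms A→X is finite; without this the sums defining the representation can be infinite and undefined (e.g. in finitely generated free ℤ-sets, where ℤ has infinitely many automorphisms). -}

module Defs where

module Reals where

  open import Algebra.Bundles using (CommutativeRing)
  open import Data.Nat.Base as ℕ using (ℕ; _⊔_)
  import Data.Nat.Properties as ℕ
  open import Data.Product.Base using (∃; _×_; _,_; proj₁; proj₂)
  open import Data.Rational.Base using (ℚ; 0ℚ; 1ℚ; ½; _+_; _*_; -_; _-_; ∣_∣; _<_; _≤_; 1/_; NonZero; Positive; positive)
  import Data.Rational.Properties as ℚ
  import Algebra.Properties.AbelianGroup
  import Algebra.Properties.Ring
  import Algebra.Properties.CommutativeSemigroup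
  open import Level using (0ℓ)
  open import Relation.Binary.PropositionalEquality using (_≡_; refl; sym; trans; cong; cong₂; subst)

  private
    a+[b-a] : ∀ a b → a + (b - a) ≡ b
    a+[b-a] a b = trans (cong (a +_) (ℚ.+-comm b (- a)))
      (trans (sym (ℚ.+-assoc a (- a) b))
      (trans (cong (_+ b) (ℚ.+-inverseʳ a)) (ℚ.+-identityˡ b)))

    [a-b]+[b-c] : ∀ a b c → (a - b) + (b - c) ≡ a - c
    [a-b]+[b-c] a b c = trans (ℚ.+-assoc a (- b) (b - c)) (cong (a +_)
      (trans (sym (ℚ.+-assoc (- b) b (- c)))
      (trans (cong (_+ - c) (ℚ.+-inverseˡ b)) (ℚ.+-identityˡ (- c)))))

    -[a-b] : ∀ a b → - (a - b) ≡ b - a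
    -[a-b] a b = trans (ℚ.neg-distrib-+ a (- b))
      (trans (cong (- a +_) (⁻¹-involutive b)) (ℚ.+-comm (- a) b))
      where open Algebra.Properties.AbelianGroup ℚ.+-0-abelianGroup using (⁻¹-involutive)

    [a-b]+[c-d] : ∀ a b c d → (a - b) + (c - d) ≡ (a + c) - (b + d)
    [a-b]+[c-d] a b c d = trans (interchange a (- b) c (- d))
      (cong ((a + c) +_) (sym (ℚ.neg-distrib-+ b d)))
      where open Algebra.Properties.CommutativeSemigroup (CommutativeRing.+-commutativeSemigroup ℚ.+-*-commutativeRing) using (interchange)

    a[c-d]+d[a-b] : ∀ a b c d → a * (c - d) + d * (a - b) ≡ a * c - b * d
    a[c-d]+d[a-b] a b c d = trans
      (cong₂ _+_ (x[y-z]≈xy-xz a c d)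
        (trans (x[y-z]≈xy-xz d a b) (cong₂ _-_ (ℚ.*-comm d a) (ℚ.*-comm d b))))
      ([a-b]+[b-c] (a * c) (a * d) (b * d))
      where open Algebra.Properties.Ring (CommutativeRing.ring ℚ.+-*-commutativeRing) using (x[y-z]≈xy-xz)

  -- Smallness along a directed index (used for pairs of indices in the Cauchy
  -- condition and for single indices in the equality of reals).
  private
    module Small {I : Set} (_⊒_ : I → ℕ → Set)
                 (⊒-down : ∀ {i M N} → M ℕ.≤ N → i ⊒ N → i ⊒ M) where

      Small : (I → ℚ) → Set
      Small f = ∀ ε → 0ℚ < ε → ∃ λ N → ∀ i → i ⊒ N → ∣ f i ∣ < ε

      Bounded : (I → ℚ) → Set
      Bounded f = ∃ λ B → 0ℚ < B × ∃ λ N → ∀ i → i ⊒ N → ∣ f i ∣ ≤ B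

      small-cong : ∀ {f g} → (∀ i → f i ≡ g i) → Small f → Small g
      small-cong f≗g sf ε ε>0 with sf ε ε>0
      ... | N , h = N , λ i i⊒N → subst (λ q → ∣ q ∣ < ε) (f≗g i) (h i i⊒N)

      small-0 : ∀ {f} → (∀ i → f i ≡ 0ℚ) → Small f
      small-0 f≗0 ε ε>0 = 0 , λ i _ → subst (λ q → ∣ q ∣ < ε) (sym (f≗0 i)) ε>0

      small-neg : ∀ {f} → Small f → Small (λ i → - f i)
      small-neg {f} sf ε ε>0 with sf ε ε>0
      ... | N , h = N , λ i i⊒N → subst (_< ε) (sym (ℚ.∣-p∣≡∣p∣ (f i))) (h i i⊒N)

      half-pos : ∀ {ε} → 0ℚ < ε → 0ℚ < ½ * ε
      half-pos {ε} ε>0 = subst (_< ½ * ε) (ℚ.*-zeroʳ ½) (ℚ.*-monoʳ-<-pos ½ ε>0)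

      half+half : ∀ ε → ½ * ε + ½ * ε ≡ ε
      half+half ε = trans (sym (ℚ.*-distribʳ-+ ε ½ ½)) (ℚ.*-identityˡ ε)

      small-+ : ∀ {f g} → Small f → Small g → Small (λ i → f i + g i)
      small-+ {f} {g} sf sg ε ε>0 with sf (½ * ε) (half-pos ε>0) | sg (½ * ε) (half-pos ε>0)
      ... | M , hf | N , hg = M ⊔ N , λ i i⊒ →
        ℚ.≤-<-trans (ℚ.∣p+q∣≤∣p∣+∣q∣ (f i) (g i))
          (subst (∣ f i ∣ + ∣ g i ∣ <_) (half+half ε)
            (ℚ.+-mono-< (hf i (⊒-down (ℕ.m≤m⊔n M N) i⊒)) (hg i (⊒-down (ℕ.m≤n⊔m M N) i⊒))))

      small-* : ∀ {f g} → Bounded f → Small g → Small (λ i → f i * g i)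
      small-* {f} {g} (B , B>0 , M , hf) sg ε ε>0 with sg δ δ>0
        where
        instance
          B-pos : Positive B
          B-pos = positive B>0
          B-nz : NonZero B
          B-nz = ℚ.pos⇒nonZero B
          1/B-pos : Positive (1/ B)
          1/B-pos = ℚ.1/pos⇒pos B
        δ = 1/ B * ε
        δ>0 : 0ℚ < δ
        δ>0 = subst (_< δ) (ℚ.*-zeroʳ (1/ B)) (ℚ.*-monoʳ-<-pos (1/ B) ε>0)
      ... | N , hg = M ⊔ N , λ i i⊒ →
        subst (_< ε) (sym (ℚ.∣p*q∣≡∣p∣*∣q∣ (f i) (g i)))
          (ℚ.≤-<-trans
            (ℚ.*-monoʳ-≤-nonNeg ∣ g i ∣ {{ℚ.∣-∣-nonNeg (g i)}} (hf i (⊒-down (ℕ.m≤m⊔n M N) i⊒)))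
            (subst (B * ∣ g i ∣ <_) Bδ≡ε (ℚ.*-monoʳ-<-pos B (hg i (⊒-down (ℕ.m≤n⊔m M N) i⊒)))))
        where
        instance
          B-pos : Positive B
          B-pos = positive B>0
          B-nz : NonZero B
          B-nz = ℚ.pos⇒nonZero B
        Bδ≡ε : B * (1/ B * ε) ≡ ε
        Bδ≡ε = trans (sym (ℚ.*-assoc B (1/ B) ε)) (trans (cong (_* ε) (ℚ.*-inverseʳ B)) (ℚ.*-identityˡ ε))

  -- Real numbers as Cauchy sequences of rationals modulo null sequences.
  record ℝ : Set where
    constructor real
    field
      at     : ℕ → ℚ
      cauchy : ∀ ε → 0ℚ < ε → ∃ λ N → ∀ m n → N ℕ.≤ m → N ℕ.≤ n → ∣ at m - at n ∣ < ε

  open ℝ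

  infix 4 _≃_
  _≃_ : ℝ → ℝ → Set
  x ≃ y = ∀ ε → 0ℚ < ε → ∃ λ N → ∀ n → N ℕ.≤ n → ∣ at x n - at y n ∣ < ε

  private
    module One = Small {ℕ} (λ n N → N ℕ.≤ n) ℕ.≤-trans
    module Two = Small {ℕ × ℕ} (λ i N → N ℕ.≤ proj₁ i × N ℕ.≤ proj₂ i)
                       (λ M≤N (p , q) → ℕ.≤-trans M≤N p , ℕ.≤-trans M≤N q)

    curryC : ∀ {f : ℕ → ℚ} → Two.Small (λ (m , n) → f m - f n) →
             ∀ ε → 0ℚ < ε → ∃ λ N → ∀ m n → N ℕ.≤ m → N ℕ.≤ n → ∣ f m - f n ∣ < ε
    curryC s ε ε>0 with s ε ε>0
    ... | N , h = N , λ m n p q → h (m , n) (p , q)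

    uncurryC : ∀ x → Two.Small (λ (m , n) → at x m - at x n)
    uncurryC x ε ε>0 with cauchy x ε ε>0
    ... | N , h = N , λ (m , n) (p , q) → h m n p q

    ≗⇒≃ : ∀ {x y} → (∀ n → at x n ≡ at y n) → x ≃ y
    ≗⇒≃ {x} {y} eq = One.small-0 λ n → trans (cong (_- at y n) (eq n)) (ℚ.+-inverseʳ (at y n))

    bounded : ∀ x → One.Bounded (at x)
    bounded x with cauchy x 1ℚ (ℚ.positive⁻¹ 1ℚ)
    ... | N , h = ∣ at x N ∣ + 1ℚ
                , ℚ.<-≤-trans (ℚ.positive⁻¹ 1ℚ) (subst (_≤ ∣ at x N ∣ + 1ℚ) (ℚ.+-identityˡ 1ℚ) (ℚ.+-monoˡ-≤ 1ℚ (ℚ.0≤∣p∣ (at x N))))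
                , N , λ n N≤n →
      subst (λ q → ∣ q ∣ ≤ ∣ at x N ∣ + 1ℚ) (a+[b-a] (at x N) (at x n))
        (ℚ.≤-trans (ℚ.∣p+q∣≤∣p∣+∣q∣ (at x N) (at x n - at x N))
          (ℚ.+-monoʳ-≤ ∣ at x N ∣ (ℚ.<⇒≤ (h n N N≤n ℕ.≤-refl))))

    bounded₁ : ∀ x → Two.Bounded (λ i → at x (proj₁ i))
    bounded₁ x with bounded x
    ... | B , B>0 , N , h = B , B>0 , N , λ i p → h (proj₁ i) (proj₁ p)

    bounded₂ : ∀ x → Two.Bounded (λ i → at x (proj₂ i))
    bounded₂ x with bounded x
    ... | B , B>0 , N , h = B , B>0 , N , λ i p → h (proj₂ i) (proj₂ p)

  const : ℚ → ℝ
  const q = real (λ _ → q) (curryC {λ _ → q} (Two.small-0 λ _ → ℚ.+-inverseʳ q))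

  infixl 6 _⊕_
  infixl 7 _⊗_
  infix 8 ⊖_

  _⊕_ : ℝ → ℝ → ℝ
  x ⊕ y = real (λ n → at x n + at y n)
    (curryC {λ n → at x n + at y n} (Two.small-cong (λ (m , n) → [a-b]+[c-d] (at x m) (at x n) (at y m) (at y n))
      (Two.small-+ (uncurryC x) (uncurryC y))))

  ⊖_ : ℝ → ℝ
  ⊖ x = real (λ n → - at x n)
    (curryC {λ n → - at x n} (Two.small-cong (λ (m , n) → ℚ.neg-distrib-+ (at x m) (- at x n)) (Two.small-neg (uncurryC x))))

  _⊗_ : ℝ → ℝ → ℝ
  x ⊗ y = real (λ n → at x n * at y n)
    (curryC {λ n → at x n * at y n} (Two.small-cong (λ (m , n) → a[c-d]+d[a-b] (at x m) (at x n) (at y m) (at y n))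
      (Two.small-+ (Two.small-* (bounded₁ x) (uncurryC y)) (Two.small-* (bounded₂ y) (uncurryC x)))))

  private
    ≃-sym : ∀ {x y} → x ≃ y → y ≃ x
    ≃-sym {x} {y} p = One.small-cong (λ n → -[a-b] (at x n) (at y n)) (One.small-neg p)

    ≃-trans : ∀ {x y z} → x ≃ y → y ≃ z → x ≃ z
    ≃-trans {x} {y} {z} p q =
      One.small-cong (λ n → [a-b]+[b-c] (at x n) (at y n) (at z n)) (One.small-+ p q)

    ⊕-cong : ∀ {x y u v} → x ≃ y → u ≃ v → x ⊕ u ≃ y ⊕ v
    ⊕-cong {x} {y} {u} {v} p q =
      One.small-cong (λ n → [a-b]+[c-d] (at x n) (at y n) (at u n) (at v n)) (One.small-+ p q)

    ⊖-cong : ∀ {x y} → x ≃ y → ⊖ x ≃ ⊖ y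
    ⊖-cong {x} {y} p = One.small-cong (λ n → ℚ.neg-distrib-+ (at x n) (- at y n)) (One.small-neg p)

    ⊗-cong : ∀ {x y u v} → x ≃ y → u ≃ v → x ⊗ u ≃ y ⊗ v
    ⊗-cong {x} {y} {u} {v} p q =
      One.small-cong (λ n → a[c-d]+d[a-b] (at x n) (at y n) (at u n) (at v n))
        (One.small-+ (One.small-* (bounded x) q) (One.small-* (bounded v) p))

  ℝ-commutativeRing : CommutativeRing 0ℓ 0ℓ
  ℝ-commutativeRing = record
    { Carrier = ℝ
    ; _≈_ = _≃_
    ; _+_ = _⊕_
    ; _*_ = _⊗_
    ; -_ = ⊖_
    ; 0# = const 0ℚ
    ; 1# = const 1ℚ
    ; isCommutativeRing = record
      { isRing = record
        { +-isAbelianGroup = record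
          { isGroup = record
            { isMonoid = record
              { isSemigroup = record
                { isMagma = record
                  { isEquivalence = record
                    { refl = λ {x} → ≗⇒≃ {x} {x} λ _ → refl
                    ; sym = λ {x} {y} → ≃-sym {x} {y}
                    ; trans = λ {x} {y} {z} → ≃-trans {x} {y} {z}
                    }
                  ; ∙-cong = λ {x} {y} {u} {v} → ⊕-cong {x} {y} {u} {v}
                  }
                ; assoc = λ x y z → ≗⇒≃ {(x ⊕ y) ⊕ z} {x ⊕ (y ⊕ z)} λ n → ℚ.+-assoc (at x n) (at y n) (at z n)
                }
              ; identity = (λ x → ≗⇒≃ {const 0ℚ ⊕ x} {x} λ n → ℚ.+-identityˡ (at x n))
                         , (λ x → ≗⇒≃ {x ⊕ const 0ℚ} {x} λ n → ℚ.+-identityʳ (at x n))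
              }
            ; inverse = (λ x → ≗⇒≃ {⊖ x ⊕ x} {const 0ℚ} λ n → ℚ.+-inverseˡ (at x n))
                      , (λ x → ≗⇒≃ {x ⊕ ⊖ x} {const 0ℚ} λ n → ℚ.+-inverseʳ (at x n))
            ; ⁻¹-cong = λ {x} {y} → ⊖-cong {x} {y}
            }
          ; comm = λ x y → ≗⇒≃ {x ⊕ y} {y ⊕ x} λ n → ℚ.+-comm (at x n) (at y n)
          }
        ; *-cong = λ {x} {y} {u} {v} → ⊗-cong {x} {y} {u} {v}
        ; *-assoc = λ x y z → ≗⇒≃ {(x ⊗ y) ⊗ z} {x ⊗ (y ⊗ z)} λ n → ℚ.*-assoc (at x n) (at y n) (at z n)
        ; *-identity = (λ x → ≗⇒≃ {const 1ℚ ⊗ x} {x} λ n → ℚ.*-identityˡ (at x n))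
                     , (λ x → ≗⇒≃ {x ⊗ const 1ℚ} {x} λ n → ℚ.*-identityʳ (at x n))
        ; distrib = (λ x y z → ≗⇒≃ {x ⊗ (y ⊕ z)} {(x ⊗ y) ⊕ (x ⊗ z)} λ n → ℚ.*-distribˡ-+ (at x n) (at y n) (at z n))
                  , (λ x y z → ≗⇒≃ {(y ⊕ z) ⊗ x} {(y ⊗ x) ⊕ (z ⊗ x)} λ n → ℚ.*-distribʳ-+ (at x n) (at y n) (at z n))
        }
      ; *-comm = λ x y → ≗⇒≃ {x ⊗ y} {y ⊗ x} λ n → ℚ.*-comm (at x n) (at y n)
      }
    }

module LinearAlgebra where

  open import Algebra.Bundles using (CommutativeMonoid; CommutativeRing)
  open import Algebra.Module.Bundles using (LeftModule)
  open import Algebra.Module.Morphism.Structures using (module LeftModuleMorphisms)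
  import Algebra.Properties.CommutativeMonoid.Sum as MonoidSum
  import Algebra.Properties.AbelianGroup as AbelianGroupProperties
  import Algebra.Properties.CommutativeSemigroup as CommutativeSemigroupProperties
  open import Data.Fin.Base using (Fin)
  open import Data.Nat.Base using (ℕ)
  open import Data.Product.Base using (Σ; _,_)
  open import Function.Bundles using (Inverse)
  open import Level using (_⊔_; suc)
  open import Relation.Binary.Bundles using (Setoid)
  open import Relation.Binary.PropositionalEquality as ≡ using (_≡_)
  import Function.Construct.Composition as Compose
  import Function.Construct.Symmetry as Symmetry

  -- Finite in the sense of being listed without repetition, up to ≈.
  Finite : ∀ {s ℓ} → Setoid s ℓ → Set (s ⊔ ℓ)
  Finite S = Σ ℕ λ n → Inverse (≡.setoid (Fin n)) S

  module Modules {r ℓr} (R : CommutativeRing r ℓr) where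

    private module R = CommutativeRing R

    Module : ∀ m ℓm → Set (r ⊔ ℓr ⊔ suc (m ⊔ ℓm))
    Module = LeftModule R.ring

    record LinearMap {m ℓm n ℓn} (M : Module m ℓm) (N : Module n ℓn)
           : Set (r ⊔ m ⊔ ℓm ⊔ n ⊔ ℓn) where
      private
        module M = LeftModule M
        module N = LeftModule N
      open LeftModuleMorphisms M.rawLeftModule N.rawLeftModule
      field
        ⟦_⟧                      : M.Carrierᴹ → N.Carrierᴹ
        isLeftModuleHomomorphism : IsLeftModuleHomomorphism ⟦_⟧
      open IsLeftModuleHomomorphism isLeftModuleHomomorphism public

    open LinearMap

    module _ {m ℓm n ℓn} {M : Module m ℓm} {N : Module n ℓn} where
      private
        module M = LeftModule M
        module N = LeftModule N

      linear : (f : M.Carrierᴹ → N.Carrierᴹ) →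
               (∀ {x y} → x M.≈ᴹ y → f x N.≈ᴹ f y) →
               (∀ x y → f (x M.+ᴹ y) N.≈ᴹ f x N.+ᴹ f y) →
               f M.0ᴹ N.≈ᴹ N.0ᴹ →
               (∀ x → f (M.-ᴹ x) N.≈ᴹ N.-ᴹ f x) →
               (∀ a x → f (a M.*ₗ x) N.≈ᴹ a N.*ₗ f x) →
               LinearMap M N
      linear f f-cong f-+ f-0 f-neg f-* = record
        { ⟦_⟧ = f
        ; isLeftModuleHomomorphism = record
          { +ᴹ-isGroupHomomorphism = record
            { isMonoidHomomorphism = record
              { isMagmaHomomorphism = record
                { isRelHomomorphism = record { cong = f-cong }
                ; homo = f-+
                }
              ; ε-homo = f-0
              }
            ; ⁻¹-homo = f-neg
            }
          ; *ₗ-homo = f-*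
          }
        }

    idᴸ : ∀ {m ℓm} {M : Module m ℓm} → LinearMap M M
    idᴸ {M = M} = linear (λ x → x) (λ p → p) (λ _ _ → ≈ᴹ-refl) ≈ᴹ-refl (λ _ → ≈ᴹ-refl) (λ _ _ → ≈ᴹ-refl)
      where open LeftModule M

    infixr 9 _∘ᴸ_
    _∘ᴸ_ : ∀ {l ℓl m ℓm n ℓn} {L : Module l ℓl} {M : Module m ℓm} {N : Module n ℓn} →
           LinearMap M N → LinearMap L M → LinearMap L N
    _∘ᴸ_ {N = N} g f = linear (λ x → ⟦ g ⟧ (⟦ f ⟧ x))
      (λ p → ⟦⟧-cong g (⟦⟧-cong f p))
      (λ x y → ≈ᴹ-trans (⟦⟧-cong g (+ᴹ-homo f x y)) (+ᴹ-homo g _ _))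
      (≈ᴹ-trans (⟦⟧-cong g (0ᴹ-homo f)) (0ᴹ-homo g))
      (λ x → ≈ᴹ-trans (⟦⟧-cong g (-ᴹ-homo f x)) (-ᴹ-homo g _))
      (λ a x → ≈ᴹ-trans (⟦⟧-cong g (*ₗ-homo f a x)) (*ₗ-homo g a _))
      where open LeftModule N

    module _ {m ℓm n ℓn} (M : Module m ℓm) (N : Module n ℓn) where
      private
        module M = LeftModule M
      open LeftModule N
      open AbelianGroupProperties +ᴹ-abelianGroup using (⁻¹-∙-comm; ε⁻¹≈ε)
      open CommutativeSemigroupProperties (CommutativeMonoid.commutativeSemigroup +ᴹ-commutativeMonoid)
        using (interchange)
      private
        *ₗ-comm : ∀ a b x → a *ₗ (b *ₗ x) ≈ᴹ b *ₗ (a *ₗ x)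
        *ₗ-comm a b x = ≈ᴹ-trans (≈ᴹ-sym (*ₗ-assoc a b x))
          (≈ᴹ-trans (*ₗ-congʳ (R.*-comm a b)) (*ₗ-assoc b a x))

        *ₗ-neg : ∀ a x → a *ₗ (-ᴹ x) ≈ᴹ -ᴹ (a *ₗ x)
        *ₗ-neg a x = inverseʳ-unique (a *ₗ x) (a *ₗ (-ᴹ x))
          (≈ᴹ-trans (≈ᴹ-sym (*ₗ-distribˡ a x (-ᴹ x)))
            (≈ᴹ-trans (*ₗ-congˡ (-ᴹ‿inverseʳ x)) (*ₗ-zeroʳ a)))
          where open AbelianGroupProperties +ᴹ-abelianGroup using (inverseʳ-unique)

      Hom : Module (r ⊔ m ⊔ ℓm ⊔ n ⊔ ℓn) (m ⊔ ℓn)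
      Hom = record
        { Carrierᴹ = LinearMap M N
        ; _≈ᴹ_ = λ f g → ∀ x → ⟦ f ⟧ x ≈ᴹ ⟦ g ⟧ x
        ; _+ᴹ_ = λ f g → linear (λ x → ⟦ f ⟧ x +ᴹ ⟦ g ⟧ x)
            (λ p → +ᴹ-cong (⟦⟧-cong f p) (⟦⟧-cong g p))
            (λ x y → ≈ᴹ-trans (+ᴹ-cong (+ᴹ-homo f x y) (+ᴹ-homo g x y)) (interchange _ _ _ _))
            (≈ᴹ-trans (+ᴹ-cong (0ᴹ-homo f) (0ᴹ-homo g)) (+ᴹ-identityˡ 0ᴹ))
            (λ x → ≈ᴹ-trans (+ᴹ-cong (-ᴹ-homo f x) (-ᴹ-homo g x)) (⁻¹-∙-comm _ _))
            (λ a x → ≈ᴹ-trans (+ᴹ-cong (*ₗ-homo f a x) (*ₗ-homo g a x)) (≈ᴹ-sym (*ₗ-distribˡ a _ _)))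
        ; _*ₗ_ = λ a f → linear (λ x → a *ₗ ⟦ f ⟧ x)
            (λ p → *ₗ-congˡ (⟦⟧-cong f p))
            (λ x y → ≈ᴹ-trans (*ₗ-congˡ (+ᴹ-homo f x y)) (*ₗ-distribˡ a _ _))
            (≈ᴹ-trans (*ₗ-congˡ (0ᴹ-homo f)) (*ₗ-zeroʳ a))
            (λ x → ≈ᴹ-trans (*ₗ-congˡ (-ᴹ-homo f x)) (*ₗ-neg a _))
            (λ b x → ≈ᴹ-trans (*ₗ-congˡ (*ₗ-homo f b x)) (*ₗ-comm a b _))
        ; 0ᴹ = linear (λ _ → 0ᴹ) (λ _ → ≈ᴹ-refl)
            (λ _ _ → ≈ᴹ-sym (+ᴹ-identityˡ 0ᴹ)) ≈ᴹ-refl (λ _ → ≈ᴹ-sym ε⁻¹≈ε) (λ a _ → ≈ᴹ-sym (*ₗ-zeroʳ a))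
        ; -ᴹ_ = λ f → linear (λ x → -ᴹ ⟦ f ⟧ x)
            (λ p → -ᴹ‿cong (⟦⟧-cong f p))
            (λ x y → ≈ᴹ-trans (-ᴹ‿cong (+ᴹ-homo f x y)) (≈ᴹ-sym (⁻¹-∙-comm _ _)))
            (≈ᴹ-trans (-ᴹ‿cong (0ᴹ-homo f)) ε⁻¹≈ε)
            (λ x → -ᴹ‿cong (-ᴹ-homo f x))
            (λ a x → ≈ᴹ-trans (-ᴹ‿cong (*ₗ-homo f a x)) (≈ᴹ-sym (*ₗ-neg a _)))
        ; isLeftModule = record
          { isLeftSemimodule = record
            { +ᴹ-isCommutativeMonoid = record
              { isMonoid = record
                { isSemigroup = record
                  { isMagma = record
                    { isEquivalence = record
                      { refl = λ _ → ≈ᴹ-refl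
                      ; sym = λ p x → ≈ᴹ-sym (p x)
                      ; trans = λ p q x → ≈ᴹ-trans (p x) (q x)
                      }
                    ; ∙-cong = λ p q x → +ᴹ-cong (p x) (q x)
                    }
                  ; assoc = λ f g h x → +ᴹ-assoc _ _ _
                  }
                ; identity = (λ f x → +ᴹ-identityˡ _) , (λ f x → +ᴹ-identityʳ _)
                }
              ; comm = λ f g x → +ᴹ-comm _ _
              }
            ; isPreleftSemimodule = record
              { *ₗ-cong = λ p q x → *ₗ-cong p (q x)
              ; *ₗ-zeroˡ = λ f x → *ₗ-zeroˡ _
              ; *ₗ-distribʳ = λ f a b x → *ₗ-distribʳ _ a b
              ; *ₗ-identityˡ = λ f x → *ₗ-identityˡ _
              ; *ₗ-assoc = λ a b f x → *ₗ-assoc a b _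
              ; *ₗ-zeroʳ = λ a x → *ₗ-zeroʳ a
              ; *ₗ-distribˡ = λ a f g x → *ₗ-distribˡ a _ _
              }
            }
          ; -ᴹ‿cong = λ p x → -ᴹ‿cong (p x)
          ; -ᴹ‿inverse = (λ f x → -ᴹ‿inverseˡ _) , (λ f x → -ᴹ‿inverseʳ _)
          }
        }

    module _ {m ℓm} (M : Module m ℓm) where
      open LeftModule M
      open MonoidSum +ᴹ-commutativeMonoid using (sum; sum-cong-≋; sum-permute)

      ∑ : ∀ {s ℓ} {S : Setoid s ℓ} → Finite S → (Setoid.Carrier S → Carrierᴹ) → Carrierᴹ
      ∑ (n , enum) f = sum (λ i → f (Inverse.to enum i))

      ∑-cong : ∀ {s ℓ} {S : Setoid s ℓ} (F : Finite S) {f g : Setoid.Carrier S → Carrierᴹ} →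
               (∀ x → f x ≈ᴹ g x) → ∑ F f ≈ᴹ ∑ F g
      ∑-cong (n , enum) p = sum-cong-≋ (λ i → p (Inverse.to enum i))

      ∑-reindex : ∀ {s ℓ t ℓ′} {S : Setoid s ℓ} {T : Setoid t ℓ′}
                  (F : Finite S) (G : Finite T) (φ : Inverse S T)
                  {f : Setoid.Carrier S → Carrierᴹ} {g : Setoid.Carrier T → Carrierᴹ} →
                  (∀ x y → Setoid._≈_ T (Inverse.to φ x) y → f x ≈ᴹ g y) →
                  ∑ F f ≈ᴹ ∑ G g
      ∑-reindex {T = T} (m , F) (n , G) φ {f} {g} p = ≈ᴹ-trans
        (sum-cong-≋ (λ i → p (Inverse.to F i) _ (Setoid.sym T (Inverse.strictlyInverseˡ G _))))
        (≈ᴹ-sym (sum-permute (λ j → g (Inverse.to G j))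
          (Compose.inverse (Compose.inverse F φ) (Symmetry.inverse G))))

    module FreeModule {s ℓs} (S : Setoid s ℓs) where
      private module S = Setoid S

      infixl 6 _⊞_
      infixr 7 _·_
      infix  8 ⊟_
      infix  4 _≋_

      data Combination : Set (r ⊔ s) where
        δ   : S.Carrier → Combination
        𝟘   : Combination
        _⊞_ : Combination → Combination → Combination
        ⊟_  : Combination → Combination
        _·_ : R.Carrier → Combination → Combination

      -- The least congruence that identifies equal generators and satisfies the module axioms.
      data _≋_ : Combination → Combination → Set (r ⊔ ℓr ⊔ s ⊔ ℓs) where
        δ-cong      : ∀ {x y} → x S.≈ y → δ x ≋ δ y
        ≋-refl      : ∀ {u} → u ≋ u
        ≋-sym       : ∀ {u v} → u ≋ v → v ≋ u
        ≋-trans     : ∀ {u v w} → u ≋ v → v ≋ w → u ≋ w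
        ⊞-cong      : ∀ {u u′ v v′} → u ≋ u′ → v ≋ v′ → u ⊞ v ≋ u′ ⊞ v′
        ⊟-cong      : ∀ {u v} → u ≋ v → ⊟ u ≋ ⊟ v
        ·-cong      : ∀ {a b u v} → a R.≈ b → u ≋ v → a · u ≋ b · v
        ⊞-assoc     : ∀ u v w → (u ⊞ v) ⊞ w ≋ u ⊞ (v ⊞ w)
        ⊞-comm      : ∀ u v → u ⊞ v ≋ v ⊞ u
        ⊞-identityˡ : ∀ u → 𝟘 ⊞ u ≋ u
        ⊟-inverseˡ  : ∀ u → ⊟ u ⊞ u ≋ 𝟘
        ·-distribˡ  : ∀ a u v → a · (u ⊞ v) ≋ a · u ⊞ a · v
        ·-distribʳ  : ∀ u a b → (a R.+ b) · u ≋ a · u ⊞ b · u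
        ·-assoc     : ∀ a b u → (a R.* b) · u ≋ a · (b · u)
        ·-identityˡ : ∀ u → R.1# · u ≋ u
        ·-zeroˡ     : ∀ u → R.0# · u ≋ 𝟘
        ·-zeroʳ     : ∀ a → a · 𝟘 ≋ 𝟘

      Free : Module (r ⊔ s) (r ⊔ ℓr ⊔ s ⊔ ℓs)
      Free = record
        { Carrierᴹ = Combination
        ; _≈ᴹ_ = _≋_
        ; _+ᴹ_ = _⊞_
        ; _*ₗ_ = _·_
        ; 0ᴹ = 𝟘
        ; -ᴹ_ = ⊟_
        ; isLeftModule = record
          { isLeftSemimodule = record
            { +ᴹ-isCommutativeMonoid = record
              { isMonoid = record
                { isSemigroup = record
                  { isMagma = record
                    { isEquivalence = record { refl = ≋-refl ; sym = ≋-sym ; trans = ≋-trans }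
                    ; ∙-cong = ⊞-cong
                    }
                  ; assoc = ⊞-assoc
                  }
                ; identity = ⊞-identityˡ , λ u → ≋-trans (⊞-comm u 𝟘) (⊞-identityˡ u)
                }
              ; comm = ⊞-comm
              }
            ; isPreleftSemimodule = record
              { *ₗ-cong = ·-cong
              ; *ₗ-zeroˡ = ·-zeroˡ
              ; *ₗ-distribʳ = ·-distribʳ
              ; *ₗ-identityˡ = ·-identityˡ
              ; *ₗ-assoc = ·-assoc
              ; *ₗ-zeroʳ = ·-zeroʳ
              ; *ₗ-distribˡ = ·-distribˡ
              }
            }
          ; -ᴹ‿cong = ⊟-cong
          ; -ᴹ‿inverse = ⊟-inverseˡ , λ u → ≋-trans (⊞-comm u (⊟ u)) (⊟-inverseˡ u)
          }
        }

      module _ {m ℓm} (M : Module m ℓm) (f : S.Carrier → LeftModule.Carrierᴹ M)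
               (f-cong : ∀ {x y} → x S.≈ y → LeftModule._≈ᴹ_ M (f x) (f y)) where
        open LeftModule M

        private
          ext : Combination → Carrierᴹ
          ext (δ x)   = f x
          ext 𝟘       = 0ᴹ
          ext (u ⊞ v) = ext u +ᴹ ext v
          ext (⊟ u)   = -ᴹ ext u
          ext (a · u) = a *ₗ ext u

          ext-cong : ∀ {u v} → u ≋ v → ext u ≈ᴹ ext v
          ext-cong (δ-cong p)          = f-cong p
          ext-cong ≋-refl              = ≈ᴹ-refl
          ext-cong (≋-sym p)           = ≈ᴹ-sym (ext-cong p)
          ext-cong (≋-trans p q)       = ≈ᴹ-trans (ext-cong p) (ext-cong q)
          ext-cong (⊞-cong p q)        = +ᴹ-cong (ext-cong p) (ext-cong q)
          ext-cong (⊟-cong p)          = -ᴹ‿cong (ext-cong p)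
          ext-cong (·-cong p q)        = *ₗ-cong p (ext-cong q)
          ext-cong (⊞-assoc u v w)     = +ᴹ-assoc _ _ _
          ext-cong (⊞-comm u v)        = +ᴹ-comm _ _
          ext-cong (⊞-identityˡ u)     = +ᴹ-identityˡ _
          ext-cong (⊟-inverseˡ u)      = -ᴹ‿inverseˡ _
          ext-cong (·-distribˡ a u v)  = *ₗ-distribˡ a _ _
          ext-cong (·-distribʳ u a b)  = *ₗ-distribʳ _ a b
          ext-cong (·-assoc a b u)     = *ₗ-assoc a b _
          ext-cong (·-identityˡ u)     = *ₗ-identityˡ _
          ext-cong (·-zeroˡ u)         = *ₗ-zeroˡ _
          ext-cong (·-zeroʳ a)         = *ₗ-zeroʳ a

        linearExtension : LinearMap Free M
        linearExtension = linear ext ext-cong (λ _ _ → ≈ᴹ-refl) ≈ᴹ-refl (λ _ → ≈ᴹ-refl) (λ _ _ → ≈ᴹ-refl)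

    open FreeModule using (Free; linearExtension)

    module _ {s ℓs t ℓt} (S : Setoid s ℓs) (T : Setoid t ℓt) {m ℓm} (M : Module m ℓm) where
      private
        module S = Setoid S
        module T = Setoid T
        module M = LeftModule M

      bilinearExtension : (f : S.Carrier → T.Carrier → M.Carrierᴹ) →
                          (∀ {x x′ y y′} → x S.≈ x′ → y T.≈ y′ → f x y M.≈ᴹ f x′ y′) →
                          LinearMap (Free S) (Hom (Free T) M)
      bilinearExtension f f-cong =
        linearExtension S (Hom (Free T) M) (λ x → linearExtension T M (f x) (f-cong S.refl)) λ {x} {x′} p → agree x x′ p
        where
        open FreeModule T using (Combination; δ; 𝟘; _⊞_; ⊟_; _·_)
        agree : ∀ x x′ → x S.≈ x′ → ∀ u →
                ⟦ linearExtension T M (f x) (f-cong S.refl) ⟧ u M.≈ᴹ ⟦ linearExtension T M (f x′) (f-cong S.refl) ⟧ u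
        agree x x′ p (δ y)   = f-cong p T.refl
        agree x x′ p 𝟘       = M.≈ᴹ-refl
        agree x x′ p (u ⊞ v) = M.+ᴹ-cong (agree x x′ p u) (agree x x′ p v)
        agree x x′ p (⊟ u)   = M.-ᴹ‿cong (agree x x′ p u)
        agree x x′ p (a · u) = M.*ₗ-congˡ (agree x x′ p u)

    -- The data of a unital algebra; associativity and unitality are not recorded.
    record RawUnitalAlgebra m ℓm : Set (r ⊔ ℓr ⊔ suc (m ⊔ ℓm)) where
      field
        underlying : Module m ℓm
      open LeftModule underlying public
      field
        _⊙_ : Carrierᴹ → Carrierᴹ → Carrierᴹ
        𝟙   : Carrierᴹ

    End : ∀ {m ℓm} → Module m ℓm → RawUnitalAlgebra (r ⊔ m ⊔ ℓm) (m ⊔ ℓm)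
    End M = record { underlying = Hom M M ; _⊙_ = _∘ᴸ_ ; 𝟙 = idᴸ }

    record IsUnitalAlgebraHomomorphism {m ℓm n ℓn}
           (A : RawUnitalAlgebra m ℓm) (B : RawUnitalAlgebra n ℓn)
           (φ : RawUnitalAlgebra.Carrierᴹ A → RawUnitalAlgebra.Carrierᴹ B)
           : Set (r ⊔ m ⊔ ℓm ⊔ n ⊔ ℓn) where
      private
        module A = RawUnitalAlgebra A
        module B = RawUnitalAlgebra B
      open LeftModuleMorphisms A.rawLeftModule B.rawLeftModule
      field
        isLeftModuleHomomorphism : IsLeftModuleHomomorphism φ
        𝟙-homo : φ A.𝟙 B.≈ᴹ B.𝟙
        ⊙-homo : ∀ x y → φ (x A.⊙ y) B.≈ᴹ (φ x B.⊙ φ y)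

module Categories where

  open import Data.Product.Base using (Σ; _×_; _,_; proj₁; proj₂)
  open import Function.Bundles using (_⇔_)
  open import Level using (_⊔_; suc)
  open import Relation.Binary.Bundles using (Setoid)
  open import Relation.Binary.Structures using (IsEquivalence)
  import Relation.Binary.Reasoning.Setoid as SetoidReasoning
  open LinearAlgebra using (Finite)

  record Category o ℓ e : Set (suc (o ⊔ ℓ ⊔ e)) where
    infix  4 _⇒_ _≈_
    infixr 9 _∘_
    field
      Obj       : Set o
      _⇒_       : Obj → Obj → Set ℓ
      _≈_       : ∀ {A B} → A ⇒ B → A ⇒ B → Set e
      id        : ∀ {A} → A ⇒ A
      _∘_       : ∀ {A B C} → B ⇒ C → A ⇒ B → A ⇒ C
      equiv     : ∀ {A B} → IsEquivalence (_≈_ {A} {B})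
      assoc     : ∀ {A B C D} {f : A ⇒ B} {g : B ⇒ C} {h : C ⇒ D} → (h ∘ g) ∘ f ≈ h ∘ (g ∘ f)
      identityˡ : ∀ {A B} {f : A ⇒ B} → id ∘ f ≈ f
      identityʳ : ∀ {A B} {f : A ⇒ B} → f ∘ id ≈ f
      ∘-cong    : ∀ {A B C} {f h : B ⇒ C} {g i : A ⇒ B} → f ≈ h → g ≈ i → f ∘ g ≈ h ∘ i

    homSetoid : Obj → Obj → Setoid ℓ e
    homSetoid A B = record { Carrier = A ⇒ B ; _≈_ = _≈_ ; isEquivalence = equiv }

  module CategoryTheory {o ℓ e} (𝐂 : Category o ℓ e) where

    open Category 𝐂 public

    module _ {A B : Obj} where
      open IsEquivalence (equiv {A} {B}) public
        using () renaming (refl to ≈-refl; sym to ≈-sym; trans to ≈-trans)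
      open SetoidReasoning (homSetoid A B) public

    private
      variable
        A B C D A′ B′ C′ D′ K X Y Z : Obj

    infixr 4 _⟩∘⟨_
    _⟩∘⟨_ : {f h : B ⇒ C} {g i : A ⇒ B} → f ≈ h → g ≈ i → f ∘ g ≈ h ∘ i
    _⟩∘⟨_ = ∘-cong

    ∘-congˡ : {f : B ⇒ C} {g h : A ⇒ B} → g ≈ h → f ∘ g ≈ f ∘ h
    ∘-congˡ p = ∘-cong ≈-refl p

    ∘-congʳ : {f g : B ⇒ C} {h : A ⇒ B} → f ≈ g → f ∘ h ≈ g ∘ h
    ∘-congʳ p = ∘-cong p ≈-refl

    pullʳ : {f : C ⇒ D} {g : B ⇒ C} {h : A ⇒ B} {k : A ⇒ C} → g ∘ h ≈ k → (f ∘ g) ∘ h ≈ f ∘ k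
    pullʳ p = ≈-trans assoc (∘-congˡ p)

    pullˡ : {f : C ⇒ D} {g : B ⇒ C} {h : A ⇒ B} {k : B ⇒ D} → f ∘ g ≈ k → f ∘ (g ∘ h) ≈ k ∘ h
    pullˡ p = ≈-trans (≈-sym assoc) (∘-congʳ p)

    glue : {a : A ⇒ A′} {b : B ⇒ B′} {c : C ⇒ C′} {f : A ⇒ B} {g : B ⇒ C} {f′ : A′ ⇒ B′} {g′ : B′ ⇒ C′} →
           b ∘ f ≈ f′ ∘ a → c ∘ g ≈ g′ ∘ b → c ∘ (g ∘ f) ≈ (g′ ∘ f′) ∘ a
    glue p q = ≈-trans (pullˡ q) (≈-trans (pullʳ p) (≈-sym assoc))

    Mono : A ⇒ B → Set (o ⊔ ℓ ⊔ e)
    Mono {A} f = ∀ {X} (g h : X ⇒ A) → f ∘ g ≈ f ∘ h → g ≈ h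

    IsIso : A ⇒ B → Set (ℓ ⊔ e)
    IsIso {A} {B} f = Σ (B ⇒ A) λ g → (g ∘ f ≈ id) × (f ∘ g ≈ id)

    infix 4 _≅_
    record _≅_ (A B : Obj) : Set (ℓ ⊔ e) where
      field
        from : A ⇒ B
        to   : B ⇒ A
        isoˡ : to ∘ from ≈ id
        isoʳ : from ∘ to ≈ id

      cancelˡ : {f : X ⇒ A} → to ∘ (from ∘ f) ≈ f
      cancelˡ = ≈-trans (pullˡ isoˡ) identityˡ

      cancelʳ : {f : X ⇒ B} → from ∘ (to ∘ f) ≈ f
      cancelʳ = ≈-trans (pullˡ isoʳ) identityˡ

    open _≅_ public

    ≅-refl : A ≅ A
    ≅-refl = record { from = id ; to = id ; isoˡ = identityˡ ; isoʳ = identityˡ }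

    ≅-sym : A ≅ B → B ≅ A
    ≅-sym φ = record { from = to φ ; to = from φ ; isoˡ = isoʳ φ ; isoʳ = isoˡ φ }

    ≅-trans : A ≅ B → B ≅ C → A ≅ C
    ≅-trans φ ψ = record
      { from = from ψ ∘ from φ
      ; to   = to φ ∘ to ψ
      ; isoˡ = ≈-trans (pullʳ (cancelˡ ψ)) (isoˡ φ)
      ; isoʳ = ≈-trans (pullʳ (cancelʳ φ)) (isoʳ ψ)
      }

    -- The set of isomorphism classes of objects, as a setoid.
    objects : Setoid o (ℓ ⊔ e)
    objects = record
      { Carrier = Obj
      ; _≈_ = _≅_
      ; isEquivalence = record { refl = ≅-refl ; sym = ≅-sym ; trans = ≅-trans }
      }

    reverse : (φ : A ≅ A′) (ψ : B ≅ B′) {f : A ⇒ B} {f′ : A′ ⇒ B′} →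
              from ψ ∘ f ≈ f′ ∘ from φ → to ψ ∘ f′ ≈ f ∘ to φ
    reverse φ ψ {f} {f′} p = begin
      to ψ ∘ f′                       ≈⟨ ∘-congˡ identityʳ ⟨
      to ψ ∘ (f′ ∘ id)                ≈⟨ ∘-congˡ (∘-congˡ (isoʳ φ)) ⟨
      to ψ ∘ (f′ ∘ (from φ ∘ to φ))   ≈⟨ ∘-congˡ (pullˡ (≈-sym p)) ⟩
      to ψ ∘ ((from ψ ∘ f) ∘ to φ)    ≈⟨ ∘-congˡ assoc ⟩
      to ψ ∘ (from ψ ∘ (f ∘ to φ))    ≈⟨ cancelˡ ψ ⟩
      f ∘ to φ                        ∎

    mono-resp-≈ : {f g : A ⇒ B} → f ≈ g → Mono f → Mono g
    mono-resp-≈ p m g h q = m g h (≈-trans (∘-congʳ p) (≈-trans q (∘-congʳ (≈-sym p))))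

    mono-∘ : {f : B ⇒ C} {g : A ⇒ B} → Mono f → Mono g → Mono (f ∘ g)
    mono-∘ mf mg h k p = mg h k (mf _ _ (≈-trans (≈-sym assoc) (≈-trans p assoc)))

    mono-cancel : {f : B ⇒ C} {g : A ⇒ B} → Mono (f ∘ g) → Mono g
    mono-cancel m h k p = m h k (≈-trans (pullʳ p) (≈-sym assoc))

    mono-id : Mono (id {A})
    mono-id g h p = ≈-trans (≈-sym identityˡ) (≈-trans p identityˡ)

    mono-from : (φ : A ≅ B) → Mono (from φ)
    mono-from φ g h p = ≈-trans (≈-sym (cancelˡ φ)) (≈-trans (∘-congˡ p) (cancelˡ φ))

    mono-to : (φ : A ≅ B) → Mono (to φ)
    mono-to φ = mono-from (≅-sym φ)

    Monos : Obj → Obj → Setoid (o ⊔ ℓ ⊔ e) e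
    Monos A X = record
      { Carrier = Σ (A ⇒ X) Mono
      ; _≈_ = λ f g → proj₁ f ≈ proj₁ g
      ; isEquivalence = record { refl = ≈-refl ; sym = ≈-sym ; trans = ≈-trans }
      }

    Subobjects : Obj → Setoid (o ⊔ ℓ ⊔ e) (ℓ ⊔ e)
    Subobjects X = record
      { Carrier = Σ Obj λ A → Σ (A ⇒ X) Mono
      ; _≈_ = λ (A , f , _) (B , g , _) → Σ (A ≅ B) λ φ → g ∘ from φ ≈ f
      ; isEquivalence = record
        { refl  = ≅-refl , identityʳ
        ; sym   = λ (φ , p) → ≅-sym φ ,
                    ≈-trans (∘-congʳ (≈-sym p)) (≈-trans (pullʳ (isoʳ φ)) identityʳ)
        ; trans = λ (φ , p) (ψ , q) → ≅-trans φ ψ , ≈-trans (pullˡ q) p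
        }
      }

    --   P --p₁--> A
    --   |         |
    --   p₂        f
    --   v         v
    --   B ---g--> C
    record IsPullback {P A B C} (p₁ : P ⇒ A) (p₂ : P ⇒ B) (f : A ⇒ C) (g : B ⇒ C) : Set (o ⊔ ℓ ⊔ e) where
      field
        commute   : f ∘ p₁ ≈ g ∘ p₂
        universal : ∀ {Q} {h₁ : Q ⇒ A} {h₂ : Q ⇒ B} → f ∘ h₁ ≈ g ∘ h₂ → Q ⇒ P
        p₁∘universal : ∀ {Q} {h₁ : Q ⇒ A} {h₂ : Q ⇒ B} (eq : f ∘ h₁ ≈ g ∘ h₂) → p₁ ∘ universal eq ≈ h₁
        p₂∘universal : ∀ {Q} {h₁ : Q ⇒ A} {h₂ : Q ⇒ B} (eq : f ∘ h₁ ≈ g ∘ h₂) → p₂ ∘ universal eq ≈ h₂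
        jointly-monic : ∀ {Q} {u v : Q ⇒ P} → p₁ ∘ u ≈ p₁ ∘ v → p₂ ∘ u ≈ p₂ ∘ v → u ≈ v

    --   C ---g--> B
    --   |         |
    --   f         i₂
    --   v         v
    --   A --i₁--> P
    record IsPushout {P A B C} (f : C ⇒ A) (g : C ⇒ B) (i₁ : A ⇒ P) (i₂ : B ⇒ P) : Set (o ⊔ ℓ ⊔ e) where
      field
        commute   : i₁ ∘ f ≈ i₂ ∘ g
        universal : ∀ {Q} {h₁ : A ⇒ Q} {h₂ : B ⇒ Q} → h₁ ∘ f ≈ h₂ ∘ g → P ⇒ Q
        universal∘i₁ : ∀ {Q} {h₁ : A ⇒ Q} {h₂ : B ⇒ Q} (eq : h₁ ∘ f ≈ h₂ ∘ g) → universal eq ∘ i₁ ≈ h₁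
        universal∘i₂ : ∀ {Q} {h₁ : A ⇒ Q} {h₂ : B ⇒ Q} (eq : h₁ ∘ f ≈ h₂ ∘ g) → universal eq ∘ i₂ ≈ h₂
        jointly-epic : ∀ {Q} {u v : P ⇒ Q} → u ∘ i₁ ≈ v ∘ i₁ → u ∘ i₂ ≈ v ∘ i₂ → u ≈ v

    record Pullback {A B C} (f : A ⇒ C) (g : B ⇒ C) : Set (o ⊔ ℓ ⊔ e) where
      field
        {apex}     : Obj
        p₁         : apex ⇒ A
        p₂         : apex ⇒ B
        isPullback : IsPullback p₁ p₂ f g

    record Pushout {A B C} (f : C ⇒ A) (g : C ⇒ B) : Set (o ⊔ ℓ ⊔ e) where
      field
        {apex}    : Obj
        i₁        : A ⇒ apex
        i₂        : B ⇒ apex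
        isPushout : IsPushout f g i₁ i₂

    record PushoutComplement {K O N} (f : K ⇒ O) (g : O ⇒ N) : Set (o ⊔ ℓ ⊔ e) where
      field
        {apex}    : Obj
        k         : K ⇒ apex
        g′        : apex ⇒ N
        isPushout : IsPushout f k g g′

    pullback-flip : ∀ {P} {p₁ : P ⇒ A} {p₂ : P ⇒ B} {f : A ⇒ C} {g : B ⇒ C} →
                    IsPullback p₁ p₂ f g → IsPullback p₂ p₁ g f
    pullback-flip pb = record
      { commute = ≈-sym commute
      ; universal = λ eq → universal (≈-sym eq)
      ; p₁∘universal = λ eq → p₂∘universal (≈-sym eq)
      ; p₂∘universal = λ eq → p₁∘universal (≈-sym eq)
      ; jointly-monic = λ p q → jointly-monic q p
      }
      where open IsPullback pb

    pushout-flip : ∀ {P} {f : C ⇒ A} {g : C ⇒ B} {i₁ : A ⇒ P} {i₂ : B ⇒ P} →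
                   IsPushout f g i₁ i₂ → IsPushout g f i₂ i₁
    pushout-flip po = record
      { commute = ≈-sym commute
      ; universal = λ eq → universal (≈-sym eq)
      ; universal∘i₁ = λ eq → universal∘i₂ (≈-sym eq)
      ; universal∘i₂ = λ eq → universal∘i₁ (≈-sym eq)
      ; jointly-epic = λ p q → jointly-epic q p
      }
      where open IsPushout po

    pullback-mono : ∀ {P} {p₁ : P ⇒ A} {p₂ : P ⇒ B} {f : A ⇒ C} {g : B ⇒ C} →
                    IsPullback p₁ p₂ f g → Mono g → Mono p₁
    pullback-mono {p₁ = p₁} {p₂} {f} {g} pb mg u v eq = jointly-monic eq (mg _ _ (begin
      g ∘ (p₂ ∘ u)  ≈⟨ pullˡ (≈-sym commute) ⟩
      (f ∘ p₁) ∘ u  ≈⟨ pullʳ eq ⟩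
      f ∘ (p₁ ∘ v)  ≈⟨ pullˡ commute ⟩
      (g ∘ p₂) ∘ v  ≈⟨ assoc ⟩
      g ∘ (p₂ ∘ v)  ∎))
      where open IsPullback pb

    private
      pushout-map : ∀ {P A B C P′ A′ B′ C′ : Obj}
               {f : C ⇒ A} {g : C ⇒ B} {i₁ : A ⇒ P} {i₂ : B ⇒ P}
               {f′ : C′ ⇒ A′} {g′ : C′ ⇒ B′} {i₁′ : A′ ⇒ P′} {i₂′ : B′ ⇒ P′}
               {φC : C ⇒ C′} {φA : A ⇒ A′} {φB : B ⇒ B′} →
               φA ∘ f ≈ f′ ∘ φC → φB ∘ g ≈ g′ ∘ φC →
               IsPushout f g i₁ i₂ → IsPushout f′ g′ i₁′ i₂′ →
               Σ (P ⇒ P′) λ u → (u ∘ i₁ ≈ i₁′ ∘ φA) × (u ∘ i₂ ≈ i₂′ ∘ φB)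
      pushout-map p q po po′ =
        IsPushout.universal po eq , IsPushout.universal∘i₁ po eq , IsPushout.universal∘i₂ po eq
        where
        eq = ≈-trans (pullʳ p) (≈-trans (pullˡ (IsPushout.commute po′)) (≈-trans (pullʳ (≈-sym q)) (≈-sym assoc)))

    pushout-iso : ∀ {P A B C P′ A′ B′ C′ : Obj}
             {f : C ⇒ A} {g : C ⇒ B} {i₁ : A ⇒ P} {i₂ : B ⇒ P}
             {f′ : C′ ⇒ A′} {g′ : C′ ⇒ B′} {i₁′ : A′ ⇒ P′} {i₂′ : B′ ⇒ P′}
             (φC : C ≅ C′) (φA : A ≅ A′) (φB : B ≅ B′)
             (f-comm : from φA ∘ f ≈ f′ ∘ from φC)
             (g-comm : from φB ∘ g ≈ g′ ∘ from φC) →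
             IsPushout f g i₁ i₂ → IsPushout f′ g′ i₁′ i₂′ →
             Σ (P ≅ P′) λ ψ → (from ψ ∘ i₁ ≈ i₁′ ∘ from φA) × (from ψ ∘ i₂ ≈ i₂′ ∘ from φB)
    pushout-iso φC φA φB p q po po′ = record
        { from = proj₁ M
        ; to   = proj₁ N
        ; isoˡ = IsPushout.jointly-epic po
            (≈-trans (glue-id (proj₁ (proj₂ M)) (proj₁ (proj₂ N)) (isoˡ φA)) (≈-sym identityˡ))
            (≈-trans (glue-id (proj₂ (proj₂ M)) (proj₂ (proj₂ N)) (isoˡ φB)) (≈-sym identityˡ))
        ; isoʳ = IsPushout.jointly-epic po′
            (≈-trans (glue-id (proj₁ (proj₂ N)) (proj₁ (proj₂ M)) (isoʳ φA)) (≈-sym identityˡ))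
            (≈-trans (glue-id (proj₂ (proj₂ N)) (proj₂ (proj₂ M)) (isoʳ φB)) (≈-sym identityˡ))
        } , proj₂ M
      where
      M = pushout-map p q po po′
      N = pushout-map (reverse φC φA p) (reverse φC φB q) po′ po
      glue-id : ∀ {X X′ Y Y′} {u : Y ⇒ Y′} {v : Y′ ⇒ Y} {i : X ⇒ Y} {i′ : X′ ⇒ Y′} {a : X ⇒ X′} {a′ : X′ ⇒ X} →
                u ∘ i ≈ i′ ∘ a → v ∘ i′ ≈ i ∘ a′ → a′ ∘ a ≈ id → (v ∘ u) ∘ i ≈ i
      glue-id s t r = ≈-trans (pullʳ s) (≈-trans (pullˡ t) (≈-trans (pullʳ r) identityʳ))

    pushout-transport : ∀ {P A B C P′ A′ B′ C′ : Obj}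
             {f : C ⇒ A} {g : C ⇒ B} {i₁ : A ⇒ P} {i₂ : B ⇒ P}
             {f′ : C′ ⇒ A′} {g′ : C′ ⇒ B′} {i₁′ : A′ ⇒ P′} {i₂′ : B′ ⇒ P′}
             (φC : C ≅ C′) (φA : A ≅ A′) (φB : B ≅ B′) (φP : P ≅ P′) →
             from φA ∘ f ≈ f′ ∘ from φC → from φB ∘ g ≈ g′ ∘ from φC →
             from φP ∘ i₁ ≈ i₁′ ∘ from φA → from φP ∘ i₂ ≈ i₂′ ∘ from φB →
             IsPushout f g i₁ i₂ → IsPushout f′ g′ i₁′ i₂′
    pushout-transport {f = f} {g} {i₁} {i₂} {f′} {g′} {i₁′} {i₂′} φC φA φB φP pf pg p₁ p₂ po = record
      { commute = mono-to φP _ _ (begin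
          to φP ∘ (i₁′ ∘ f′)   ≈⟨ glue (reverse φC φA pf) (reverse φA φP p₁) ⟩
          (i₁ ∘ f) ∘ to φC     ≈⟨ ∘-congʳ commute ⟩
          (i₂ ∘ g) ∘ to φC     ≈⟨ glue (reverse φC φB pg) (reverse φB φP p₂) ⟨
          to φP ∘ (i₂′ ∘ g′)   ∎)
      ; universal = λ eq → universal (shift eq) ∘ to φP
      ; universal∘i₁ = λ eq → ≈-trans (pullʳ (reverse φA φP p₁)) (≈-trans (pullˡ (universal∘i₁ (shift eq))) (≈-trans (pullʳ (isoʳ φA)) identityʳ))
      ; universal∘i₂ = λ eq → ≈-trans (pullʳ (reverse φB φP p₂)) (≈-trans (pullˡ (universal∘i₂ (shift eq))) (≈-trans (pullʳ (isoʳ φB)) identityʳ))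
      ; jointly-epic = λ {_} {u} {v} r s → cancel u v (jointly-epic
          (≈-trans (pullʳ p₁) (≈-trans (pullˡ r) (≈-trans assoc (≈-trans (∘-congˡ (≈-sym p₁)) (≈-sym assoc)))))
          (≈-trans (pullʳ p₂) (≈-trans (pullˡ s) (≈-trans assoc (≈-trans (∘-congˡ (≈-sym p₂)) (≈-sym assoc))))))
      }
      where
      open IsPushout po
      shift : ∀ {Q} {h₁ : _ ⇒ Q} {h₂ : _ ⇒ Q} → h₁ ∘ f′ ≈ h₂ ∘ g′ → (h₁ ∘ from φA) ∘ f ≈ (h₂ ∘ from φB) ∘ g
      shift eq = ≈-trans (pullʳ pf) (≈-trans (pullˡ eq) (≈-trans (pullʳ (≈-sym pg)) (≈-sym assoc)))
      cancel : ∀ {Q} (u v : _ ⇒ Q) → u ∘ from φP ≈ v ∘ from φP → u ≈ v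
      cancel u v r = begin
        u                         ≈⟨ ≈-trans (pullʳ (isoʳ φP)) identityʳ ⟨
        (u ∘ from φP) ∘ to φP     ≈⟨ ∘-congʳ r ⟩
        (v ∘ from φP) ∘ to φP     ≈⟨ ≈-trans (pullʳ (isoʳ φP)) identityʳ ⟩
        v                         ∎

    pullback-iso : ∀ {P A B C P′ A′ B′ C′ : Obj}
             {p₁ : P ⇒ A} {p₂ : P ⇒ B} {f : A ⇒ C} {g : B ⇒ C}
             {p₁′ : P′ ⇒ A′} {p₂′ : P′ ⇒ B′} {f′ : A′ ⇒ C′} {g′ : B′ ⇒ C′}
             (φA : A ≅ A′) (φB : B ≅ B′) (φC : C ≅ C′) →
             from φC ∘ f ≈ f′ ∘ from φA → from φC ∘ g ≈ g′ ∘ from φB →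
             IsPullback p₁ p₂ f g → IsPullback p₁′ p₂′ f′ g′ →
             Σ (P ≅ P′) λ ψ → (from φA ∘ p₁ ≈ p₁′ ∘ from ψ) × (from φB ∘ p₂ ≈ p₂′ ∘ from ψ)
    pullback-iso φA φB φC pf pg pb pb′ = record
        { from = to′
        ; to   = fro
        ; isoˡ = PB.jointly-monic
            (≈-trans (two (≈-sym to′₁) (≈-sym fro₁) (isoˡ φA)) (≈-sym identityʳ))
            (≈-trans (two (≈-sym to′₂) (≈-sym fro₂) (isoˡ φB)) (≈-sym identityʳ))
        ; isoʳ = PB′.jointly-monic
            (≈-trans (two (≈-sym fro₁) (≈-sym to′₁) (isoʳ φA)) (≈-sym identityʳ))
            (≈-trans (two (≈-sym fro₂) (≈-sym to′₂) (isoʳ φB)) (≈-sym identityʳ))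
        } , ≈-sym to′₁ , ≈-sym to′₂
      where
      module PB = IsPullback pb
      module PB′ = IsPullback pb′
      eq′ = ≈-trans (pullˡ (≈-sym pf)) (≈-trans (pullʳ PB.commute) (≈-trans (pullˡ pg) assoc))
      eq″ = ≈-trans (pullˡ (≈-sym (reverse φA φC pf))) (≈-trans (pullʳ PB′.commute) (≈-trans (pullˡ (reverse φB φC pg)) assoc))
      to′ = PB′.universal eq′
      to′₁ = PB′.p₁∘universal eq′
      to′₂ = PB′.p₂∘universal eq′
      fro = PB.universal eq″
      fro₁ = PB.p₁∘universal eq″
      fro₂ = PB.p₂∘universal eq″
      two : ∀ {X X′ Y Y′} {u : Y ⇒ Y′} {v : Y′ ⇒ Y} {p : Y ⇒ X} {p′ : Y′ ⇒ X′} {a : X ⇒ X′} {a′ : X′ ⇒ X} →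
            a ∘ p ≈ p′ ∘ u → a′ ∘ p′ ≈ p ∘ v → a′ ∘ a ≈ id → p ∘ (v ∘ u) ≈ p
      two r s t = ≈-trans (pullˡ (≈-sym s)) (≈-trans (pullʳ (≈-sym r)) (≈-trans (pullˡ t) identityˡ))

    --   A ---b--> D
    --   |         |
    --   a         d
    --   v         v
    --   B ---c--> C
    record IsFPC {A B C D} (c : B ⇒ C) (a : A ⇒ B) (d : D ⇒ C) (b : A ⇒ D) : Set (o ⊔ ℓ ⊔ e) where
      field
        isPullback : IsPullback a b c d
        final : ∀ {E F} {x : E ⇒ B} {y : E ⇒ F} {z : F ⇒ C} {w : E ⇒ A} →
                IsPullback x y c z → a ∘ w ≈ x → F ⇒ D
        d∘final : ∀ {E F} {x : E ⇒ B} {y : E ⇒ F} {z : F ⇒ C} {w : E ⇒ A}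
                  (pb : IsPullback x y c z) (eq : a ∘ w ≈ x) → d ∘ final pb eq ≈ z
        final∘y : ∀ {E F} {x : E ⇒ B} {y : E ⇒ F} {z : F ⇒ C} {w : E ⇒ A}
                  (pb : IsPullback x y c z) (eq : a ∘ w ≈ x) → final pb eq ∘ y ≈ b ∘ w
        unique : ∀ {E F} {x : E ⇒ B} {y : E ⇒ F} {z : F ⇒ C} {w : E ⇒ A} →
                 IsPullback x y c z → a ∘ w ≈ x → {u v : F ⇒ D} →
                 d ∘ u ≈ z → u ∘ y ≈ b ∘ w → d ∘ v ≈ z → v ∘ y ≈ b ∘ w → u ≈ v

    record FPC {A B C} (c : B ⇒ C) (a : A ⇒ B) : Set (o ⊔ ℓ ⊔ e) where
      field
        {apex} : Obj
        d      : apex ⇒ C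
        b      : A ⇒ apex
        isFPC  : IsFPC c a d b

    fpc-iso : ∀ {A B C D A′ B′ C′ D′ : Obj}
              {c : B ⇒ C} {a : A ⇒ B} {d : D ⇒ C} {b : A ⇒ D}
              {c′ : B′ ⇒ C′} {a′ : A′ ⇒ B′} {d′ : D′ ⇒ C′} {b′ : A′ ⇒ D′}
              (φA : A ≅ A′) (φB : B ≅ B′) (φC : C ≅ C′) →
              from φB ∘ a ≈ a′ ∘ from φA → from φC ∘ c ≈ c′ ∘ from φB →
              Mono d → Mono d′ → IsFPC c a d b → IsFPC c′ a′ d′ b′ →
              Σ (D ≅ D′) λ ψ → (from φC ∘ d ≈ d′ ∘ from ψ) × (from ψ ∘ b ≈ b′ ∘ from φA)
    fpc-iso {D = D} {D′ = D′} {d = d} {d′ = d′} φA φB φC pa pc md md′ F F′ = record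
        { from = proj₁ U
        ; to   = proj₁ V
        ; isoˡ = md _ _ (two (proj₁ (proj₂ U)) (proj₁ (proj₂ V)) (isoˡ φC))
        ; isoʳ = md′ _ _ (two (proj₁ (proj₂ V)) (proj₁ (proj₂ U)) (isoʳ φC))
        } , ≈-sym (proj₁ (proj₂ U)) , proj₂ (proj₂ U)
      where
      two : ∀ {X X′ Y Y′} {u : Y ⇒ Y′} {v : Y′ ⇒ Y} {p : Y ⇒ X} {p′ : Y′ ⇒ X′} {a : X ⇒ X′} {a′ : X′ ⇒ X} →
            p′ ∘ u ≈ a ∘ p → p ∘ v ≈ a′ ∘ p′ → a′ ∘ a ≈ id → p ∘ (v ∘ u) ≈ p ∘ id
      two r s t = ≈-trans (pullˡ s) (≈-trans (pullʳ r) (≈-trans (pullˡ t) (≈-trans identityˡ (≈-sym identityʳ))))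

      induced : ∀ {A B C D A′ B′ C′ D′ : Obj}
        {c : B ⇒ C} {a : A ⇒ B} {d : D ⇒ C} {b : A ⇒ D}
        {c′ : B′ ⇒ C′} {a′ : A′ ⇒ B′} {d′ : D′ ⇒ C′} {b′ : A′ ⇒ D′}
        (φA : A ≅ A′) (φB : B ≅ B′) (φC : C ≅ C′) →
        from φB ∘ a ≈ a′ ∘ from φA → from φC ∘ c ≈ c′ ∘ from φB →
        IsFPC c a d b → IsFPC c′ a′ d′ b′ →
        Σ (D ⇒ D′) λ u → (d′ ∘ u ≈ from φC ∘ d) × (u ∘ b ≈ b′ ∘ from φA)
      induced {c = c} {a} {d} {b} {c′} {a′} φA φB φC pa pc F F′ =
        F′.final square (≈-sym pa) , F′.d∘final square (≈-sym pa) , F′.final∘y square (≈-sym pa)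
        where
        module F′ = IsFPC F′
        open IsPullback (IsFPC.isPullback F)
        back : ∀ {Q} {h₁ : Q ⇒ _} {h₂ : Q ⇒ _} → c′ ∘ h₁ ≈ (from φC ∘ d) ∘ h₂ → c ∘ (to φB ∘ h₁) ≈ d ∘ h₂
        back eq = ≈-trans (pullˡ (≈-sym (reverse φB φC pc))) (≈-trans (pullʳ (≈-trans eq assoc)) (cancelˡ φC))
        square : IsPullback (from φB ∘ a) b c′ (from φC ∘ d)
        square = record
          { commute = ≈-trans (pullˡ (≈-sym pc)) (≈-trans (pullʳ commute) (≈-sym assoc))
          ; universal = λ eq → universal (back eq)
          ; p₁∘universal = λ eq → ≈-trans (pullʳ (p₁∘universal (back eq))) (cancelʳ φB)
          ; p₂∘universal = λ eq → p₂∘universal (back eq)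
          ; jointly-monic = λ r s → jointly-monic (mono-from φB _ _ (≈-trans (≈-sym assoc) (≈-trans r assoc))) s
          }

      U = induced φA φB φC pa pc F F′
      V = induced (≅-sym φA) (≅-sym φB) (≅-sym φC) (reverse φA φB pa) (reverse φB φC pc) F′ F

    -- For every commutative cube over the given square, with vertical arrows
    -- a, b, c, d and with pullbacks as the back faces (those over m and f): the
    -- top face is a pushout if and only if the front faces are pullbacks.
    IsVanKampen : {m : C ⇒ A} {f : C ⇒ B} {g : A ⇒ D} {n : B ⇒ D} → IsPushout m f g n → Set (o ⊔ ℓ ⊔ e)
    IsVanKampen {C} {A} {B} {D} {m} {f} {g} {n} _ =
      ∀ {A′ B′ C′ D′} {m′ : C′ ⇒ A′} {f′ : C′ ⇒ B′} {g′ : A′ ⇒ D′} {n′ : B′ ⇒ D′}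
        {a : A′ ⇒ A} {b : B′ ⇒ B} {c : C′ ⇒ C} {d : D′ ⇒ D} →
      g′ ∘ m′ ≈ n′ ∘ f′ →
      d ∘ g′ ≈ g ∘ a → d ∘ n′ ≈ n ∘ b →
      IsPullback m′ c a m → IsPullback f′ c b f →
      IsPushout m′ f′ g′ n′ ⇔ (IsPullback g′ a d g × IsPullback n′ b d n)

    record Adhesive : Set (o ⊔ ℓ ⊔ e) where
      field
        pullbacks : (f : A ⇒ C) (g : B ⇒ C) → Pullback f g
        pushouts  : {m : C ⇒ A} → Mono m → (f : C ⇒ B) → Pushout m f
        vanKampen : {m : C ⇒ A} {f : C ⇒ B} {g : A ⇒ D} {n : B ⇒ D} →
                    Mono m → (po : IsPushout m f g n) → IsVanKampen po

    Finitary : Set (o ⊔ ℓ ⊔ e)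
    Finitary = ∀ X → Finite (Subobjects X)

    -- Sums over sets of monomorphisms A ⇒ X are defined only if these sets are
    -- finite.  Finiteness of the sets of subobjects does not ensure that: finitely
    -- generated free ℤ-sets form a finitary adhesive category with a strict
    -- initial object and with FPCs along monomorphisms, in which every nonempty
    -- object has infinitely many automorphisms.
    FiniteMonos : Set (o ⊔ ℓ ⊔ e)
    FiniteMonos = ∀ A X → Finite (Monos A X)

    record StrictInitial : Set (o ⊔ ℓ ⊔ e) where
      field
        ∅        : Obj
        !        : ∅ ⇒ X
        !-unique : (f : ∅ ⇒ X) → ! ≈ f
        strict   : (f : X ⇒ ∅) → IsIso f

    record FPCsAlongMonos : Set (o ⊔ ℓ ⊔ e) where
      field
        fpc    : {m : B ⇒ C} {i : A ⇒ B} → Mono m → Mono i → FPC m i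
        d-mono : {m : B ⇒ C} {i : A ⇒ B} (m-mono : Mono m) (i-mono : Mono i) → Mono (FPC.d (fpc m-mono i-mono))
        b-mono : {m : B ⇒ C} {i : A ⇒ B} (m-mono : Mono m) (i-mono : Mono i) → Mono (FPC.b (fpc m-mono i-mono))

module Rewriting where

  open import Algebra.Bundles using (CommutativeRing)
  open import Data.Fin.Base using (Fin)
  import Data.Fin.Properties as Fin
  open import Data.List.Base using (List; []; _∷_; [_]; concatMap; allFin; length; lookup; deduplicate)
  open import Data.List.Membership.Propositional using (lose)
  open import Data.List.Membership.Propositional.Properties using (∈-allFin; ∈-lookup)
  import Data.List.Membership.Setoid as Membership
  import Data.List.Membership.Setoid.Properties as MembershipProperties
  open import Data.List.Relation.Unary.Any as Any using (here)
  open import Data.List.Relation.Unary.AllPairs.Core using ([]; _∷_)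
  import Data.List.Relation.Unary.Any.Properties as AnyProperties
  import Data.List.Relation.Unary.All as All
  import Data.List.Relation.Unary.Unique.Setoid as UniqueS
  import Data.List.Relation.Unary.Unique.DecSetoid.Properties as UniqueD
  open import Data.Product.Base using (Σ; _×_; _,_; proj₁; proj₂)
  open import Function.Bundles using (Inverse; Equivalence)
  open import Level using (_⊔_)
  open import Relation.Binary.Bundles using (Setoid; DecSetoid)
  open import Relation.Binary.Definitions using (Decidable)
  open import Relation.Binary.PropositionalEquality as ≡ using (_≡_)
  open import Relation.Nullary.Decidable.Core using (Dec; yes; no; map′)
  open import Relation.Nullary.Negation.Core using (contradiction)
  open LinearAlgebra
  open Categories

  -- Finite sets have decidable equality, and a set with decidable equality that
  -- is exhausted by a list is finite.
  module _ {s ℓ} {S : Setoid s ℓ} where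
    open Setoid S

    finite⇒decidable : Finite S → Decidable _≈_
    finite⇒decidable (n , F) x y = map′
      (λ p → trans (sym (Inverse.strictlyInverseˡ F x))
               (trans (reflexive (≡.cong (Inverse.to F) p)) (Inverse.strictlyInverseˡ F y)))
      (Inverse.from-cong F)
      (Inverse.from F x Fin.≟ Inverse.from F y)

    exhausted⇒finite : Decidable _≈_ → (xs : List Carrier) → (∀ x → Membership._∈_ S x xs) → Finite S
    exhausted⇒finite _≟_ xs all∈xs = length ys , record
      { to = lookup ys
      ; from = λ x → Any.index (∈ys x)
      ; to-cong = λ p → reflexive (≡.cong (lookup ys) p)
      ; from-cong = λ {x} {y} p → lookup-injective ys! (trans (sym (at x)) (trans p (at y)))
      ; inverse = (λ {x} p → trans (reflexive (≡.cong (lookup ys) p)) (sym (at x)))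
                , (λ {i} {x} p → lookup-injective ys! (trans (sym (at x)) p))
      }
      where
      open Membership S using (_∈_)
      DS : DecSetoid s ℓ
      DS = record { isDecEquivalence = record { isEquivalence = isEquivalence ; _≟_ = _≟_ } }
      ys = deduplicate _≟_ xs
      ys! : UniqueS.Unique S ys
      ys! = UniqueD.deduplicate-! DS xs
      ∈ys : ∀ x → x ∈ ys
      ∈ys x = MembershipProperties.∈-deduplicate⁺ S _≟_ (λ p q → trans q (sym p)) (all∈xs x)
      at : ∀ x → x ≈ lookup ys (Any.index (∈ys x))
      at x = AnyProperties.lookup-index (∈ys x)
      lookup-injective : ∀ {zs} → UniqueS.Unique S zs → ∀ {i j} → lookup zs i ≈ lookup zs j → i ≡ j
      lookup-injective (_ ∷ _) {Fin.zero} {Fin.zero} _ = ≡.refl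
      lookup-injective {z ∷ zs} (z∉ ∷ _) {Fin.zero} {Fin.suc j} p =
        contradiction p (All.lookup z∉ (∈-lookup j))
      lookup-injective {z ∷ zs} (z∉ ∷ _) {Fin.suc i} {Fin.zero} p =
        contradiction (sym p) (All.lookup z∉ (∈-lookup i))
      lookup-injective (_ ∷ zs!) {Fin.suc i} {Fin.suc j} p = ≡.cong Fin.suc (lookup-injective zs! p)

  module AdhesiveProperties {o ℓ e} {𝐂 : Category o ℓ e} (adhesive : CategoryTheory.Adhesive 𝐂) where

    open CategoryTheory 𝐂
    open Adhesive adhesive

    private
      variable
        A B C D K O N K̄ X Z : Obj

    private
      square-of-mono : {m : C ⇒ A} → Mono m → IsPullback id id m m
      square-of-mono mm = record
        { commute = ≈-refl
        ; universal = λ {_} {h₁} _ → h₁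
        ; p₁∘universal = λ _ → identityˡ
        ; p₂∘universal = λ eq → ≈-trans identityˡ (mm _ _ eq)
        ; jointly-monic = λ p _ → mono-id _ _ p
        }

      trivial-pullback : {f : C ⇒ B} → IsPullback f id id f
      trivial-pullback = record
        { commute = ≈-trans identityˡ (≈-sym identityʳ)
        ; universal = λ {_} {_} {h₂} _ → h₂
        ; p₁∘universal = λ eq → ≈-trans (≈-sym eq) identityˡ
        ; p₂∘universal = λ _ → identityˡ
        ; jointly-monic = λ _ p → mono-id _ _ p
        }

      trivial-pushout : {f : C ⇒ B} → IsPushout id f f id
      trivial-pushout = record
        { commute = ≈-trans identityʳ (≈-sym identityˡ)
        ; universal = λ {_} {_} {h₂} _ → h₂
        ; universal∘i₁ = λ eq → ≈-trans (≈-sym eq) identityʳ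
        ; universal∘i₂ = λ _ → identityʳ
        ; jointly-epic = λ _ p → ≈-trans (≈-sym identityʳ) (≈-trans p identityʳ)
        }

      faces : {m : C ⇒ A} {f : C ⇒ B} {g : A ⇒ D} {n : B ⇒ D} → Mono m → IsPushout m f g n →
              IsPullback f m n g × IsPullback id id n n
      faces mm po = Equivalence.to
        (vanKampen mm po (≈-trans identityʳ (≈-sym identityˡ)) (≈-sym (IsPushout.commute po)) ≈-refl
          (square-of-mono mm) trivial-pullback)
        trivial-pushout

    pushout-mono : {m : C ⇒ A} {f : C ⇒ B} {g : A ⇒ D} {n : B ⇒ D} →
                   Mono m → IsPushout m f g n → Mono n
    pushout-mono mm po u v eq =
      ≈-trans (≈-sym (p₁∘universal eq)) (≈-trans (≈-trans identityˡ (≈-sym identityˡ)) (p₂∘universal eq))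
      where open IsPullback (proj₂ (faces mm po))

    pushout-pullback : {m : C ⇒ A} {f : C ⇒ B} {g : A ⇒ D} {n : B ⇒ D} →
                       Mono m → IsPushout m f g n → IsPullback m f g n
    pushout-pullback mm po = pullback-flip (proj₁ (faces mm po))

    -- Pushouts along monomorphisms are final pullback complements; hence pushout
    -- complements are unique.
    pushout-fpc : {o : K ⇒ O} {k : K ⇒ K̄} {n : O ⇒ N} {o′ : K̄ ⇒ N} →
                  Mono o → IsPushout o k n o′ → IsFPC n o o′ k
    pushout-fpc {K} {O} {K̄} {N} {o} {k} {n} {o′} mo po = record
      { isPullback = pushout-pullback mo po
      ; final = λ pb eq → Mediate.w* pb eq
      ; d∘final = λ pb eq → Mediate.d∘w* pb eq
      ; final∘y = λ pb eq → Mediate.w*∘y pb eq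
      ; unique = λ _ _ du _ dv _ → mo′ _ _ (≈-trans du (≈-sym dv))
      }
      where
      mo′ : Mono o′
      mo′ = pushout-mono mo po
      module Mediate {E F} {x : E ⇒ O} {y : E ⇒ F} {z : F ⇒ N} {w : E ⇒ K}
                     (pb : IsPullback x y n z) (eq : o ∘ w ≈ x) where
        module E = IsPullback pb
        open Pullback (pullbacks z o′) using () renaming (p₁ to q₁; p₂ to q₂; isPullback to Q-pb)
        module Q = IsPullback Q-pb

        y-kw : z ∘ y ≈ o′ ∘ (k ∘ w)
        y-kw = begin
          z ∘ y         ≈⟨ E.commute ⟨
          n ∘ x         ≈⟨ ∘-congˡ eq ⟨
          n ∘ (o ∘ w)   ≈⟨ pullˡ (IsPushout.commute po) ⟩
          (o′ ∘ k) ∘ w  ≈⟨ assoc ⟩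
          o′ ∘ (k ∘ w)  ∎

        t : E ⇒ _
        t = Q.universal y-kw
        q₁t : q₁ ∘ t ≈ y
        q₁t = Q.p₁∘universal y-kw
        q₂t : q₂ ∘ t ≈ k ∘ w
        q₂t = Q.p₂∘universal y-kw

        mq₁ : Mono q₁
        mq₁ = pullback-mono Q-pb mo′

        back₁ : IsPullback id w x o
        back₁ = record
          { commute = ≈-trans identityʳ (≈-sym eq)
          ; universal = λ {_} {h₁} _ → h₁
          ; p₁∘universal = λ _ → identityˡ
          ; p₂∘universal = λ r → mo _ _ (≈-trans (pullˡ eq) r)
          ; jointly-monic = λ r _ → mono-id _ _ r
          }

        module Lift {T} {h₁ : T ⇒ _} {h₂ : T ⇒ K} (r : q₂ ∘ h₁ ≈ k ∘ h₂) where
          s : n ∘ (o ∘ h₂) ≈ z ∘ (q₁ ∘ h₁)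
          s = begin
            n ∘ (o ∘ h₂)    ≈⟨ pullˡ (IsPushout.commute po) ⟩
            (o′ ∘ k) ∘ h₂   ≈⟨ pullʳ (≈-sym r) ⟩
            o′ ∘ (q₂ ∘ h₁)  ≈⟨ pullˡ (≈-sym Q.commute) ⟩
            (z ∘ q₁) ∘ h₁   ≈⟨ assoc ⟩
            z ∘ (q₁ ∘ h₁)   ∎
          v : T ⇒ E
          v = E.universal s
          tv : t ∘ v ≈ h₁
          tv = mq₁ _ _ (≈-trans (pullˡ q₁t) (E.p₂∘universal s))
          wv : w ∘ v ≈ h₂
          wv = mo _ _ (≈-trans (pullˡ eq) (E.p₁∘universal s))

        back₂ : IsPullback t w q₂ k
        back₂ = record
          { commute = q₂t
          ; universal = Lift.v
          ; p₁∘universal = Lift.tv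
          ; p₂∘universal = Lift.wv
          ; jointly-monic = λ {_} {u} {v} r s → E.jointly-monic
              (≈-trans (∘-congʳ (≈-sym eq)) (≈-trans (pullʳ s) (≈-trans (≈-sym assoc) (∘-congʳ eq))))
              (≈-trans (∘-congʳ (≈-sym q₁t)) (≈-trans (pullʳ r) (≈-trans (≈-sym assoc) (∘-congʳ q₁t))))
          }

        top : IsPushout id t y q₁
        top = Equivalence.from
          (vanKampen mo po (≈-trans identityʳ (≈-sym q₁t)) (≈-sym E.commute) Q.commute back₁ back₂)
          (pullback-flip pb , Q-pb)

        sect : F ⇒ _
        sect = IsPushout.universal top {h₁ = t} {h₂ = id} (≈-trans identityʳ (≈-sym identityˡ))
        sect-y : sect ∘ y ≈ t
        sect-y = IsPushout.universal∘i₁ top _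
        sect-q : sect ∘ q₁ ≈ id
        sect-q = IsPushout.universal∘i₂ top _
        q-sect : q₁ ∘ sect ≈ id
        q-sect = IsPushout.jointly-epic top
          (≈-trans (pullʳ sect-y) (≈-trans q₁t (≈-sym identityˡ)))
          (≈-trans (pullʳ sect-q) (≈-trans identityʳ (≈-sym identityˡ)))

        w* : F ⇒ K̄
        w* = q₂ ∘ sect
        d∘w* : o′ ∘ w* ≈ z
        d∘w* = ≈-trans (pullˡ (≈-sym Q.commute)) (≈-trans (pullʳ q-sect) identityʳ)
        w*∘y : w* ∘ y ≈ k ∘ w
        w*∘y = ≈-trans (pullʳ sect-y) q₂t

    -- Arrows out of the domain of an arrow into a pushout along a monomorphism
    -- agree if they agree over both injections.
    cover : {m : C ⇒ A} {f : C ⇒ B} {g : A ⇒ D} {n : B ⇒ D} → Mono m → IsPushout m f g n →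
            (d : Z ⇒ D) (h k : Z ⇒ X) →
            (∀ {W} (w : W ⇒ Z) (s : W ⇒ A) → d ∘ w ≈ g ∘ s → h ∘ w ≈ k ∘ w) →
            (∀ {W} (w : W ⇒ Z) (s : W ⇒ B) → d ∘ w ≈ n ∘ s → h ∘ w ≈ k ∘ w) → h ≈ k
    cover {m = m} {f} {g} {n} mm po d h k onA onB =
      IsPushout.jointly-epic top (onA g′ a PA.commute) (onB n′ b PB.commute)
      where
      open Pullback (pullbacks d g) renaming (p₁ to g′; p₂ to a; isPullback to pbA)
      open Pullback (pullbacks d n) renaming (p₁ to n′; p₂ to b; isPullback to pbB)
      open Pullback (pullbacks a m) renaming (p₁ to m′; p₂ to c; isPullback to pbC)
      module PA = IsPullback pbA
      module PB = IsPullback pbB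
      module PC = IsPullback pbC

      eq : d ∘ (g′ ∘ m′) ≈ n ∘ (f ∘ c)
      eq = begin
        d ∘ (g′ ∘ m′)  ≈⟨ pullˡ PA.commute ⟩
        (g ∘ a) ∘ m′   ≈⟨ pullʳ PC.commute ⟩
        g ∘ (m ∘ c)    ≈⟨ pullˡ (IsPushout.commute po) ⟩
        (n ∘ f) ∘ c    ≈⟨ assoc ⟩
        n ∘ (f ∘ c)    ∎

      f′ : _
      f′ = PB.universal eq
      n′f′ : n′ ∘ f′ ≈ g′ ∘ m′
      n′f′ = PB.p₁∘universal eq
      bf′ : b ∘ f′ ≈ f ∘ c
      bf′ = PB.p₂∘universal eq

      module Lift {T} {h₁ : T ⇒ _} {h₂ : T ⇒ _} (r : b ∘ h₁ ≈ f ∘ h₂) where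
        s : d ∘ (n′ ∘ h₁) ≈ g ∘ (m ∘ h₂)
        s = begin
          d ∘ (n′ ∘ h₁)  ≈⟨ pullˡ PB.commute ⟩
          (n ∘ b) ∘ h₁   ≈⟨ pullʳ r ⟩
          n ∘ (f ∘ h₂)   ≈⟨ pullˡ (≈-sym (IsPushout.commute po)) ⟩
          (g ∘ m) ∘ h₂   ≈⟨ assoc ⟩
          g ∘ (m ∘ h₂)   ∎
        t = PA.universal s
        v = PC.universal (PA.p₂∘universal s)
        m′v : m′ ∘ v ≈ t
        m′v = PC.p₁∘universal (PA.p₂∘universal s)
        cv : c ∘ v ≈ h₂
        cv = PC.p₂∘universal (PA.p₂∘universal s)
        f′v : f′ ∘ v ≈ h₁
        f′v = PB.jointly-monic
          (≈-trans (pullˡ n′f′) (≈-trans (pullʳ m′v) (PA.p₁∘universal s)))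
          (≈-trans (pullˡ bf′) (≈-trans (pullʳ cv) (≈-sym r)))

      back₂ : IsPullback f′ c b f
      back₂ = record
        { commute = bf′
        ; universal = Lift.v
        ; p₁∘universal = Lift.f′v
        ; p₂∘universal = Lift.cv
        ; jointly-monic = λ {_} {u} {v} r s → PC.jointly-monic
            (PA.jointly-monic
              (≈-trans (pullˡ (≈-sym n′f′)) (≈-trans (pullʳ r) (≈-trans (pullˡ n′f′) assoc)))
              (≈-trans (pullˡ PC.commute) (≈-trans (pullʳ s) (≈-trans (pullˡ (≈-sym PC.commute)) assoc))))
            s
        }

      top : IsPushout m′ f′ g′ n′
      top = Equivalence.from
        (vanKampen mm po (≈-sym n′f′) PA.commute PB.commute pbC back₂)
        (pbA , pbB)

    -- Unions of subobjects are effective.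
    union-mono : ∀ {P Q} {p : P ⇒ A} {q : P ⇒ B} {c : A ⇒ X} {d : B ⇒ X} {i : A ⇒ Q} {j : B ⇒ Q} {u : Q ⇒ X} →
                 Mono c → Mono d → IsPullback p q c d → IsPushout p q i j →
                 u ∘ i ≈ c → u ∘ j ≈ d → Mono u
    union-mono {p = p} {q} {c} {d} {i} {j} {u} mc md pb po ui uj f g uf≈ug =
      cover mp po f f g
        (λ w s fw → cover mp po (g ∘ w) (f ∘ w) (g ∘ w)
          (λ v t gwv → same ui mc (≈-trans assoc (shift w v fw)) gwv (merge w v))
          (λ v t gwv → mixed (≈-trans assoc (shift w v fw)) gwv (merge w v)))
        (λ w s fw → cover mp po (g ∘ w) (f ∘ w) (g ∘ w)
          (λ v t gwv → ≈-sym (mixed gwv (≈-trans assoc (shift w v fw)) (≈-sym (merge w v))))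
          (λ v t gwv → same uj md (≈-trans assoc (shift w v fw)) gwv (merge w v)))
      where
      module P = IsPullback pb
      mp : Mono p
      mp = pullback-mono pb md

      shift : ∀ {W V S} {l : S ⇒ _} (w : W ⇒ _) (v : V ⇒ W) {s : W ⇒ S} → f ∘ w ≈ l ∘ s → f ∘ (w ∘ v) ≈ l ∘ (s ∘ v)
      shift w v r = ≈-trans (pullˡ r) assoc

      merge : ∀ {W V} (w : W ⇒ _) (v : V ⇒ W) → u ∘ ((f ∘ w) ∘ v) ≈ u ∘ ((g ∘ w) ∘ v)
      merge w v = begin
        u ∘ ((f ∘ w) ∘ v)  ≈⟨ ∘-congˡ assoc ⟩
        u ∘ (f ∘ (w ∘ v))  ≈⟨ pullˡ uf≈ug ⟩
        (u ∘ g) ∘ (w ∘ v)  ≈⟨ assoc ⟩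
        u ∘ (g ∘ (w ∘ v))  ≈⟨ ∘-congˡ assoc ⟨
        u ∘ ((g ∘ w) ∘ v)  ∎

      over : ∀ {S V} {l : S ⇒ _} {k : S ⇒ _} {h : V ⇒ _} {s : V ⇒ S} → u ∘ l ≈ k → h ≈ l ∘ s → u ∘ h ≈ k ∘ s
      over ul r = ≈-trans (∘-congˡ r) (pullˡ ul)

      same : ∀ {S V} {l : S ⇒ _} {k : S ⇒ _} {h h′ : V ⇒ _} {s t : V ⇒ S} →
             u ∘ l ≈ k → Mono k → h ≈ l ∘ s → h′ ≈ l ∘ t → u ∘ h ≈ u ∘ h′ → h ≈ h′
      same ul mk r r′ eq = ≈-trans r (≈-trans
        (∘-congˡ (mk _ _ (≈-trans (≈-sym (over ul r)) (≈-trans eq (over ul r′)))))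
        (≈-sym r′))

      mixed : ∀ {V} {h h′ : V ⇒ _} {s : V ⇒ _} {t : V ⇒ _} →
              h ≈ i ∘ s → h′ ≈ j ∘ t → u ∘ h ≈ u ∘ h′ → h ≈ h′
      mixed {h = h} {h′} {s} {t} r r′ eq = begin
        h            ≈⟨ r ⟩
        i ∘ s        ≈⟨ ∘-congˡ (P.p₁∘universal cs≈dt) ⟨
        i ∘ (p ∘ x)  ≈⟨ pullˡ (IsPushout.commute po) ⟩
        (j ∘ q) ∘ x  ≈⟨ pullʳ (P.p₂∘universal cs≈dt) ⟩
        j ∘ t        ≈⟨ r′ ⟨
        h′           ∎
        where
        cs≈dt = ≈-trans (≈-sym (over ui r)) (≈-trans eq (over uj r′))
        x = P.universal cs≈dt

  module SqPO {o ℓ e} {𝐂 : Category o ℓ e}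
              (adhesive : CategoryTheory.Adhesive 𝐂)
              (finitary : CategoryTheory.Finitary 𝐂)
              (finiteMonos : CategoryTheory.FiniteMonos 𝐂)
              (initial : CategoryTheory.StrictInitial 𝐂)
              (fpcs : CategoryTheory.FPCsAlongMonos 𝐂) where

    open CategoryTheory 𝐂
    open Adhesive adhesive
    open AdhesiveProperties adhesive
    open StrictInitial initial
    open FPCsAlongMonos fpcs

    private
      fpc-mono-iso : ∀ {A B C A′ B′ C′} {c : B ⇒ C} {a : A ⇒ B} {c′ : B′ ⇒ C′} {a′ : A′ ⇒ B′}
        (mc : Mono c) (ma : Mono a) (mc′ : Mono c′) (ma′ : Mono a′)
        (φA : A ≅ A′) (φB : B ≅ B′) (φC : C ≅ C′) →
        from φB ∘ a ≈ a′ ∘ from φA → from φC ∘ c ≈ c′ ∘ from φB →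
        Σ (FPC.apex (fpc mc ma) ≅ FPC.apex (fpc mc′ ma′)) λ ψ →
          (from φC ∘ FPC.d (fpc mc ma) ≈ FPC.d (fpc mc′ ma′) ∘ from ψ) ×
          (from ψ ∘ FPC.b (fpc mc ma) ≈ FPC.b (fpc mc′ ma′) ∘ from φA)
      fpc-mono-iso mc ma mc′ ma′ φA φB φC p q =
        fpc-iso φA φB φC p q (d-mono mc ma) (d-mono mc′ ma′) (FPC.isFPC (fpc mc ma)) (FPC.isFPC (fpc mc′ ma′))

    record Rule : Set (o ⊔ ℓ ⊔ e) where
      field
        {O K I} : Obj
        out     : K ⇒ O
        inp     : K ⇒ I
        out-mono : Mono out
        inp-mono : Mono inp

    record _≅ᴿ_ (p q : Rule) : Set (ℓ ⊔ e) where
      private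
        module p = Rule p
        module q = Rule q
      field
        O-iso : p.O ≅ q.O
        K-iso : p.K ≅ q.K
        I-iso : p.I ≅ q.I
        out-comm : from O-iso ∘ p.out ≈ q.out ∘ from K-iso
        inp-comm : from I-iso ∘ p.inp ≈ q.inp ∘ from K-iso

    open _≅ᴿ_

    ≅ᴿ-refl : ∀ {p} → p ≅ᴿ p
    ≅ᴿ-refl = record
      { O-iso = ≅-refl ; K-iso = ≅-refl ; I-iso = ≅-refl
      ; out-comm = ≈-trans identityˡ (≈-sym identityʳ)
      ; inp-comm = ≈-trans identityˡ (≈-sym identityʳ)
      }

    ≅ᴿ-sym : ∀ {p q} → p ≅ᴿ q → q ≅ᴿ p
    ≅ᴿ-sym α = record
      { O-iso = ≅-sym (O-iso α) ; K-iso = ≅-sym (K-iso α) ; I-iso = ≅-sym (I-iso α)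
      ; out-comm = reverse (K-iso α) (O-iso α) (out-comm α)
      ; inp-comm = reverse (K-iso α) (I-iso α) (inp-comm α)
      }

    ≅ᴿ-trans : ∀ {p q r} → p ≅ᴿ q → q ≅ᴿ r → p ≅ᴿ r
    ≅ᴿ-trans α β = record
      { O-iso = ≅-trans (O-iso α) (O-iso β)
      ; K-iso = ≅-trans (K-iso α) (K-iso β)
      ; I-iso = ≅-trans (I-iso α) (I-iso β)
      ; out-comm = paste (out-comm α) (out-comm β)
      ; inp-comm = paste (inp-comm α) (inp-comm β)
      }
      where
      paste : ∀ {A A′ A″ B B′ B″} {f : A ⇒ B} {f′ : A′ ⇒ B′} {f″ : A″ ⇒ B″}
              {a : A ⇒ A′} {a′ : A′ ⇒ A″} {b : B ⇒ B′} {b′ : B′ ⇒ B″} →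
              b ∘ f ≈ f′ ∘ a → b′ ∘ f′ ≈ f″ ∘ a′ → (b′ ∘ b) ∘ f ≈ f″ ∘ (a′ ∘ a)
      paste p q = ≈-trans (pullʳ p) (≈-trans (pullˡ q) assoc)

    Lin : Setoid (o ⊔ ℓ ⊔ e) (ℓ ⊔ e)
    Lin = record
      { Carrier = Rule
      ; _≈_ = _≅ᴿ_
      ; isEquivalence = record { refl = ≅ᴿ-refl ; sym = ≅ᴿ-sym ; trans = ≅ᴿ-trans }
      }

    trivialRule : Rule
    trivialRule = record
      { O = ∅ ; K = ∅ ; I = ∅ ; out = id ; inp = id ; out-mono = mono-id ; inp-mono = mono-id }

    -- The set M_p(X); below, derive p m is p_m(X).
    Matches : Rule → Obj → Setoid (o ⊔ ℓ ⊔ e) e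
    Matches p X = Monos (Rule.I p) X

    matches-finite : ∀ p X → Finite (Matches p X)
    matches-finite p X = finiteMonos (Rule.I p) X

    derivation : (p : Rule) {X : Obj} ((m , m-mono) : Setoid.Carrier (Matches p X)) →
                 Pushout (Rule.out p) (FPC.b (fpc m-mono (Rule.inp-mono p)))
    derivation p (m , m-mono) = pushouts out-mono (FPC.b (fpc m-mono inp-mono))
      where open Rule p

    derive : (p : Rule) {X : Obj} → Setoid.Carrier (Matches p X) → Obj
    derive p m = Pushout.apex (derivation p m)

    derive-cong : ∀ {p p′ X X′} (α : p ≅ᴿ p′) (ξ : X ≅ X′)
                  (m : Setoid.Carrier (Matches p X)) (m′ : Setoid.Carrier (Matches p′ X′)) →
                  from ξ ∘ proj₁ m ≈ proj₁ m′ ∘ from (I-iso α) →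
                  derive p m ≅ derive p′ m′
    derive-cong {p} {p′} α ξ m m′ eq =
      let κ , _ , κ∘b = fpc-mono-iso (proj₂ m) (Rule.inp-mono p) (proj₂ m′) (Rule.inp-mono p′)
                          (K-iso α) (I-iso α) ξ (inp-comm α) eq
      in proj₁ (pushout-iso (K-iso α) (O-iso α) κ (out-comm α) κ∘b
                 (Pushout.isPushout (derivation p m)) (Pushout.isPushout (derivation p′ m′)))

    matches-cong : ∀ {p p′ X X′} → p ≅ᴿ p′ → X ≅ X′ → Inverse (Matches p X) (Matches p′ X′)
    matches-cong α ξ = record
      { to = λ (m , mm) → from ξ ∘ (m ∘ to (I-iso α)) , mono-∘ (mono-from ξ) (mono-∘ mm (mono-to (I-iso α)))
      ; from = λ (m , mm) → to ξ ∘ (m ∘ from (I-iso α)) , mono-∘ (mono-to ξ) (mono-∘ mm (mono-from (I-iso α)))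
      ; to-cong = λ p → ∘-congˡ (∘-congʳ p)
      ; from-cong = λ p → ∘-congˡ (∘-congʳ p)
      ; inverse = (λ p → ≈-trans (∘-congˡ (∘-congʳ p)) (undo (≅-sym (I-iso α)) (≅-sym ξ)))
                , (λ p → ≈-trans (∘-congˡ (∘-congʳ p)) (undo (I-iso α) ξ))
      }
      where
      undo : ∀ {I I′ X X′} (ι : I ≅ I′) (ξ : X ≅ X′) {m : I ⇒ X} →
             to ξ ∘ ((from ξ ∘ (m ∘ to ι)) ∘ from ι) ≈ m
      undo ι ξ = ≈-trans (∘-congˡ assoc) (≈-trans (cancelˡ ξ) (≈-trans (pullʳ (isoˡ ι)) identityʳ))

    record MonoSpan (X Y : Obj) : Set (o ⊔ ℓ ⊔ e) where
      field
        {M}        : Obj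
        left       : M ⇒ X
        right      : M ⇒ Y
        left-mono  : Mono left
        right-mono : Mono right

    -- Equality of spans in M_{p₂}(p₁) : isomorphisms of M that commute with the
    -- legs, whose feet are fixed.
    record _≅ᴹ_ {X Y} (s t : MonoSpan X Y) : Set (ℓ ⊔ e) where
      private
        module s = MonoSpan s
        module t = MonoSpan t
      field
        M-iso      : s.M ≅ t.M
        left-comm  : t.left ∘ from M-iso ≈ s.left
        right-comm : t.right ∘ from M-iso ≈ s.right

    open _≅ᴹ_

    monoSpans : Obj → Obj → Setoid (o ⊔ ℓ ⊔ e) (ℓ ⊔ e)
    monoSpans X Y = record
      { Carrier = MonoSpan X Y
      ; _≈_ = _≅ᴹ_
      ; isEquivalence = record
        { refl = record { M-iso = ≅-refl ; left-comm = identityʳ ; right-comm = identityʳ }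
        ; sym = λ μ → record
          { M-iso = ≅-sym (M-iso μ)
          ; left-comm = ≈-trans (∘-congʳ (≈-sym (left-comm μ))) (≈-trans (pullʳ (isoʳ (M-iso μ))) identityʳ)
          ; right-comm = ≈-trans (∘-congʳ (≈-sym (right-comm μ))) (≈-trans (pullʳ (isoʳ (M-iso μ))) identityʳ)
          }
        ; trans = λ μ ν → record
          { M-iso = ≅-trans (M-iso μ) (M-iso ν)
          ; left-comm = ≈-trans (pullˡ (left-comm ν)) (left-comm μ)
          ; right-comm = ≈-trans (pullˡ (right-comm ν)) (right-comm μ)
          }
        }
      }

    module Gluing {X Y} (s : MonoSpan X Y) where
      open MonoSpan s
      open Pushout (pushouts left-mono right) public renaming (apex to N; i₁ to n-left; i₂ to n-right)
      n-right-mono : Mono n-right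
      n-right-mono = pushout-mono left-mono isPushout
      n-left-mono : Mono n-left
      n-left-mono = pushout-mono right-mono (pushout-flip isPushout)

    record CompositionMatch (p₂ p₁ : Rule) : Set (o ⊔ ℓ ⊔ e) where
      field
        span       : MonoSpan (Rule.I p₂) (Rule.O p₁)
        complement : PushoutComplement (Rule.out p₁) (Gluing.n-right span)

    -- The set M_{p₂}(p₁).  Pushout complements along monomorphisms are unique up to
    -- isomorphism, so the choice of complement does not enter the equality.
    CompositionMatches : Rule → Rule → Setoid (o ⊔ ℓ ⊔ e) (ℓ ⊔ e)
    CompositionMatches p₂ p₁ = record
      { Carrier = CompositionMatch p₂ p₁
      ; _≈_ = λ m m′ → CompositionMatch.span m ≅ᴹ CompositionMatch.span m′
      ; isEquivalence = record { refl = Spans.refl ; sym = Spans.sym ; trans = Spans.trans }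
      }
      where module Spans = Setoid (monoSpans (Rule.I p₂) (Rule.O p₁))

    module Composition (p₂ p₁ : Rule) (m : CompositionMatch p₂ p₁) where
      private
        module p₁ = Rule p₁
        module p₂ = Rule p₂
      open CompositionMatch m public
      open Gluing span public
      open PushoutComplement complement public
        renaming (apex to K̄₁; k to k₁; g′ to o₁′; isPushout to complement-isPushout)

      o₁′-mono : Mono o₁′
      o₁′-mono = pushout-mono p₁.out-mono complement-isPushout

      open FPC (fpc n-left-mono p₂.inp-mono) public
        renaming (apex to K̄₂; d to i₂′; b to k₂)

      i₂′-mono : Mono i₂′
      i₂′-mono = d-mono n-left-mono p₂.inp-mono

      open Pushout (pushouts p₂.out-mono k₂) public
        renaming (apex to O₂₁; i₁ to O₂⇒O₂₁; i₂ to o₂′; isPushout to O₂₁-isPushout)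
      open Pushout (pushouts p₁.inp-mono k₁) public
        renaming (apex to I₂₁; i₁ to I₁⇒I₂₁; i₂ to i₁′; isPushout to I₂₁-isPushout)
      open Pullback (pullbacks i₂′ o₁′) public
        renaming (apex to K₂₁; p₁ to i₂″; p₂ to o₁″; isPullback to K₂₁-isPullback)

      composite : Rule
      composite = record
        { O = O₂₁
        ; K = K₂₁
        ; I = I₂₁
        ; out = o₂′ ∘ i₂″
        ; inp = i₁′ ∘ o₁″
        ; out-mono = mono-∘ (pushout-mono p₂.out-mono O₂₁-isPushout) (pullback-mono K₂₁-isPullback o₁′-mono)
        ; inp-mono = mono-∘ (pushout-mono p₁.inp-mono I₂₁-isPushout) (pullback-mono (pullback-flip K₂₁-isPullback) i₂′-mono)
        }

    compose : (p₂ p₁ : Rule) → CompositionMatch p₂ p₁ → Rule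
    compose p₂ p₁ m = Composition.composite p₂ p₁ m

    gluing-cong : ∀ {X Y X′ Y′} (χ : X ≅ X′) (υ : Y ≅ Y′) (s : MonoSpan X Y) (t : MonoSpan X′ Y′)
      (μ : MonoSpan.M s ≅ MonoSpan.M t) →
      from χ ∘ MonoSpan.left s ≈ MonoSpan.left t ∘ from μ → from υ ∘ MonoSpan.right s ≈ MonoSpan.right t ∘ from μ →
      Σ (Gluing.N s ≅ Gluing.N t) λ ν →
        (from ν ∘ Gluing.n-left s ≈ Gluing.n-left t ∘ from χ) × (from ν ∘ Gluing.n-right s ≈ Gluing.n-right t ∘ from υ)
    gluing-cong χ υ s t μ l r = pushout-iso μ χ υ l r (Gluing.isPushout s) (Gluing.isPushout t)

    complement-cong : ∀ {p p′ N N′} (β : p ≅ᴿ p′) (ν : N ≅ N′) {n : Rule.O p ⇒ N} {n′ : Rule.O p′ ⇒ N′} →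
      from ν ∘ n ≈ n′ ∘ from (O-iso β) → PushoutComplement (Rule.out p) n → PushoutComplement (Rule.out p′) n′
    complement-cong β ν eq c = record
      { k = k ∘ to (K-iso β)
      ; g′ = from ν ∘ g′
      ; isPushout = pushout-transport (K-iso β) (O-iso β) ≅-refl ν (out-comm β)
          (≈-trans identityˡ (≈-sym (≈-trans (pullʳ (isoˡ (K-iso β))) identityʳ)))
          eq (≈-sym identityʳ) isPushout
      }
      where open PushoutComplement c

    compose-cong : ∀ {p₂ p₁ q₂ q₁} (α : p₂ ≅ᴿ q₂) (β : p₁ ≅ᴿ q₁)
      (m : CompositionMatch p₂ p₁) (n : CompositionMatch q₂ q₁) →
      let s = CompositionMatch.span m ; t = CompositionMatch.span n in
      (μ : MonoSpan.M s ≅ MonoSpan.M t) →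
      from (I-iso α) ∘ MonoSpan.left s ≈ MonoSpan.left t ∘ from μ →
      from (O-iso β) ∘ MonoSpan.right s ≈ MonoSpan.right t ∘ from μ →
      compose p₂ p₁ m ≅ᴿ compose q₂ q₁ n
    compose-cong {p₂} {p₁} {q₂} {q₁} α β m n μ l r =
      let ν , ν-left , ν-right = gluing-cong (I-iso α) (O-iso β) P.span Q.span μ l r
          κ₁ , κ₁-o , κ₁-k = fpc-iso (K-iso β) (O-iso β) ν (out-comm β) ν-right P.o₁′-mono Q.o₁′-mono
                               (pushout-fpc (Rule.out-mono p₁) P.complement-isPushout)
                               (pushout-fpc (Rule.out-mono q₁) Q.complement-isPushout)
          κ₂ , κ₂-i , κ₂-k = fpc-mono-iso P.n-left-mono (Rule.inp-mono p₂) Q.n-left-mono (Rule.inp-mono q₂)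
                               (K-iso α) (I-iso α) ν (inp-comm α) ν-left
          ω , _ , ω-o = pushout-iso (K-iso α) (O-iso α) κ₂ (out-comm α) κ₂-k P.O₂₁-isPushout Q.O₂₁-isPushout
          ι , _ , ι-i = pushout-iso (K-iso β) (I-iso β) κ₁ (inp-comm β) κ₁-k P.I₂₁-isPushout Q.I₂₁-isPushout
          κ , κ-i , κ-o = pullback-iso κ₂ κ₁ ν κ₂-i κ₁-o P.K₂₁-isPullback Q.K₂₁-isPullback
      in record
        { O-iso = ω ; K-iso = κ ; I-iso = ι
        ; out-comm = glue κ-i ω-o
        ; inp-comm = glue κ-o ι-i
        }
      where
      module P = Composition p₂ p₁ m
      module Q = Composition q₂ q₁ n

    private
      transport : ∀ {p₂ p₁ q₂ q₁} → p₂ ≅ᴿ q₂ → p₁ ≅ᴿ q₁ → CompositionMatch p₂ p₁ → CompositionMatch q₂ q₁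
      transport {q₂ = q₂} {q₁} α β m = record
        { span = t
        ; complement = complement-cong β (proj₁ ν) (proj₂ (proj₂ ν)) (CompositionMatch.complement m)
        }
        where
        open MonoSpan (CompositionMatch.span m)
        t : MonoSpan (Rule.I q₂) (Rule.O q₁)
        t = record
          { left = from (I-iso α) ∘ left
          ; right = from (O-iso β) ∘ right
          ; left-mono = mono-∘ (mono-from (I-iso α)) left-mono
          ; right-mono = mono-∘ (mono-from (O-iso β)) right-mono
          }
        ν = gluing-cong (I-iso α) (O-iso β) (CompositionMatch.span m) t ≅-refl (≈-sym identityʳ) (≈-sym identityʳ)

    compositionMatches-cong : ∀ {p₂ p₁ q₂ q₁} → p₂ ≅ᴿ q₂ → p₁ ≅ᴿ q₁ →
                              Inverse (CompositionMatches p₂ p₁) (CompositionMatches q₂ q₁)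
    compositionMatches-cong {p₂} {p₁} {q₂} {q₁} α β = record
      { to = transport α β
      ; from = transport (≅ᴿ-sym α) (≅ᴿ-sym β)
      ; to-cong = λ {m} {m′} → moved α β m m′
      ; from-cong = λ {m} {m′} → moved (≅ᴿ-sym α) (≅ᴿ-sym β) m m′
      ; inverse = (λ {m} {m′} μ → back α β m m′ μ)
                , (λ {m} {m′} μ → back (≅ᴿ-sym α) (≅ᴿ-sym β) m m′ μ)
      }
      where
      moved : ∀ {p₂ p₁ q₂ q₁} (α : p₂ ≅ᴿ q₂) (β : p₁ ≅ᴿ q₁) (m m′ : CompositionMatch p₂ p₁) →
              Setoid._≈_ (CompositionMatches p₂ p₁) m m′ →
              Setoid._≈_ (CompositionMatches q₂ q₁) (transport α β m) (transport α β m′)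
      moved α β m m′ μ = record
        { M-iso = M-iso μ ; left-comm = pullʳ (left-comm μ) ; right-comm = pullʳ (right-comm μ) }
      back : ∀ {p₂ p₁ q₂ q₁} (α : p₂ ≅ᴿ q₂) (β : p₁ ≅ᴿ q₁) (m : CompositionMatch q₂ q₁) (m′ : CompositionMatch p₂ p₁) →
             Setoid._≈_ (CompositionMatches p₂ p₁) m′ (transport (≅ᴿ-sym α) (≅ᴿ-sym β) m) →
             Setoid._≈_ (CompositionMatches q₂ q₁) (transport α β m′) m
      back α β m m′ μ = record
        { M-iso = M-iso μ
        ; left-comm = ≈-trans (≈-sym (cancelʳ (I-iso α))) (∘-congˡ (≈-trans (≈-sym assoc) (left-comm μ)))
        ; right-comm = ≈-trans (≈-sym (cancelʳ (O-iso β))) (∘-congˡ (≈-trans (≈-sym assoc) (right-comm μ)))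
        }

    private
      -- A pushout complement of K → O → N exists if and only if the pushout of
      -- K → O along K → K̄, with K̄ the final pullback complement, is all of N.
      complement? : ∀ {K O N} {f : K ⇒ O} {n : O ⇒ N} → Mono f → Mono n → Dec (PushoutComplement f n)
      complement? {K} {O} {N} {f} {n} mf mn = decide (finite⇒decidable (finitary N) (_ , u , mu) (N , id , mono-id))
        where
        open FPC (fpc mn mf)
        open Pushout (pushouts mf b) using (i₁; i₂) renaming (isPushout to po)
        pb = IsFPC.isPullback isFPC
        u = IsPushout.universal po (IsPullback.commute pb)
        u∘i₁ = IsPushout.universal∘i₁ po (IsPullback.commute pb)
        u∘i₂ = IsPushout.universal∘i₂ po (IsPullback.commute pb)
        mu : Mono u
        mu = union-mono mn (d-mono mn mf) pb po u∘i₁ u∘i₂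

        decide : Dec (Setoid._≈_ (Subobjects N) (_ , u , mu) (N , id , mono-id)) → Dec (PushoutComplement f n)
        decide (yes (φ , φ≈u)) = yes (record
          { k = b
          ; g′ = d
          ; isPushout = pushout-transport ≅-refl ≅-refl ≅-refl φ
              (≈-trans identityˡ (≈-sym identityʳ)) (≈-trans identityˡ (≈-sym identityʳ))
              (≈-trans (∘-congʳ from≈u) (≈-trans u∘i₁ (≈-sym identityʳ)))
              (≈-trans (∘-congʳ from≈u) (≈-trans u∘i₂ (≈-sym identityʳ)))
              po
          })
          where
          from≈u : from φ ≈ u
          from≈u = ≈-trans (≈-sym identityˡ) φ≈u
        decide (no u≉id) = no λ c →
          let open PushoutComplement c renaming (g′ to d′; isPushout to po′)
              κ , κ-d , κ-b = fpc-iso ≅-refl ≅-refl ≅-refl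
                                (≈-trans identityˡ (≈-sym identityʳ)) (≈-trans identityˡ (≈-sym identityʳ))
                                (d-mono mn mf) (pushout-mono mf po′) isFPC (pushout-fpc mf po′)
              φ , φ-i₁ , φ-i₂ = pushout-iso ≅-refl ≅-refl κ (≈-trans identityˡ (≈-sym identityʳ)) κ-b po po′
          in u≉id (φ , ≈-trans identityˡ (IsPushout.jointly-epic po
               (≈-trans φ-i₁ (≈-trans identityʳ (≈-sym u∘i₁)))
               (≈-trans φ-i₂ (≈-trans (≈-sym κ-d) (≈-trans identityˡ (≈-sym u∘i₂))))))

      spans-decidable : ∀ {X Y} → Decidable (_≅ᴹ_ {X} {Y})
      spans-decidable {X} {Y} s t = decide
        (finite⇒decidable (finitary Y) (s.M , s.right , s.right-mono) (t.M , t.right , t.right-mono))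
        where
        module s = MonoSpan s
        module t = MonoSpan t
        decide : Dec (Setoid._≈_ (Subobjects Y) (s.M , s.right , s.right-mono) (t.M , t.right , t.right-mono)) → Dec (s ≅ᴹ t)
        decide (no ≉) = no λ μ → ≉ (M-iso μ , right-comm μ)
        decide (yes (φ , r)) = map′
          (λ l → record { M-iso = φ ; left-comm = l ; right-comm = r })
          (λ μ → ≈-trans (∘-congˡ (t.right-mono _ _ (≈-trans r (≈-sym (right-comm μ))))) (left-comm μ))
          (finite⇒decidable (finiteMonos s.M X) (t.left ∘ from φ , mono-∘ t.left-mono (mono-from φ)) (s.left , s.left-mono))

    compositionMatches-finite : ∀ p₂ p₁ → Finite (CompositionMatches p₂ p₁)
    compositionMatches-finite p₂ p₁ =
      exhausted⇒finite (λ m m′ → spans-decidable (span m) (span m′)) candidates exhaustive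
      where
      module p₁ = Rule p₁
      module p₂ = Rule p₂
      open CompositionMatch

      enumSub = proj₂ (finitary p₁.O)
      enumMono = λ A → proj₂ (finiteMonos A p₂.I)

      candidateSpan : (i : Fin (proj₁ (finitary p₁.O))) →
                      Fin (proj₁ (finiteMonos (proj₁ (Inverse.to enumSub i)) p₂.I)) → MonoSpan p₂.I p₁.O
      candidateSpan i j = record
        { left = proj₁ (Inverse.to (enumMono _) j)
        ; right = proj₁ (proj₂ (Inverse.to enumSub i))
        ; left-mono = proj₂ (Inverse.to (enumMono _) j)
        ; right-mono = proj₂ (proj₂ (Inverse.to enumSub i))
        }

      withComplement : ∀ s → Dec (PushoutComplement p₁.out (Gluing.n-right s)) → List (CompositionMatch p₂ p₁)
      withComplement s (yes c) = [ record { span = s ; complement = c } ]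
      withComplement s (no _)  = []

      candidate : MonoSpan p₂.I p₁.O → List (CompositionMatch p₂ p₁)
      candidate s = withComplement s (complement? p₁.out-mono (Gluing.n-right-mono s))

      candidates : List (CompositionMatch p₂ p₁)
      candidates = concatMap (λ i → concatMap (λ j → candidate (candidateSpan i j)) (allFin _)) (allFin _)

      open Membership (CompositionMatches p₂ p₁) using (_∈_)

      withComplement-∈ : ∀ m s c? → span m ≅ᴹ s → m ∈ withComplement s c?
      withComplement-∈ m s (yes c) μ = here μ
      withComplement-∈ m s (no ¬c) μ = contradiction
        (complement-cong (≅ᴿ-refl {p₁}) (proj₁ ν) (proj₂ (proj₂ ν)) (complement m)) ¬c
        where
        ν = gluing-cong ≅-refl ≅-refl (span m) s (M-iso μ)
              (≈-trans identityˡ (≈-sym (left-comm μ))) (≈-trans identityˡ (≈-sym (right-comm μ)))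

      exhaustive : ∀ m → m ∈ candidates
      exhaustive m = AnyProperties.concatMap⁺ (λ i → concatMap (λ j → candidate (candidateSpan i j)) (allFin _))
        (lose (∈-allFin i) (AnyProperties.concatMap⁺ (λ j → candidate (candidateSpan i j))
          (lose (∈-allFin j) (withComplement-∈ m (candidateSpan i j) _ μ))))
        where
        open MonoSpan (span m)
        sub : Setoid.Carrier (Subobjects p₁.O)
        sub = M , right , right-mono
        i = Inverse.from enumSub sub
        φ = Inverse.strictlyInverseˡ enumSub sub
        mono : Setoid.Carrier (Monos (proj₁ (Inverse.to enumSub i)) p₂.I)
        mono = left ∘ from (proj₁ φ) , mono-∘ left-mono (mono-from (proj₁ φ))
        j = Inverse.from (enumMono _) mono
        μ : span m ≅ᴹ candidateSpan i j
        μ = Setoid.sym (monoSpans p₂.I p₁.O) (record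
          { M-iso = proj₁ φ
          ; left-comm = ≈-sym (Inverse.strictlyInverseˡ (enumMono _) mono)
          ; right-comm = proj₂ φ
          })

    module _ {r ℓr} (𝐤 : CommutativeRing r ℓr) where

      open Modules 𝐤
      open LinearMap

      private
        module Rules   = FreeModule Lin
        module Objects = FreeModule objects

      ruleProduct : LinearMap Rules.Free (Hom Rules.Free Rules.Free)
      ruleProduct = bilinearExtension Lin Lin Rules.Free
        (λ p₂ p₁ → ∑ Rules.Free (compositionMatches-finite p₂ p₁) (λ m → Rules.δ (compose p₂ p₁ m)))
        (λ {p₂} {q₂} {p₁} {q₁} α β → ∑-reindex Rules.Free
          (compositionMatches-finite p₂ p₁) (compositionMatches-finite q₂ q₁) (compositionMatches-cong α β)
          (λ m n μ → Rules.δ-cong (compose-cong α β m n (M-iso μ) (≈-sym (left-comm μ)) (≈-sym (right-comm μ)))))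

      ruleAlgebra : RawUnitalAlgebra _ _
      ruleAlgebra = record
        { underlying = Rules.Free
        ; _⊙_ = λ R₂ R₁ → ⟦ ⟦ ruleProduct ⟧ R₂ ⟧ R₁
        ; 𝟙 = Rules.δ trivialRule
        }

      Ĉ : Module _ _
      Ĉ = Objects.Free

      representation : LinearMap Rules.Free (Hom Ĉ Ĉ)
      representation = bilinearExtension Lin objects Ĉ
        (λ p X → ∑ Ĉ (matches-finite p X) (λ m → Objects.δ (derive p m)))
        (λ {p} {p′} {X} {X′} α ξ → ∑-reindex Ĉ
          (matches-finite p X) (matches-finite p′ X′) (matches-cong α ξ)
          (λ m m′ eq → Objects.δ-cong (derive-cong α ξ m m′
            (≈-trans (∘-congˡ (≈-sym (≈-trans (pullʳ (isoˡ (I-iso α))) identityʳ)))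
              (≈-trans (≈-sym assoc) (∘-congʳ eq))))))

{-# OPTIONS --safe #-}

-- At |X⟩, both sides of ρ(δ(p₂) ⊙ δ(p₁)) = ρ(δ(p₂)) ρ(δ(p₁)) are double sums: one over m₁ : I₁ → X and
-- m₂ : I₂ → Y, where Y is the result of applying p₁ at m₁, the other over a composition match μ and
-- n : I₂₁ → X.  The pairs correspond as follows.  From (m₁ , m₂), the overlap of μ is the pullback of
-- I₂ → Y ← O₁, so that the gluing N is the union of I₂ and O₁ in Y; intersecting N with K̄ gives the
-- pushout complement K̄₁, and n : I₁ +_{K₁} K̄₁ → X is monic as a union.  From (μ , n), m₁ is the
-- restriction of n to I₁, finality of K̄ gives κ : K̄₁ → K̄, and N → N +_{K̄₁} K̄ = Y restricts to m₂.
-- Related pairs have isomorphic results: if L is the FPC of K̄₂ → N → Y, then the FPC for m₂ is L and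
-- the FPC for n is L ∩ K̄; pulling Y = N +_{K̄₁} K̄ back along L → Y, the van Kampen property yields
-- L = K̄₂ +_{K₂₁} (L ∩ K̄), hence O₂ +_{K₂} L = O₂₁ +_{K̄₂} L = O₂₁ +_{K₂₁} (L ∩ K̄).
module Submission where

open import Algebra.Bundles using (CommutativeRing)
open import Algebra.Module.Bundles using (LeftModule)
import Algebra.Properties.CommutativeMonoid.Sum as MonoidSum
open import Data.Fin.Base using (Fin; zero; suc; splitAt; join)
open import Data.Fin.Properties using (splitAt-join; join-splitAt)
open import Data.Nat.Base as ℕ using (ℕ; zero; suc)
open import Data.Product.Base using (Σ; ∃; _×_; _,_; proj₁; proj₂)
open import Data.Sum.Base as Sum using (_⊎_; inj₁; inj₂)
open import Function.Base using (_∘′_)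
open import Function.Bundles using (Inverse; Equivalence)
open import Level using (_⊔_)
open import Relation.Binary.Bundles using (Setoid)
open import Relation.Binary.PropositionalEquality as ≡ using (_≡_)

open import Defs
open Reals using (ℝ-commutativeRing)
open LinearAlgebra using (Finite; module Modules)
open Categories using (Category; module CategoryTheory)
open Rewriting using (module SqPO; module AdhesiveProperties)

-- Finite sums

total : ∀ {n} → (Fin n → ℕ) → ℕ
total {zero}  k = 0
total {suc n} k = k zero ℕ.+ total (k ∘′ suc)

unfold : ∀ {n} {k : Fin (suc n) → ℕ} →
         Fin (k zero) ⊎ Σ (Fin n) (Fin ∘′ k ∘′ suc) → Σ (Fin (suc n)) (Fin ∘′ k)
unfold (inj₁ j)       = zero , j
unfold (inj₂ (i , j)) = suc i , j

-- Lexicographic order: the first `k zero` indices enumerate the fibre over `zero`, so that sums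
-- over pairs split by `sum-splitAt`.
unflatten : ∀ {n} (k : Fin n → ℕ) → Fin (total k) → Σ (Fin n) (Fin ∘′ k)
unflatten {suc n} k p = unfold (Sum.map₂ (unflatten (k ∘′ suc)) (splitAt (k zero) p))

flatten : ∀ {n} (k : Fin n → ℕ) → Σ (Fin n) (Fin ∘′ k) → Fin (total k)
flatten {suc n} k (zero  , j) = join (k zero) _ (inj₁ j)
flatten {suc n} k (suc i , j) = join (k zero) _ (inj₂ (flatten (k ∘′ suc) (i , j)))

unflatten-flatten : ∀ {n} (k : Fin n → ℕ) q → unflatten k (flatten k q) ≡ q
unflatten-flatten {suc n} k (zero  , j)
  rewrite splitAt-join (k zero) (total (k ∘′ suc)) (inj₁ j) = ≡.refl
unflatten-flatten {suc n} k (suc i , j)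
  rewrite splitAt-join (k zero) (total (k ∘′ suc)) (inj₂ (flatten (k ∘′ suc) (i , j)))
        | unflatten-flatten (k ∘′ suc) (i , j) = ≡.refl

flatten-unflatten : ∀ {n} (k : Fin n → ℕ) p → flatten k (unflatten k p) ≡ p
flatten-unflatten {suc n} k p = ≡.trans (refold (splitAt (k zero) p)) (join-splitAt (k zero) _ p)
  where
  refold : ∀ s → flatten k (unfold (Sum.map₂ (unflatten (k ∘′ suc)) s)) ≡ join (k zero) _ s
  refold (inj₁ j) = ≡.refl
  refold (inj₂ p) = ≡.cong (λ q → join (k zero) _ (inj₂ q)) (flatten-unflatten (k ∘′ suc) p)

pairs-finite : ∀ {n} (k : Fin n → ℕ) → Finite (≡.setoid (Σ (Fin n) (Fin ∘′ k)))
pairs-finite k = total k , record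
  { to        = unflatten k
  ; from      = flatten k
  ; to-cong   = ≡.cong (unflatten k)
  ; from-cong = ≡.cong (flatten k)
  ; inverse   = (λ { ≡.refl → unflatten-flatten k _ }) , (λ { ≡.refl → flatten-unflatten k _ })
  }

-- A bijection between dependent pairs up to ≈, given by its graph: equality of pairs would need
-- transports of the second components along ≈, in whose place stand the quantifiers over u′ and u
-- in imageʳ and imageˡ.
record Correspondence {a ℓa b ℓb a′ ℓa′ b′ ℓb′ ρ}
  (S : Setoid a ℓa) (T : Setoid.Carrier S → Setoid b ℓb)
  (S′ : Setoid a′ ℓa′) (T′ : Setoid.Carrier S′ → Setoid b′ ℓb′)
  (_~_ : Σ (Setoid.Carrier S) (λ s → Setoid.Carrier (T s)) →
         Σ (Setoid.Carrier S′) (λ s → Setoid.Carrier (T′ s)) → Set ρ)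
  : Set (a ⊔ ℓa ⊔ b ⊔ ℓb ⊔ a′ ⊔ ℓa′ ⊔ b′ ⊔ ℓb′ ⊔ ρ) where
  private
    module S = Setoid S
    module T {s} = Setoid (T s)
    module S′ = Setoid S′
    module T′ {s} = Setoid (T′ s)
  field
    respʳ    : ∀ {p s′ t′ u′} → p ~ (s′ , t′) → t′ T′.≈ u′ → p ~ (s′ , u′)
    respˡ    : ∀ {q s t u} → (s , t) ~ q → t T.≈ u → (s , u) ~ q
    imageʳ   : ∀ p → ∃ λ s′ → ∀ u′ → s′ S′.≈ u′ → ∃ λ v′ → p ~ (u′ , v′)
    imageˡ   : ∀ q → ∃ λ s → ∀ u → s S.≈ u → ∃ λ v → (u , v) ~ q
    uniqueʳ₁ : ∀ {p s′ t′ u′ v′} → p ~ (s′ , t′) → p ~ (u′ , v′) → s′ S′.≈ u′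
    uniqueʳ₂ : ∀ {p s′ t′ v′} → p ~ (s′ , t′) → p ~ (s′ , v′) → t′ T′.≈ v′
    uniqueˡ₁ : ∀ {q s t u v} → (s , t) ~ q → (u , v) ~ q → s S.≈ u
    uniqueˡ₂ : ∀ {q s t v} → (s , t) ~ q → (s , v) ~ q → t T.≈ v

module Sums {r ℓr} (R : CommutativeRing r ℓr) {m ℓm} (M : Modules.Module R m ℓm) where

  open Modules R using (∑; ∑-reindex)
  open LeftModule M
  open MonoidSum +ᴹ-commutativeMonoid using (sum)

  sum-splitAt : ∀ m {n} (f : Fin m ⊎ Fin n → Carrierᴹ) →
                sum (λ p → f (splitAt m p)) ≈ᴹ sum (f ∘′ inj₁) +ᴹ sum (f ∘′ inj₂)
  sum-splitAt zero    f = ≈ᴹ-sym (+ᴹ-identityˡ _)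
  sum-splitAt (suc m) f = ≈ᴹ-trans (+ᴹ-congˡ (sum-splitAt m (f ∘′ Sum.map₁ suc))) (≈ᴹ-sym (+ᴹ-assoc _ _ _))

  sum-pairs : ∀ {n} (k : Fin n → ℕ) (f : Σ (Fin n) (Fin ∘′ k) → Carrierᴹ) →
              ∑ M (pairs-finite k) f ≈ᴹ sum (λ i → sum (λ j → f (i , j)))
  sum-pairs {zero}  k f = ≈ᴹ-refl
  sum-pairs {suc n} k f = ≈ᴹ-trans
    (sum-splitAt (k zero) (λ s → f (unfold (Sum.map₂ (unflatten (k ∘′ suc)) s))))
    (+ᴹ-congˡ (sum-pairs (k ∘′ suc) (λ (i , j) → f (suc i , j))))

  -- Comparison with the enumeration of `Fin 1` spares a computation of the length of `F`.
  ∑-singleton : ∀ {s ℓ} {S : Setoid s ℓ} (F : Finite S) (x : Setoid.Carrier S) →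
                (∀ y → Setoid._≈_ S x y) → {f : Setoid.Carrier S → Carrierᴹ} {c : Carrierᴹ} →
                (∀ y → f y ≈ᴹ c) → ∑ M F f ≈ᴹ c
  ∑-singleton {S = S} F x x≈ {f} {c} f≈c = ≈ᴹ-trans
    (∑-reindex M F one (record
      { to        = λ _ → zero
      ; from      = λ _ → x
      ; to-cong   = λ _ → ≡.refl
      ; from-cong = λ _ → S.refl
      ; inverse   = (λ { {zero} _ → ≡.refl }) , (λ {y} _ → x≈ y)
      }) {g = λ _ → c} (λ y _ _ → f≈c y))
    (+ᴹ-identityʳ c)
    where
    module S = Setoid S
    one : Finite (≡.setoid (Fin 1))
    one = 1 , record
      { to = λ i → i ; from = λ i → i ; to-cong = λ p → p ; from-cong = λ p → p
      ; inverse = (λ p → p) , (λ p → p) }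

  module _
    {a ℓa b ℓb a′ ℓa′ b′ ℓb′}
    {S : Setoid a ℓa} {T : Setoid.Carrier S → Setoid b ℓb}
    {S′ : Setoid a′ ℓa′} {T′ : Setoid.Carrier S′ → Setoid b′ ℓb′}
    where
    private
      module S = Setoid S
      module T {s} = Setoid (T s)
      module S′ = Setoid S′
      module T′ {s} = Setoid (T′ s)
      ∣T∣ = λ s → Setoid.Carrier (T s)
      ∣T′∣ = λ s → Setoid.Carrier (T′ s)

    -- Both double sums are flattened to sums over pairs of indices. On these, equality is
    -- propositional and the relation is the graph of a genuine bijection, so `∑-reindex` applies.
    ∑∑-reindex : ∀ {ρ} {_~_ : Σ S.Carrier ∣T∣ → Σ S′.Carrier ∣T′∣ → Set ρ} → Correspondence S T S′ T′ _~_ →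
                 (F : Finite S) (G : ∀ s → Finite (T s)) (F′ : Finite S′) (G′ : ∀ s → Finite (T′ s)) →
                 {f : ∀ s → ∣T∣ s → Carrierᴹ} {g : ∀ s → ∣T′∣ s → Carrierᴹ} →
                 (∀ {s t s′ t′} → (s , t) ~ (s′ , t′) → f s t ≈ᴹ g s′ t′) →
                 ∑ M F (λ s → ∑ M (G s) (f s)) ≈ᴹ ∑ M F′ (λ s → ∑ M (G′ s) (g s))
    ∑∑-reindex {_~_ = _~_} C F G F′ G′ {f} {g} f≈g = ≈ᴹ-trans (≈ᴹ-sym (sum-pairs k (λ (i , j) → f (s i) (t i j))))
      (≈ᴹ-trans (∑-reindex M (pairs-finite k) (pairs-finite k′) bijection
                  {g = λ (i , j) → g (s′ i) (t′ i j)} λ { p _ ≡.refl → f≈g (proj₂ (right p)) })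
        (sum-pairs k′ (λ (i , j) → g (s′ i) (t′ i j))))
      where
      open Correspondence C

      s = Inverse.to (proj₂ F)
      s′ = Inverse.to (proj₂ F′)
      k = λ i → proj₁ (G (s i))
      k′ = λ i → proj₁ (G′ (s′ i))
      t = λ i → Inverse.to (proj₂ (G (s i)))
      t′ = λ i → Inverse.to (proj₂ (G′ (s′ i)))

      Index = Σ (Fin (proj₁ F)) (Fin ∘′ k)
      Index′ = Σ (Fin (proj₁ F′)) (Fin ∘′ k′)

      _≈ᴵ_ : Index → Index′ → Set _
      (i , j) ≈ᴵ (i′ , j′) = (s i , t i j) ~ (s′ i′ , t′ i′ j′)

      right : ∀ p → ∃ (p ≈ᴵ_)
      right (i , j) =
        -- The image `s₀` need not be one of the enumerated elements: `move` passes to its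
        -- enumerated representative, and `respʳ` does the same for the second component.
        let s₀ , move = imageʳ (s i , t i j)
            i′ = Inverse.from (proj₂ F′) s₀
            v , r = move (s′ i′) (S′.sym (Inverse.strictlyInverseˡ (proj₂ F′) s₀))
        in (i′ , Inverse.from (proj₂ (G′ (s′ i′))) v)
           , respʳ r (T′.sym (Inverse.strictlyInverseˡ (proj₂ (G′ (s′ i′))) v))

      left : ∀ q → ∃ (_≈ᴵ q)
      left (i′ , j′) =
        let s₀ , move = imageˡ (s′ i′ , t′ i′ j′)
            i = Inverse.from (proj₂ F) s₀
            v , r = move (s i) (S.sym (Inverse.strictlyInverseˡ (proj₂ F) s₀))
        in (i , Inverse.from (proj₂ (G (s i))) v)
           , respˡ r (T.sym (Inverse.strictlyInverseˡ (proj₂ (G (s i))) v))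

      injective : ∀ {a ℓ} {A : Setoid a ℓ} ((n , E) : Finite A) {i j} →
                  Setoid._≈_ A (Inverse.to E i) (Inverse.to E j) → i ≡ j
      injective (_ , E) p = ≡.trans (≡.sym (Inverse.strictlyInverseʳ E _))
        (≡.trans (Inverse.from-cong E p) (Inverse.strictlyInverseʳ E _))

      functional : ∀ {p q q′} → p ≈ᴵ q → p ≈ᴵ q′ → q ≡ q′
      -- Once the first indices coincide, both second components lie in the same fibre, as
      -- `uniqueʳ₂` requires.
      functional {q = i , j} {i′ , j′} r r′ with injective F′ (uniqueʳ₁ r r′)
      ... | ≡.refl = ≡.cong (i ,_) (injective (G′ (s′ i)) (uniqueʳ₂ r r′))

      cofunctional : ∀ {p p′ q} → p ≈ᴵ q → p′ ≈ᴵ q → p ≡ p′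
      cofunctional {i , j} {i′ , j′} r r′ with injective F (uniqueˡ₁ r r′)
      ... | ≡.refl = ≡.cong (i ,_) (injective (G (s i)) (uniqueˡ₂ r r′))

      bijection : Inverse (≡.setoid Index) (≡.setoid Index′)
      bijection = record
        { to        = λ p → proj₁ (right p)
        ; from      = λ q → proj₁ (left q)
        ; to-cong   = ≡.cong _
        ; from-cong = ≡.cong _
        ; inverse   = (λ { {q} ≡.refl → functional (proj₂ (right (proj₁ (left q)))) (proj₂ (left q)) })
                    , (λ { {p} ≡.refl → cofunctional (proj₂ (left (proj₁ (right p)))) (proj₂ (right p)) })
        }

-- Linear maps, finite sums and generators

module _ {r ℓr} (R : CommutativeRing r ℓr) where

  open Modules R
  open LinearMap

  module _ {m ℓm n ℓn} {M : Module m ℓm} {N : Module n ℓn} where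
    private
      module M = LeftModule M
      module N = LeftModule N

    sum-homo : (h : LinearMap M N) → ∀ {k} (f : Fin k → M.Carrierᴹ) →
               ⟦ h ⟧ (MonoidSum.sum M.+ᴹ-commutativeMonoid f) N.≈ᴹ
               MonoidSum.sum N.+ᴹ-commutativeMonoid (λ i → ⟦ h ⟧ (f i))
    sum-homo h {zero}  f = 0ᴹ-homo h
    sum-homo h {suc k} f = N.≈ᴹ-trans (+ᴹ-homo h _ _) (N.+ᴹ-congˡ (sum-homo h (λ i → f (suc i))))

    ∑-homo : (h : LinearMap M N) → ∀ {s ℓ} {S : Setoid s ℓ} (F : Finite S) (f : Setoid.Carrier S → M.Carrierᴹ) →
             ⟦ h ⟧ (∑ M F f) N.≈ᴹ ∑ N F (λ x → ⟦ h ⟧ (f x))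
    ∑-homo h (n , E) f = sum-homo h (λ i → f (Inverse.to E i))

    -- Makes the value of an endomorphism at a fixed vector linear in the endomorphism, so that
    -- `∑-homo` and `agree-on-generators` apply to that argument too.
    evaluation : M.Carrierᴹ → LinearMap (Hom M N) N
    evaluation x = linear (λ h → ⟦ h ⟧ x) (λ p → p x) (λ _ _ → N.≈ᴹ-refl) N.≈ᴹ-refl
      (λ _ → N.≈ᴹ-refl) (λ _ _ → N.≈ᴹ-refl)

  module _ {s ℓs} {S : Setoid s ℓs} {m ℓm} {M : Module m ℓm} where
    open FreeModule S
    open LeftModule M

    agree-on-generators : (f g : LinearMap Free M) → (∀ x → ⟦ f ⟧ (δ x) ≈ᴹ ⟦ g ⟧ (δ x)) → ∀ u → ⟦ f ⟧ u ≈ᴹ ⟦ g ⟧ u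
    agree-on-generators f g p = go
      where
      go : ∀ u → ⟦ f ⟧ u ≈ᴹ ⟦ g ⟧ u
      go (δ x)   = p x
      go 𝟘       = ≈ᴹ-trans (0ᴹ-homo f) (≈ᴹ-sym (0ᴹ-homo g))
      go (u ⊞ v) = ≈ᴹ-trans (+ᴹ-homo f u v) (≈ᴹ-trans (+ᴹ-cong (go u) (go v)) (≈ᴹ-sym (+ᴹ-homo g u v)))
      go (⊟ u)   = ≈ᴹ-trans (-ᴹ-homo f u) (≈ᴹ-trans (-ᴹ‿cong (go u)) (≈ᴹ-sym (-ᴹ-homo g u)))
      go (a · u) = ≈ᴹ-trans (*ₗ-homo f a u) (≈ᴹ-trans (*ₗ-congˡ (go u)) (≈ᴹ-sym (*ₗ-homo g a u)))

-- Pullbacks, pushouts and final pullback complements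

module Squares {o ℓ e} {𝐂 : Category o ℓ e} (adhesive : CategoryTheory.Adhesive 𝐂) where

  open CategoryTheory 𝐂
  open Adhesive adhesive
  open AdhesiveProperties adhesive

  private
    variable
      A B C D E F P Q X Y : Obj

  pullback-resp-≈ : {p₁ q₁ : P ⇒ A} {p₂ q₂ : P ⇒ B} {f h : A ⇒ C} {g k : B ⇒ C} →
                    p₁ ≈ q₁ → p₂ ≈ q₂ → f ≈ h → g ≈ k → IsPullback p₁ p₂ f g → IsPullback q₁ q₂ h k
  pullback-resp-≈ {f = f} {h} {g} {k} p q r s pb = record
    { commute = ≈-trans (≈-sym r ⟩∘⟨ ≈-sym p) (≈-trans commute (s ⟩∘⟨ q))
    ; universal = λ eq → universal (back eq)
    ; p₁∘universal = λ eq → ≈-trans (∘-congʳ (≈-sym p)) (p₁∘universal (back eq))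
    ; p₂∘universal = λ eq → ≈-trans (∘-congʳ (≈-sym q)) (p₂∘universal (back eq))
    ; jointly-monic = λ t u → jointly-monic
        (≈-trans (∘-congʳ p) (≈-trans t (∘-congʳ (≈-sym p))))
        (≈-trans (∘-congʳ q) (≈-trans u (∘-congʳ (≈-sym q))))
    }
    where
    open IsPullback pb
    back : ∀ {Q} {h₁ : Q ⇒ _} {h₂ : Q ⇒ _} → h ∘ h₁ ≈ k ∘ h₂ → f ∘ h₁ ≈ g ∘ h₂
    back eq = ≈-trans (∘-congʳ r) (≈-trans eq (∘-congʳ (≈-sym s)))

  --   Q --q₁--> P --p₁--> A
  --   |         |         |
  --   q₂        p₂        f
  --   v         v         v
  --   X ---h--> B ---g--> C
  pullback-paste : {p₁ : P ⇒ A} {p₂ : P ⇒ B} {f : A ⇒ C} {g : B ⇒ C} {q₁ : Q ⇒ P} {q₂ : Q ⇒ X} {h : X ⇒ B} →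
                   IsPullback p₁ p₂ f g → IsPullback q₁ q₂ p₂ h → IsPullback (p₁ ∘ q₁) q₂ f (g ∘ h)
  pullback-paste {p₁ = p₁} {p₂} {f} {g} {q₁} {q₂} {h} pb qb = record
    { commute = glue Q.commute P.commute
    ; universal = λ eq → Q.universal (P.p₂∘universal (≈-trans eq assoc))
    ; p₁∘universal = λ eq → ≈-trans (pullʳ (Q.p₁∘universal _)) (P.p₁∘universal _)
    ; p₂∘universal = λ eq → Q.p₂∘universal _
    ; jointly-monic = λ r s → Q.jointly-monic
        (P.jointly-monic (≈-trans (≈-sym assoc) (≈-trans r assoc))
          (≈-trans (pullˡ Q.commute) (≈-trans (pullʳ s) (≈-trans (≈-sym assoc)
            (≈-trans (∘-congʳ (≈-sym Q.commute)) assoc)))))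
        s
    }
    where
    module P = IsPullback pb
    module Q = IsPullback qb

  pullback-cancel : {p₁ : P ⇒ A} {p₂ : P ⇒ B} {f : A ⇒ C} {g : B ⇒ C} {q₁ : Q ⇒ P} {q₂ : Q ⇒ X} {h : X ⇒ B} →
                    IsPullback p₁ p₂ f g → p₂ ∘ q₁ ≈ h ∘ q₂ → IsPullback (p₁ ∘ q₁) q₂ f (g ∘ h) →
                    IsPullback q₁ q₂ p₂ h
  pullback-cancel {p₁ = p₁} {p₂} {f} {g} {q₁} {q₂} {h} pb comm ob = record
    { commute = comm
    ; universal = λ eq → O.universal (glue eq P.commute)
    ; p₁∘universal = λ eq → P.jointly-monic
        (≈-trans (≈-sym assoc) (O.p₁∘universal _))
        (≈-trans (pullˡ comm) (≈-trans (pullʳ (O.p₂∘universal _)) (≈-sym eq)))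
    ; p₂∘universal = λ eq → O.p₂∘universal _
    ; jointly-monic = λ r s → O.jointly-monic (≈-trans assoc (≈-trans (∘-congˡ r) (≈-sym assoc))) s
    }
    where
    module P = IsPullback pb
    module O = IsPullback ob

  pullback-along-mono : {p₁ : P ⇒ A} {p₂ : P ⇒ B} {f : A ⇒ C} {g : B ⇒ C} {x : C ⇒ X} →
                        Mono x → IsPullback p₁ p₂ f g → IsPullback p₁ p₂ (x ∘ f) (x ∘ g)
  pullback-along-mono {f = f} {g} {x} mx pb = record
    { commute = ≈-trans (pullʳ commute) (≈-sym assoc)
    ; universal = λ eq → universal (drop eq)
    ; p₁∘universal = λ eq → p₁∘universal (drop eq)
    ; p₂∘universal = λ eq → p₂∘universal (drop eq)
    ; jointly-monic = jointly-monic
    }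
    where
    open IsPullback pb
    drop : ∀ {Q} {h₁ : Q ⇒ _} {h₂ : Q ⇒ _} → (x ∘ f) ∘ h₁ ≈ (x ∘ g) ∘ h₂ → f ∘ h₁ ≈ g ∘ h₂
    drop eq = mx _ _ (≈-trans (≈-sym assoc) (≈-trans eq assoc))

  -- The inverse image of the subobject `b` under an arrow that factors through it is everything.
  -- Supplies the cube faces with an identity edge in `intersection-complement`.
  triangle-pullback : {f : A ⇒ B} {b : B ⇒ C} {g : A ⇒ C} → Mono b → b ∘ f ≈ g → IsPullback f id b g
  triangle-pullback mb bf≈g = record
    { commute = ≈-trans bf≈g (≈-sym identityʳ)
    ; universal = λ {_} {_} {h₂} _ → h₂
    ; p₁∘universal = λ eq → mb _ _ (≈-trans (pullˡ bf≈g) (≈-sym eq))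
    ; p₂∘universal = λ _ → identityˡ
    ; jointly-monic = λ _ r → mono-id _ _ r
    }

  --   C ---g--> B ---h--> Y
  --   |         |         |
  --   f         i₂        j
  --   v         v         v
  --   A --i₁--> P ---x--> X
  pushout-paste : {f : C ⇒ A} {g : C ⇒ B} {i₁ : A ⇒ P} {i₂ : B ⇒ P} {h : B ⇒ Y} {x : P ⇒ X} {j : Y ⇒ X} →
                  IsPushout f g i₁ i₂ → IsPushout i₂ h x j → IsPushout f (h ∘ g) (x ∘ i₁) j
  pushout-paste {f = f} {g} {i₁} {i₂} {h} {x} {j} po qo = record
    { commute = ≈-trans (pullʳ P.commute) (≈-trans (pullˡ Q.commute) assoc)
    ; universal = λ eq → Q.universal (P.universal∘i₂ (≈-trans eq (≈-sym assoc)))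
    ; universal∘i₁ = λ eq → ≈-trans (pullˡ (Q.universal∘i₁ _)) (P.universal∘i₁ _)
    ; universal∘i₂ = λ eq → Q.universal∘i₂ _
    ; jointly-epic = λ r s → Q.jointly-epic
        (P.jointly-epic (≈-trans assoc (≈-trans r (≈-sym assoc)))
          (≈-trans (pullʳ Q.commute) (≈-trans (pullˡ s) (≈-trans assoc
            (≈-trans (∘-congˡ (≈-sym Q.commute)) (≈-sym assoc))))))
        s
    }
    where
    module P = IsPushout po
    module Q = IsPushout qo

  pushout-cancel : {f : C ⇒ A} {g : C ⇒ B} {i₁ : A ⇒ P} {i₂ : B ⇒ P} {h : B ⇒ Y} {x : P ⇒ X} {j : Y ⇒ X} →
                   IsPushout f g i₁ i₂ → x ∘ i₂ ≈ j ∘ h → IsPushout f (h ∘ g) (x ∘ i₁) j → IsPushout i₂ h x j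
  pushout-cancel {f = f} {g} {i₁} {i₂} {h} {x} {j} po comm oo = record
    { commute = comm
    ; universal = λ eq → O.universal (shift eq)
    ; universal∘i₁ = λ eq → P.jointly-epic
        (≈-trans assoc (O.universal∘i₁ (shift eq)))
        (≈-trans (pullʳ comm) (≈-trans (pullˡ (O.universal∘i₂ (shift eq))) (≈-sym eq)))
    ; universal∘i₂ = λ eq → O.universal∘i₂ (shift eq)
    ; jointly-epic = λ r s → O.jointly-epic (≈-trans (≈-sym assoc) (≈-trans (∘-congʳ r) assoc)) s
    }
    where
    module P = IsPushout po
    module O = IsPushout oo
    shift : ∀ {Q} {h₁ : _ ⇒ Q} {h₂ : _ ⇒ Q} → h₁ ∘ i₂ ≈ h₂ ∘ h → (h₁ ∘ i₁) ∘ f ≈ h₂ ∘ (h ∘ g)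
    shift eq = ≈-trans (pullʳ P.commute) (≈-trans (pullˡ eq) assoc)

  pushout-resp-≈ : {f f′ : C ⇒ A} {g g′ : C ⇒ B} {i₁ j₁ : A ⇒ P} {i₂ j₂ : B ⇒ P} →
                   f ≈ f′ → g ≈ g′ → i₁ ≈ j₁ → i₂ ≈ j₂ → IsPushout f g i₁ i₂ → IsPushout f′ g′ j₁ j₂
  pushout-resp-≈ p q r s = pushout-transport ≅-refl ≅-refl ≅-refl ≅-refl (idle p) (idle q) (idle r) (idle s)
    where
    idle : {f g : A ⇒ B} → f ≈ g → id ∘ f ≈ g ∘ id
    idle p = ≈-trans identityˡ (≈-trans p (≈-sym identityʳ))

  -- Because d is monic, only the existence of the mediating arrow is at stake.
  mono-fpc : {a : A ⇒ B} {b : A ⇒ D} {c : B ⇒ C} {d : D ⇒ C} → IsPullback a b c d → Mono d →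
             (∀ {E F} {x : E ⇒ B} {y : E ⇒ F} {z : F ⇒ C} {w : E ⇒ A} →
                IsPullback x y c z → a ∘ w ≈ x → Σ (F ⇒ D) λ u → d ∘ u ≈ z) →
             IsFPC c a d b
  mono-fpc pb md mediate = record
    { isPullback = pb
    ; final = λ qb eq → proj₁ (mediate qb eq)
    ; d∘final = λ qb eq → proj₂ (mediate qb eq)
    ; final∘y = λ qb eq → md _ _ (≈-trans (pullˡ (proj₂ (mediate qb eq)))
        (≈-trans (≈-sym (IsPullback.commute qb)) (≈-trans (∘-congˡ (≈-sym eq))
          (≈-trans (pullˡ (IsPullback.commute pb)) assoc))))
    ; unique = λ _ _ du _ dv _ → md _ _ (≈-trans du (≈-sym dv))
    }

  --   A ---a--> B
  --   b         c
  --   D ---d--> C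
  --   b′        c′
  --   D′ --d′-> C′
  fpc-paste : ∀ {D′ C′} {a : A ⇒ B} {b : A ⇒ D} {c : B ⇒ C} {d : D ⇒ C} {b′ : D ⇒ D′} {c′ : C ⇒ C′} {d′ : D′ ⇒ C′} →
              Mono d′ → IsFPC c a d b → IsFPC c′ d d′ b′ → IsFPC (c′ ∘ c) a d′ (b′ ∘ b)
  fpc-paste {c = c} {c′ = c′} md′ φ ψ =
    mono-fpc
      (pullback-flip (pullback-paste (pullback-flip ψ.isPullback) (pullback-flip φ.isPullback)))
      md′
      λ {_} {_} {x} {y} {z} pb eq →
        -- Pulling `z` back along `c′` splits the test square in two: finality of `φ` lifts `p₁`
        -- through `d`, and this lift is the datum that finality of `ψ` asks for.
        let open Pullback (pullbacks c′ z)
            module I = IsPullback isPullback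
            comm = ≈-trans (≈-sym assoc) (IsPullback.commute pb)
            pb₁ : IsPullback x (I.universal comm) c p₁
            pb₁ = pullback-flip (pullback-cancel (pullback-flip isPullback) (I.p₁∘universal comm)
                    (pullback-resp-≈ (≈-sym (I.p₂∘universal comm)) ≈-refl ≈-refl ≈-refl (pullback-flip pb)))
        in ψ.final isPullback (φ.d∘final pb₁ eq) , ψ.d∘final isPullback (φ.d∘final pb₁ eq)
    where
    module φ = IsFPC φ
    module ψ = IsFPC ψ

  --   A′ --a′-> A ---a--> B
  --   b′        b         c
  --   D′ --d′-> D ---d--> C
  fpc-trans : ∀ {A′ D′} {a : A ⇒ B} {b : A ⇒ D} {c : B ⇒ C} {d : D ⇒ C} {a′ : A′ ⇒ A} {b′ : A′ ⇒ D′} {d′ : D′ ⇒ D} →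
              Mono d → Mono d′ → IsFPC c a d b → IsFPC b a′ d′ b′ → IsFPC c (a ∘ a′) (d ∘ d′) b′
  fpc-trans {a = a} {a′ = a′} md md′ φ ψ =
    mono-fpc (pullback-paste φ.isPullback ψ.isPullback) (mono-∘ md md′)
      λ {_} {_} {x} {y} {z} {w} pb eq →
        -- Finality of `φ` lifts `z` to `D`; cancelling the square of `φ` from `pb` leaves a test
        -- square over `b` for `ψ`.
        let eq′ = ≈-trans (≈-sym assoc) eq
            pb₁ : IsPullback (a′ ∘ w) y _ (φ.final pb eq′)
            pb₁ = pullback-cancel φ.isPullback (≈-sym (φ.final∘y pb eq′))
                    (pullback-resp-≈ (≈-sym eq′) ≈-refl ≈-refl (≈-sym (φ.d∘final pb eq′)) pb)
        in ψ.final pb₁ ≈-refl , ≈-trans (pullʳ (ψ.d∘final pb₁ ≈-refl)) (φ.d∘final pb eq′)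
    where
    module φ = IsFPC φ
    module ψ = IsFPC ψ

  --   A ---a--> B
  --   b′        j
  --   A′ --a′-> B′
  --   κ         n
  --   D ---d--> C
  fpc-cancel : ∀ {A′ B′} {a : A ⇒ B} {b : A ⇒ D} {c : B ⇒ C} {d : D ⇒ C}
               {b′ : A ⇒ A′} {j : B ⇒ B′} {a′ : A′ ⇒ B′} {κ : A′ ⇒ D} {n : B′ ⇒ C} →
               Mono d → Mono a′ → IsFPC c a d b → IsFPC j a a′ b′ → n ∘ j ≈ c → n ∘ a′ ≈ d ∘ κ →
               IsFPC n a′ d κ
  fpc-cancel {a = a} {b} {c} {d} {b′} {j} {a′} {κ} {n} md ma′ φ ψ nj comm = mono-fpc
    (record
      { commute = comm
      ; universal = λ eq → proj₁ (factor eq)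
      ; p₁∘universal = λ eq → proj₂ (factor eq)
      ; p₂∘universal = λ eq → md _ _ (≈-trans (pullˡ (≈-sym comm)) (≈-trans (pullʳ (proj₂ (factor eq))) eq))
      ; jointly-monic = λ r _ → ma′ _ _ r
      })
    md
    λ {_} {_} {x} {y} {z} {w} pb eq →
      -- Restricted along `j`, the test square lies over `c`, and the pullback property of `ψ` lifts
      -- `p₁` through `a`; so finality of `φ` applies.
      let open Pullback (pullbacks j x)
          comm₁ : j ∘ p₁ ≈ a′ ∘ (w ∘ p₂)
          comm₁ = ≈-trans (IsPullback.commute isPullback) (≈-trans (∘-congʳ (≈-sym eq)) assoc)
          pb₁ : IsPullback p₁ (y ∘ p₂) c z
          pb₁ = pullback-resp-≈ ≈-refl ≈-refl nj ≈-refl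
                  (pullback-flip (pullback-paste (pullback-flip pb) (pullback-flip isPullback)))
          eq₁ = IsPullback.p₁∘universal ψ.isPullback comm₁
      in φ.final pb₁ eq₁ , φ.d∘final pb₁ eq₁
    where
    module φ = IsFPC φ
    module ψ = IsFPC ψ
    factor : ∀ {Q} {h₁ : Q ⇒ _} {h₂ : Q ⇒ _} → n ∘ h₁ ≈ d ∘ h₂ → Σ (Q ⇒ _) λ u → a′ ∘ u ≈ h₁
    -- Over `B`, the pullback property of `φ` factors `p₁` through `a`; finality of `ψ` extends this
    -- to a factorisation of `h₁` through `a′`.
    factor {h₁ = h₁} {h₂} eq =
      let open Pullback (pullbacks j h₁)
          comm₁ : c ∘ p₁ ≈ d ∘ (h₂ ∘ p₂)
          comm₁ = begin
            c ∘ p₁          ≈⟨ ∘-congʳ nj ⟨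
            (n ∘ j) ∘ p₁    ≈⟨ pullʳ (IsPullback.commute isPullback) ⟩
            n ∘ (h₁ ∘ p₂)   ≈⟨ pullˡ eq ⟩
            (d ∘ h₂) ∘ p₂   ≈⟨ assoc ⟩
            d ∘ (h₂ ∘ p₂)   ∎
          eq₁ = IsPullback.p₁∘universal φ.isPullback comm₁
      in ψ.final isPullback eq₁ , ψ.d∘final isPullback eq₁

  -- The square A′ B′ D′ Y is the pullback of the square A B D C along g : Y ⇒ C.
  fpc-pullback : ∀ {A′ B′ D′} {a : A ⇒ B} {b : A ⇒ D} {c : B ⇒ C} {d : D ⇒ C}
                 {a′ : A′ ⇒ B′} {c′ : B′ ⇒ Y} {d′ : D′ ⇒ Y} {g : Y ⇒ C} {gA : A′ ⇒ A} {gB : B′ ⇒ B} {gD : D′ ⇒ D} →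
                 Mono d → IsFPC c a d b →
                 IsPullback gB c′ c g → IsPullback gA a′ a gB → IsPullback gD d′ d g →
                 Σ (A′ ⇒ D′) λ b′ → (gD ∘ b′ ≈ b ∘ gA) × IsFPC c′ a′ d′ b′
  fpc-pullback {a = a} {b} {c} {d} {a′} {c′} {d′} {g} {gA} {gB} {gD} md φ pbB pbA pbD =
    b′ , PD.p₁∘universal comm , mono-fpc
      (pullback-flip (pullback-cancel pbD (PD.p₂∘universal comm)
        (pullback-resp-≈ (≈-sym (PD.p₁∘universal comm)) ≈-refl ≈-refl PB.commute
          (pullback-paste (pullback-flip φ.isPullback) pbA))))
      (pullback-mono (pullback-flip pbD) md)
      λ {_} {_} {x} {y} {z} {w} pb eq →
        -- Pasted with `pbB`, the test square lies over `c`; finality of `φ` lifts `g ∘ z` to `D`,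
        -- and the lift together with `z` gives an arrow into the pullback `D′`.
        let pb₁ : IsPullback (gB ∘ x) y c (g ∘ z)
            pb₁ = pullback-paste pbB pb
            eq₁ : a ∘ (gA ∘ w) ≈ gB ∘ x
            eq₁ = ≈-trans (pullˡ PA.commute) (pullʳ eq)
            comm₁ = φ.d∘final pb₁ eq₁
        in PD.universal comm₁ , PD.p₂∘universal comm₁
    where
    module φ = IsFPC φ
    module PA = IsPullback pbA
    module PB = IsPullback pbB
    module PD = IsPullback pbD
    comm : d ∘ (b ∘ gA) ≈ g ∘ (c′ ∘ a′)
    comm = begin
      d ∘ (b ∘ gA)    ≈⟨ pullˡ (≈-sym (IsPullback.commute φ.isPullback)) ⟩
      (c ∘ a) ∘ gA    ≈⟨ pullʳ PA.commute ⟩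
      c ∘ (gB ∘ a′)   ≈⟨ pullˡ PB.commute ⟩
      (g ∘ c′) ∘ a′   ≈⟨ assoc ⟩
      g ∘ (c′ ∘ a′)   ∎
    b′ = PD.universal comm

-- Two steps and one step

module Concurrency {o ℓ e} {𝐂 : Category o ℓ e}
  (adhesive : CategoryTheory.Adhesive 𝐂)
  (finitary : CategoryTheory.Finitary 𝐂)
  (finiteMonos : CategoryTheory.FiniteMonos 𝐂)
  (initial : CategoryTheory.StrictInitial 𝐂)
  (fpcs : CategoryTheory.FPCsAlongMonos 𝐂) where

  open CategoryTheory 𝐂
  open Adhesive adhesive
  open AdhesiveProperties adhesive
  open StrictInitial initial
  open FPCsAlongMonos fpcs
  open SqPO adhesive finitary finiteMonos initial fpcs
  open Squares adhesive

  idle : ∀ {A B} {f : A ⇒ B} → id ∘ f ≈ f ∘ id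
  idle = ≈-trans identityˡ (≈-sym identityʳ)

  module TwoStep
    {N Y K̄₁ K̄ K̄₂ I₂ K₂ O₂ O₂₁ I₂₁ X K₂₁ : Obj}
    {o₁′ : K̄₁ ⇒ N} {κ : K̄₁ ⇒ K̄} {x : N ⇒ Y} {e : K̄ ⇒ Y}
    (Y-gluing : IsPushout o₁′ κ x e) (o₁′-mono : Mono o₁′) (x-mono : Mono x)
    {n₂ : I₂ ⇒ N} {i₂ : K₂ ⇒ I₂} {i₂′ : K̄₂ ⇒ N} {k₂ : K₂ ⇒ K̄₂}
    (K̄₂-fpc : IsFPC n₂ i₂ i₂′ k₂) (i₂′-mono : Mono i₂′)
    {o₂ : K₂ ⇒ O₂} {o₂′ : K̄₂ ⇒ O₂₁} {j₂ : O₂ ⇒ O₂₁} (o₂-mono : Mono o₂) (O₂₁-isPushout : IsPushout o₂ k₂ j₂ o₂′)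
    {n : I₂₁ ⇒ X} {i₁′ : K̄₁ ⇒ I₂₁} {d : K̄ ⇒ X} (K̄-fpc : IsFPC n i₁′ d κ) (d-mon : Mono d)
    {i₂″ : K₂₁ ⇒ K̄₂} {o₁″ : K₂₁ ⇒ K̄₁} (K₂₁-isPullback : IsPullback i₂″ o₁″ i₂′ o₁′)
    where

    open FPC (fpc x-mono i₂′-mono) using () renaming (apex to L; d to L⇒Y; b to K̄₂⇒L; isFPC to L-fpc)
    L⇒Y-mono : Mono L⇒Y
    L⇒Y-mono = d-mono x-mono i₂′-mono

    L-fpc′ : IsFPC (x ∘ n₂) i₂ L⇒Y (K̄₂⇒L ∘ k₂)
    L-fpc′ = fpc-paste L⇒Y-mono K̄₂-fpc L-fpc

    -- `Z` is the intersection of `L` and `K̄` in `Y`. Base change of `L-fpc` along `e` makes it an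
    -- FPC over `κ`, and `K̄-fpc` turns this into one over `n`.
    open Pullback (pullbacks L⇒Y e) using ()
      renaming (apex to Z; p₁ to Z⇒L; p₂ to Z⇒K̄; isPullback to Z-pullback)
    Z⇒K̄-mono : Mono Z⇒K̄
    Z⇒K̄-mono = pullback-mono (pullback-flip Z-pullback) L⇒Y-mono

    restricted : Σ (K₂₁ ⇒ Z) λ b → (Z⇒L ∘ b ≈ K̄₂⇒L ∘ i₂″) × IsFPC κ o₁″ Z⇒K̄ b
    restricted = fpc-pullback L⇒Y-mono L-fpc (pushout-pullback o₁′-mono Y-gluing) K₂₁-isPullback Z-pullback
    K₂₁⇒Z : K₂₁ ⇒ Z
    K₂₁⇒Z = proj₁ restricted
    Z-fpc : IsFPC κ o₁″ Z⇒K̄ K₂₁⇒Z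
    Z-fpc = proj₂ (proj₂ restricted)

    Z-fpc′ : IsFPC n (i₁′ ∘ o₁″) (d ∘ Z⇒K̄) K₂₁⇒Z
    Z-fpc′ = fpc-trans d-mon Z⇒K̄-mono K̄-fpc Z-fpc

    L-gluing : IsPushout i₂″ K₂₁⇒Z K̄₂⇒L Z⇒L
    -- The cube over `Y-gluing` has `L⇒Y` as its vertical arrow at `Y`; two of its side faces are
    -- pullbacks because they are squares of FPCs.
    L-gluing = Equivalence.from
      (vanKampen o₁′-mono Y-gluing (≈-sym (proj₁ (proj₂ restricted)))
        (≈-sym (IsPullback.commute (IsFPC.isPullback L-fpc))) (IsPullback.commute Z-pullback)
        K₂₁-isPullback (pullback-flip (IsFPC.isPullback Z-fpc)))
      (pullback-flip (IsFPC.isPullback L-fpc) , Z-pullback)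

    open Pushout (pushouts o₂-mono (K̄₂⇒L ∘ k₂)) using ()
      renaming (apex to W; i₁ to O₂⇒W; i₂ to L⇒W; isPushout to W-isPushout)

    O₂₁⇒W-square : O₂⇒W ∘ o₂ ≈ (L⇒W ∘ K̄₂⇒L) ∘ k₂
    O₂₁⇒W-square = ≈-trans (IsPushout.commute W-isPushout) (≈-sym assoc)
    O₂₁⇒W : O₂₁ ⇒ W
    O₂₁⇒W = IsPushout.universal O₂₁-isPushout O₂₁⇒W-square

    W-isPushout′ : IsPushout (o₂′ ∘ i₂″) K₂₁⇒Z O₂₁⇒W (L⇒W ∘ Z⇒L)
    -- Cancelling `O₂₁` leaves `W` as the pushout of `o₂′` along `K̄₂⇒L`; pasting with `L-gluing`
    -- replaces `K̄₂⇒L` by `K₂₁⇒Z`.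
    W-isPushout′ = pushout-flip (pushout-paste (pushout-flip L-gluing)
      (pushout-flip (pushout-cancel O₂₁-isPushout
        (IsPushout.universal∘i₂ O₂₁-isPushout O₂₁⇒W-square)
        (pushout-resp-≈ ≈-refl ≈-refl
          (≈-sym (IsPushout.universal∘i₁ O₂₁-isPushout O₂₁⇒W-square)) ≈-refl W-isPushout))))

    -- The derivations make their own choices of FPCs and pushouts. Uniqueness up to isomorphism
    -- compares each of them with `L`, `Z` and `W`, and `W` mediates.
    final-iso : ∀ {L′ Z′ W₂ W₂₁} {m₂ : I₂ ⇒ Y} {l : L′ ⇒ Y} {bL : K₂ ⇒ L′} {u₁ : O₂ ⇒ W₂} {u₂ : L′ ⇒ W₂}
                {z : Z′ ⇒ X} {bZ : K₂₁ ⇒ Z′} {v₁ : O₂₁ ⇒ W₂₁} {v₂ : Z′ ⇒ W₂₁} →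
                x ∘ n₂ ≈ m₂ → IsFPC m₂ i₂ l bL → Mono l → IsPushout o₂ bL u₁ u₂ →
                IsFPC n (i₁′ ∘ o₁″) z bZ → Mono z → IsPushout (o₂′ ∘ i₂″) bZ v₁ v₂ →
                W₂ ≅ W₂₁
    final-iso x-n₂ φ ml po ψ mz qo =
      let L′≅L , _ , L′≅L-b = fpc-iso ≅-refl ≅-refl ≅-refl idle (≈-trans identityˡ (≈-trans (≈-sym x-n₂) (≈-sym identityʳ)))
                          ml L⇒Y-mono φ L-fpc′
          Z≅Z′ , _ , Z≅Z′-b = fpc-iso ≅-refl ≅-refl ≅-refl idle idle (mono-∘ d-mon Z⇒K̄-mono) mz Z-fpc′ ψ
      in ≅-trans (proj₁ (pushout-iso ≅-refl ≅-refl L′≅L idle L′≅L-b po W-isPushout))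
                 (proj₁ (pushout-iso ≅-refl ≅-refl Z≅Z′ idle Z≅Z′-b W-isPushout′ qo))

  module Derivation (p : Rule) {X : Obj} (m : Setoid.Carrier (Matches p X)) where
    open Rule p
    open FPC (fpc (proj₂ m) inp-mono) public renaming (apex to K̄)
    d-monic : Mono d
    d-monic = d-mono (proj₂ m) inp-mono
    open Pushout (derivation p m) public
      renaming (apex to Y; i₁ to O⇒Y; i₂ to K̄⇒Y; isPushout to Y-isPushout)
    K̄⇒Y-mono : Mono K̄⇒Y
    K̄⇒Y-mono = pushout-mono out-mono Y-isPushout
    O⇒Y-mono : Mono O⇒Y
    O⇒Y-mono = pushout-mono (b-mono (proj₂ m) inp-mono) (pushout-flip Y-isPushout)

  module _ (p₂ p₁ : Rule) (X : Obj) where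

    private
      module p₁ = Rule p₁
      module p₂ = Rule p₂

    TwoSteps : Set _
    TwoSteps = Σ (Setoid.Carrier (Matches p₁ X)) λ m₁ → Setoid.Carrier (Matches p₂ (derive p₁ m₁))

    OneStep : Set _
    OneStep = Σ (CompositionMatch p₂ p₁) λ μ → Setoid.Carrier (Matches (compose p₂ p₁ μ) X)

    -- κ restricts the first step to K̄₁, and x embeds the gluing N into its result.
    record _~_ (s : TwoSteps) (t : OneStep) : Set (o ⊔ ℓ ⊔ e) where
      private
        m₁ = proj₁ s
        m₂ = proj₂ s
        μ = proj₁ t
        n = proj₂ t
        module D = Derivation p₁ m₁
        module C = Composition p₂ p₁ μ
      field
        κ : C.K̄₁ ⇒ D.K̄
        x : C.N ⇒ D.Y
        n-I₁ : proj₁ n ∘ C.I₁⇒I₂₁ ≈ proj₁ m₁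
        n-K̄₁ : proj₁ n ∘ C.i₁′ ≈ D.d ∘ κ
        x-O₁ : x ∘ C.n-right ≈ D.O⇒Y
        x-I₂ : x ∘ C.n-left ≈ proj₁ m₂
        x-K̄₁ : x ∘ C.o₁′ ≈ D.K̄⇒Y ∘ κ

    module Related {s : TwoSteps} {t : OneStep} (r : s ~ t) where
      open _~_ r public
      m₁ = proj₁ s
      m₂ = proj₂ s
      μ = proj₁ t
      n = proj₂ t
      module D = Derivation p₁ m₁
      module C = Composition p₂ p₁ μ

      i₁′-mono : Mono C.i₁′
      i₁′-mono = pushout-mono p₁.inp-mono C.I₂₁-isPushout

      κ-k₁ : κ ∘ C.k₁ ≈ D.b
      κ-k₁ = D.d-monic _ _ (begin
        D.d ∘ (κ ∘ C.k₁)                       ≈⟨ pullˡ (≈-sym n-K̄₁) ⟩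
        (proj₁ n ∘ C.i₁′) ∘ C.k₁               ≈⟨ pullʳ (≈-sym (IsPushout.commute C.I₂₁-isPushout)) ⟩
        proj₁ n ∘ (C.I₁⇒I₂₁ ∘ p₁.inp)          ≈⟨ pullˡ n-I₁ ⟩
        proj₁ m₁ ∘ p₁.inp                      ≈⟨ IsPullback.commute (IsFPC.isPullback D.isFPC) ⟩
        D.d ∘ D.b                              ∎)

      κ-mono : Mono κ
      κ-mono = mono-cancel (mono-resp-≈ n-K̄₁ (mono-∘ (proj₂ n) i₁′-mono))

      -- `Y` is the pushout of `O₁` and `K̄` over `K₁`, and `N` that of `O₁` and `K̄₁`; cancelling
      -- the latter leaves `N` and `K̄` glued along `K̄₁`.
      Y-gluing : IsPushout C.o₁′ κ x D.K̄⇒Y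
      Y-gluing = pushout-cancel C.complement-isPushout x-K̄₁
        (pushout-resp-≈ ≈-refl (≈-sym κ-k₁) (≈-sym x-O₁) ≈-refl D.Y-isPushout)

      x-mono : Mono x
      x-mono = pushout-mono κ-mono (pushout-flip Y-gluing)

      -- The gluing square is a pullback in `N`, and remains one in `Y` because `x` is monic. Hence
      -- the two matches determine the span.
      M-pullback : IsPullback (MonoSpan.left C.span) (MonoSpan.right C.span) (proj₁ m₂) D.O⇒Y
      M-pullback = pullback-resp-≈ ≈-refl ≈-refl x-I₂ x-O₁
        (pullback-along-mono x-mono (pushout-pullback (MonoSpan.left-mono C.span) (Gluing.isPushout C.span)))

    span-unique : ∀ {s μ n μ′ n′} → s ~ (μ , n) → s ~ (μ′ , n′) →
                  CompositionMatch.span μ ≅ᴹ CompositionMatch.span μ′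
    span-unique r r′ =
      let φ , l-comm , r-comm = pullback-iso ≅-refl ≅-refl ≅-refl idle idle (Related.M-pullback r) (Related.M-pullback r′)
      in record { M-iso = φ
                ; left-comm = ≈-trans (≈-sym l-comm) identityˡ
                ; right-comm = ≈-trans (≈-sym r-comm) identityˡ }

    -- The legs of the gluing determine `x`, then monicity of `K̄⇒Y` determines `κ`, and `n` is
    -- known on `I₁` and `K̄₁`. In `second-match-unique` the chain runs backwards, from `n` via `κ`
    -- to `x`.
    one-step-match-unique : ∀ {s μ n n′} → s ~ (μ , n) → s ~ (μ , n′) → proj₁ n ≈ proj₁ n′
    one-step-match-unique r r′ = IsPushout.jointly-epic S.C.I₂₁-isPushout
      (≈-trans S.n-I₁ (≈-sym T.n-I₁))
      (≈-trans S.n-K̄₁ (≈-trans (∘-congˡ κ≈κ′) (≈-sym T.n-K̄₁)))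
      where
      module S = Related r
      module T = Related r′
      x≈x′ : S.x ≈ T.x
      x≈x′ = IsPushout.jointly-epic (Gluing.isPushout S.C.span)
        (≈-trans S.x-I₂ (≈-sym T.x-I₂)) (≈-trans S.x-O₁ (≈-sym T.x-O₁))
      κ≈κ′ : S.κ ≈ T.κ
      κ≈κ′ = S.D.K̄⇒Y-mono _ _ (≈-trans (≈-sym S.x-K̄₁) (≈-trans (∘-congʳ x≈x′) T.x-K̄₁))

    first-match-unique : ∀ {m₁ m₂ m₁′ m₂′ t} → (m₁ , m₂) ~ t → (m₁′ , m₂′) ~ t → proj₁ m₁ ≈ proj₁ m₁′
    first-match-unique r r′ = ≈-trans (≈-sym (_~_.n-I₁ r)) (_~_.n-I₁ r′)

    second-match-unique : ∀ {m₁ m₂ m₂′ t} → (m₁ , m₂) ~ t → (m₁ , m₂′) ~ t → proj₁ m₂ ≈ proj₁ m₂′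
    second-match-unique r r′ = ≈-trans (≈-sym S.x-I₂) (≈-trans (∘-congʳ x≈x′) T.x-I₂)
      where
      module S = Related r
      module T = Related r′
      κ≈κ′ : S.κ ≈ T.κ
      κ≈κ′ = S.D.d-monic _ _ (≈-trans (≈-sym S.n-K̄₁) T.n-K̄₁)
      x≈x′ : S.x ≈ T.x
      x≈x′ = IsPushout.jointly-epic S.C.complement-isPushout
        (≈-trans S.x-O₁ (≈-sym T.x-O₁))
        (≈-trans S.x-K̄₁ (≈-trans (∘-congˡ κ≈κ′) (≈-sym T.x-K̄₁)))

    -- `m₁` is any match equal to the restriction of `n`, as `imageˡ` demands: the object that `m₂`
    -- maps into depends on the representative.
    split : ∀ {μ} (n : Setoid.Carrier (Matches (compose p₂ p₁ μ) X)) (m₁ : Setoid.Carrier (Matches p₁ X)) →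
            proj₁ n ∘ Composition.I₁⇒I₂₁ p₂ p₁ μ ≈ proj₁ m₁ →
            ∃ λ m₂ → (m₁ , m₂) ~ (μ , n)
    split {μ} n m₁ n-I₁ = (x ∘ C.n-left , mono-∘ x-mono C.n-left-mono) , record
      { κ = κ ; x = x ; n-I₁ = n-I₁ ; n-K̄₁ = ≈-sym d-κ ; x-O₁ = x-O₁ ; x-I₂ = ≈-refl ; x-K̄₁ = x-K̄₁ }
      where
      module D = Derivation p₁ m₁
      module C = Composition p₂ p₁ μ
      K₁-pullback : IsPullback p₁.inp C.k₁ (proj₁ m₁) (proj₁ n ∘ C.i₁′)
      K₁-pullback = pullback-resp-≈ ≈-refl ≈-refl n-I₁ ≈-refl
        (pullback-along-mono (proj₂ n) (pushout-pullback p₁.inp-mono C.I₂₁-isPushout))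
      κ : C.K̄₁ ⇒ D.K̄
      -- In `X`, `K̄₁` meets `I₁` exactly in `K₁`; so finality of `K̄` applies with the identity of
      -- `K₁` as `w`.
      κ = IsFPC.final D.isFPC K₁-pullback identityʳ
      d-κ : D.d ∘ κ ≈ proj₁ n ∘ C.i₁′
      d-κ = IsFPC.d∘final D.isFPC K₁-pullback identityʳ
      κ-k₁ : κ ∘ C.k₁ ≈ D.b
      κ-k₁ = ≈-trans (IsFPC.final∘y D.isFPC K₁-pullback identityʳ) identityʳ
      κ-mono : Mono κ
      κ-mono = mono-cancel (mono-resp-≈ (≈-sym d-κ)
        (mono-∘ (proj₂ n) (pushout-mono p₁.inp-mono C.I₂₁-isPushout)))
      eq : D.O⇒Y ∘ p₁.out ≈ (D.K̄⇒Y ∘ κ) ∘ C.k₁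
      eq = ≈-trans (IsPushout.commute D.Y-isPushout) (≈-sym (pullʳ κ-k₁))
      x : C.N ⇒ D.Y
      x = IsPushout.universal C.complement-isPushout eq
      x-O₁ : x ∘ C.n-right ≈ D.O⇒Y
      x-O₁ = IsPushout.universal∘i₁ C.complement-isPushout eq
      x-K̄₁ : x ∘ C.o₁′ ≈ D.K̄⇒Y ∘ κ
      x-K̄₁ = IsPushout.universal∘i₂ C.complement-isPushout eq
      x-mono : Mono x
      x-mono = pushout-mono κ-mono (pushout-flip (pushout-cancel C.complement-isPushout x-K̄₁
        (pushout-resp-≈ ≈-refl (≈-sym κ-k₁) (≈-sym x-O₁) ≈-refl D.Y-isPushout)))

    module Intersection (m₁ : Setoid.Carrier (Matches p₁ X)) (m₂ : Setoid.Carrier (Matches p₂ (derive p₁ m₁))) where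

      module D = Derivation p₁ m₁

      open Pullback (pullbacks (proj₁ m₂) D.O⇒Y) using (isPullback) renaming (p₁ to leg₂; p₂ to leg₁)

      intersection : MonoSpan p₂.I p₁.O
      intersection = record
        { left = leg₂ ; right = leg₁
        ; left-mono = pullback-mono isPullback D.O⇒Y-mono
        ; right-mono = pullback-mono (pullback-flip isPullback) (proj₂ m₂)
        }

      -- `t` runs through all representatives of the intersection, since `imageʳ` must serve each of
      -- them.
      module Union {t : MonoSpan p₂.I p₁.O} (θ : intersection ≅ᴹ t) where
        module t = MonoSpan t
        module G = Gluing t
        module θ = _≅ᴹ_ θ

        t-pullback : IsPullback t.left t.right (proj₁ m₂) D.O⇒Y
        t-pullback = record
          { commute = commutes
          ; universal = λ eq → from θ.M-iso ∘ universal eq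
          ; p₁∘universal = λ eq → ≈-trans (pullˡ θ.left-comm) (p₁∘universal eq)
          ; p₂∘universal = λ eq → ≈-trans (pullˡ θ.right-comm) (p₂∘universal eq)
          ; jointly-monic = λ r _ → t.left-mono _ _ r
          }
          where
          open IsPullback isPullback
          left-to : t.left ≈ leg₂ ∘ to θ.M-iso
          left-to = ≈-sym (≈-trans (∘-congʳ (≈-sym θ.left-comm)) (≈-trans (pullʳ (isoʳ θ.M-iso)) identityʳ))
          right-to : t.right ≈ leg₁ ∘ to θ.M-iso
          right-to = ≈-sym (≈-trans (∘-congʳ (≈-sym θ.right-comm)) (≈-trans (pullʳ (isoʳ θ.M-iso)) identityʳ))
          commutes : proj₁ m₂ ∘ t.left ≈ D.O⇒Y ∘ t.right
          commutes = ≈-trans (∘-congˡ left-to) (≈-trans (pullˡ commute)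
            (≈-trans assoc (∘-congˡ (≈-sym right-to))))

        x : G.N ⇒ D.Y
        x = IsPushout.universal G.isPushout (IsPullback.commute t-pullback)
        x-I₂ : x ∘ G.n-left ≈ proj₁ m₂
        x-I₂ = IsPushout.universal∘i₁ G.isPushout (IsPullback.commute t-pullback)
        x-O₁ : x ∘ G.n-right ≈ D.O⇒Y
        x-O₁ = IsPushout.universal∘i₂ G.isPushout (IsPullback.commute t-pullback)
        x-mono : Mono x
        x-mono = union-mono (proj₂ m₂) D.O⇒Y-mono t-pullback G.isPushout x-I₂ x-O₁

        -- Equality of composition matches does not see the complement, hence `c` is arbitrary.
        -- Finality of the pushout square of `Y` compares it with `K̄`.
        module Complete (c : PushoutComplement p₁.out G.n-right) where

          μ : CompositionMatch p₂ p₁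
          μ = record { span = t ; complement = c }

          module C = Composition p₂ p₁ μ

          K₁-pullback : IsPullback p₁.out C.k₁ D.O⇒Y (x ∘ C.o₁′)
          K₁-pullback = pullback-resp-≈ ≈-refl ≈-refl x-O₁ ≈-refl
            (pullback-along-mono x-mono (pushout-pullback p₁.out-mono C.complement-isPushout))
          Y-fpc : IsFPC D.O⇒Y p₁.out D.K̄⇒Y D.b
          Y-fpc = pushout-fpc p₁.out-mono D.Y-isPushout
          κ : C.K̄₁ ⇒ D.K̄
          κ = IsFPC.final Y-fpc K₁-pullback identityʳ
          x-K̄₁ : x ∘ C.o₁′ ≈ D.K̄⇒Y ∘ κ
          x-K̄₁ = ≈-sym (IsFPC.d∘final Y-fpc K₁-pullback identityʳ)
          κ-k₁ : κ ∘ C.k₁ ≈ D.b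
          κ-k₁ = ≈-trans (IsFPC.final∘y Y-fpc K₁-pullback identityʳ) identityʳ
          κ-mono : Mono κ
          κ-mono = mono-cancel (mono-resp-≈ x-K̄₁ (mono-∘ x-mono C.o₁′-mono))

          -- `b` factors through `κ`, so restricting the FPC square along `κ` keeps all of `K₁`.
          -- This makes `I₂₁` the union of `I₁` and `K̄₁` in `X`.
          m₁-K₁-pullback : IsPullback p₁.inp C.k₁ (proj₁ m₁) (D.d ∘ κ)
          m₁-K₁-pullback = pullback-resp-≈ identityʳ ≈-refl ≈-refl ≈-refl
            (pullback-paste (IsFPC.isPullback D.isFPC) (pullback-flip (triangle-pullback κ-mono κ-k₁)))
          n : C.I₂₁ ⇒ X
          n = IsPushout.universal C.I₂₁-isPushout (IsPullback.commute m₁-K₁-pullback)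
          n-I₁ : n ∘ C.I₁⇒I₂₁ ≈ proj₁ m₁
          n-I₁ = IsPushout.universal∘i₁ C.I₂₁-isPushout (IsPullback.commute m₁-K₁-pullback)
          n-K̄₁ : n ∘ C.i₁′ ≈ D.d ∘ κ
          n-K̄₁ = IsPushout.universal∘i₂ C.I₂₁-isPushout (IsPullback.commute m₁-K₁-pullback)
          n-mono : Mono n
          n-mono = union-mono (proj₂ m₁) (mono-∘ D.d-monic κ-mono) m₁-K₁-pullback C.I₂₁-isPushout n-I₁ n-K̄₁

          related : (m₁ , m₂) ~ (μ , n , n-mono)
          related = record
            { κ = κ ; x = x ; n-I₁ = n-I₁ ; n-K̄₁ = n-K̄₁ ; x-O₁ = x-O₁ ; x-I₂ = x-I₂ ; x-K̄₁ = x-K̄₁ }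

      -- Base change of the pushout `Y` along `x`: `O₁` and `K₁` already map into `N` and stay
      -- unchanged, while `K̄` is cut down to its intersection with `N`. By the van Kampen property
      -- the result is a pushout with apex `N`.
      intersection-complement : PushoutComplement p₁.out (Gluing.n-right intersection)
      intersection-complement = record { k = k ; g′ = q₁ ; isPushout = Equivalence.from
        (vanKampen p₁.out-mono D.Y-isPushout (≈-sym q₁-k)
          (≈-trans U.x-O₁ (≈-sym identityʳ)) (IsPullback.commute Q)
          (triangle-pullback mono-id identityˡ)
          (triangle-pullback (pullback-mono (pullback-flip Q) U.x-mono) q₂-k))
        (triangle-pullback U.x-mono U.x-O₁ , Q) }
        where
        module U = Union (Setoid.refl (monoSpans p₂.I p₁.O) {intersection})
        open Pullback (pullbacks U.x D.K̄⇒Y) renaming (p₁ to q₁; p₂ to q₂; isPullback to Q)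
        eq : U.x ∘ (U.G.n-right ∘ p₁.out) ≈ D.K̄⇒Y ∘ D.b
        eq = ≈-trans (pullˡ U.x-O₁) (IsPushout.commute D.Y-isPushout)
        k : p₁.K ⇒ _
        k = IsPullback.universal Q eq
        q₁-k : q₁ ∘ k ≈ U.G.n-right ∘ p₁.out
        q₁-k = IsPullback.p₁∘universal Q eq
        q₂-k : q₂ ∘ k ≈ D.b
        q₂-k = IsPullback.p₂∘universal Q eq

    result-iso : ∀ {m₁ m₂ μ n} → (m₁ , m₂) ~ (μ , n) → derive p₂ m₂ ≅ derive (compose p₂ p₁ μ) n
    result-iso {m₁} {m₂} {μ} {n} r = TwoStep.final-iso
      r.Y-gluing r.C.o₁′-mono r.x-mono
      (FPC.isFPC (fpc r.C.n-left-mono p₂.inp-mono)) r.C.i₂′-mono p₂.out-mono r.C.O₂₁-isPushout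
      -- The pushout `I₂₁` is itself an FPC; cancelling it from the FPC of the first step exhibits
      -- `K̄` as the FPC of `i₁′` along `n`.
      (fpc-cancel r.D.d-monic r.i₁′-mono r.D.isFPC (pushout-fpc p₁.inp-mono r.C.I₂₁-isPushout) r.n-I₁ r.n-K̄₁)
      r.D.d-monic r.C.K₂₁-isPullback
      r.x-I₂ E.isFPC E.d-monic E.Y-isPushout F.isFPC F.d-monic F.Y-isPushout
      where
      module r = Related r
      module E = Derivation p₂ m₂
      module F = Derivation (compose p₂ p₁ μ) n

  I₁⇒I₂₁-mono : ∀ p₂ p₁ (μ : CompositionMatch p₂ p₁) → Mono (Composition.I₁⇒I₂₁ p₂ p₁ μ)
  I₁⇒I₂₁-mono p₂ p₁ μ = pushout-mono k₁-mono (pushout-flip I₂₁-isPushout)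
    where
    open Composition p₂ p₁ μ
    k₁-mono : Mono k₁
    k₁-mono = pullback-mono
      (pullback-flip (pushout-pullback (Rule.out-mono p₁) complement-isPushout)) n-right-mono

  -- The trivial rule

  -- Strictness inverts `g`, and `h ∘ g⁻¹` is an endomorphism of `∅`, hence the identity. It follows
  -- that `!` is monic and thus a match.
  maps-to-∅-unique : ∀ {X} (g h : X ⇒ ∅) → g ≈ h
  maps-to-∅-unique g h =
    let g⁻¹ , g⁻¹g , _ = strict g
    in begin
      g                ≈⟨ identityˡ ⟨
      id ∘ g           ≈⟨ ∘-congʳ (≈-trans (≈-sym (!-unique id)) (!-unique (h ∘ g⁻¹))) ⟩
      (h ∘ g⁻¹) ∘ g    ≈⟨ pullʳ g⁻¹g ⟩
      h ∘ id           ≈⟨ identityʳ ⟩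
      h                ∎

  initial-match : ∀ X → Setoid.Carrier (Matches trivialRule X)
  initial-match X = ! , λ g h _ → maps-to-∅-unique g h

  -- `X` itself is an FPC of an identity followed by `m`, so `K̄` is isomorphic to `X`, and a
  -- pushout along an identity changes nothing.
  derive-trivial : ∀ {X} (m : Setoid.Carrier (Matches trivialRule X)) → derive trivialRule m ≅ X
  derive-trivial {X} m = proj₁ (pushout-iso ≅-refl ≅-refl κ idle κ-b D.Y-isPushout id-pushout)
    where
    module D = Derivation trivialRule m

    id-fpc : IsFPC (proj₁ m) id id (proj₁ m)
    id-fpc = mono-fpc (pullback-flip (triangle-pullback mono-id identityˡ)) mono-id λ {_} {_} {_} {_} {z} _ _ → z , identityˡ

    id-pushout : IsPushout id (proj₁ m) (proj₁ m) id
    id-pushout = record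
      { commute = ≈-trans identityʳ (≈-sym identityˡ)
      ; universal = λ {_} {_} {h₂} _ → h₂
      ; universal∘i₁ = λ eq → ≈-trans (≈-sym eq) identityʳ
      ; universal∘i₂ = λ _ → identityʳ
      ; jointly-epic = λ _ r → ≈-trans (≈-sym identityʳ) (≈-trans r identityʳ)
      }

    κ-iso = fpc-iso ≅-refl ≅-refl ≅-refl idle idle D.d-monic mono-id D.isFPC id-fpc
    κ = proj₁ κ-iso
    κ-b = proj₂ (proj₂ κ-iso)

-- The representation

module _ {o ℓ e} {𝐂 : Category o ℓ e}
  (adhesive : CategoryTheory.Adhesive 𝐂)
  (finitary : CategoryTheory.Finitary 𝐂)
  (finiteMonos : CategoryTheory.FiniteMonos 𝐂)
  (initial : CategoryTheory.StrictInitial 𝐂)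
  (fpcs : CategoryTheory.FPCsAlongMonos 𝐂) where

  open CategoryTheory 𝐂
  open SqPO adhesive finitary finiteMonos initial fpcs
  open Concurrency adhesive finitary finiteMonos initial fpcs
  open StrictInitial initial

  correspondence : ∀ p₂ p₁ X → Correspondence
    (Matches p₁ X) (λ m₁ → Matches p₂ (derive p₁ m₁))
    (CompositionMatches p₂ p₁) (λ μ → Matches (compose p₂ p₁ μ) X)
    (_~_ p₂ p₁ X)
  correspondence p₂ p₁ X = record
    { respʳ = λ {s} {μ} {n} {n′} r n≈n′ → let open _~_ {p₂} {p₁} {X} r in record
        { κ = κ ; x = x ; x-O₁ = x-O₁ ; x-I₂ = x-I₂ ; x-K̄₁ = x-K̄₁
        ; n-I₁ = ≈-trans (∘-congʳ (≈-sym n≈n′)) n-I₁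
        ; n-K̄₁ = ≈-trans (∘-congʳ (≈-sym n≈n′)) n-K̄₁
        }
    ; respˡ = λ {t} {m₁} {m₂} {m₂′} r m₂≈m₂′ → let open _~_ {p₂} {p₁} {X} r in record
        { κ = κ ; x = x ; x-O₁ = x-O₁ ; x-K̄₁ = x-K̄₁ ; n-I₁ = n-I₁ ; n-K̄₁ = n-K̄₁
        ; x-I₂ = ≈-trans x-I₂ m₂≈m₂′
        }
    ; imageʳ = λ (m₁ , m₂) →
        let open Intersection p₂ p₁ X m₁ m₂
        in record { span = intersection ; complement = intersection-complement } , λ μ θ →
          let open Union.Complete θ (CompositionMatch.complement μ)
          in (n , n-mono) , related
    ; imageˡ = λ (μ , n) → (proj₁ n ∘ Composition.I₁⇒I₂₁ p₂ p₁ μ , mono-∘ (proj₂ n) (I₁⇒I₂₁-mono p₂ p₁ μ))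
        , split p₂ p₁ X {μ} n
    ; uniqueʳ₁ = λ {s} {μ} {n} {μ′} {n′} r r′ → span-unique p₂ p₁ X {s} {μ} {n} {μ′} {n′} r r′
    ; uniqueʳ₂ = λ {s} {μ} {n} {n′} r r′ → one-step-match-unique p₂ p₁ X {s} {μ} {n} {n′} r r′
    ; uniqueˡ₁ = λ {t} {m₁} {m₂} {m₁′} {m₂′} r r′ → first-match-unique p₂ p₁ X {m₁} {m₂} {m₁′} {m₂′} {t} r r′
    ; uniqueˡ₂ = λ {t} {m₁} {m₂} {m₂′} r r′ → second-match-unique p₂ p₁ X {m₁} {m₂} {m₂′} {t} r r′
    }

  module _ {r ℓr} (𝐤 : CommutativeRing r ℓr) where

    open Modules 𝐤
    open LinearMap
    private
      module Rules   = FreeModule Lin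
      module Objects = FreeModule objects
      ρ = representation 𝐤
      module Ĉ = LeftModule (Ĉ 𝐤)
      act : Rules.Combination → LinearMap (Ĉ 𝐤) (Ĉ 𝐤)
      act = ⟦ ρ ⟧
      product : Rules.Combination → LinearMap Rules.Free Rules.Free
      product = ⟦ ruleProduct 𝐤 ⟧
      ev : Objects.Combination → LinearMap (Hom (Ĉ 𝐤) (Ĉ 𝐤)) (Ĉ 𝐤)
      ev = evaluation 𝐤 {M = Ĉ 𝐤} {N = Ĉ 𝐤}
      open Sums 𝐤 (Ĉ 𝐤) using (∑-singleton; ∑∑-reindex)

    -- Not through the name that open gives to trivialRule: it differs syntactically from the original
    -- occurring in ruleAlgebra, and their comparison would unfold the whole representation.
    representation-𝟙 : ∀ u → ⟦ act (Rules.δ (SqPO.trivialRule adhesive finitary finiteMonos initial fpcs)) ⟧ u Ĉ.≈ᴹ u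
    representation-𝟙 =
      agree-on-generators 𝐤 {S = objects} {M = Ĉ 𝐤} (act (Rules.δ trivialRule)) (idᴸ {M = Ĉ 𝐤}) λ X →
        ∑-singleton (matches-finite trivialRule X) (initial-match X) (λ m → !-unique (proj₁ m))
          (λ m → Objects.δ-cong (derive-trivial m))

    -- Once linearity has moved the outer sum outside on each side, the summands are sums over
    -- matches by computation, and the correspondence applies.
    representation-⊙-generators : ∀ p₂ p₁ X →
      ⟦ act (⟦ product (Rules.δ p₂) ⟧ (Rules.δ p₁)) ⟧ (Objects.δ X) Ĉ.≈ᴹ
      ⟦ act (Rules.δ p₂) ⟧ (⟦ act (Rules.δ p₁) ⟧ (Objects.δ X))
    representation-⊙-generators p₂ p₁ X = Ĉ.≈ᴹ-trans
      (∑-homo 𝐤 (ev (Objects.δ X) ∘ᴸ ρ) (compositionMatches-finite p₂ p₁) (λ μ → Rules.δ (compose p₂ p₁ μ)))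
      (Ĉ.≈ᴹ-trans
        (Ĉ.≈ᴹ-sym (∑∑-reindex (correspondence p₂ p₁ X)
          (matches-finite p₁ X) (λ m₁ → matches-finite p₂ (derive p₁ m₁))
          (compositionMatches-finite p₂ p₁) (λ μ → matches-finite (compose p₂ p₁ μ) X)
          {f = λ m₁ m₂ → Objects.δ (derive p₂ m₂)} {g = λ μ n → Objects.δ (derive (compose p₂ p₁ μ) n)}
          (λ {m₁} {m₂} {μ} {n} r → Objects.δ-cong (result-iso p₂ p₁ X {m₁} {m₂} {μ} {n} r))))
        (Ĉ.≈ᴹ-sym (∑-homo 𝐤 (act (Rules.δ p₂)) (matches-finite p₁ X) (λ m₁ → Objects.δ (derive p₁ m₁)))))

    -- Both sides are trilinear. Each use of `agree-on-generators` presents them as linear in one of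
    -- `R₂`, `R₁`, `u`, with evaluations fixing the other arguments.
    representation-⊙ : ∀ R₂ R₁ u → ⟦ act (⟦ product R₂ ⟧ R₁) ⟧ u Ĉ.≈ᴹ ⟦ act R₂ ⟧ (⟦ act R₁ ⟧ u)
    representation-⊙ R₂ R₁ u = agree-on-generators 𝐤 {S = Lin} {M = Ĉ 𝐤}
      (ev u ∘ᴸ ρ ∘ᴸ evaluation 𝐤 {M = Rules.Free} {N = Rules.Free} R₁ ∘ᴸ ruleProduct 𝐤) (ev (⟦ act R₁ ⟧ u) ∘ᴸ ρ)
      (λ p₂ → agree-on-generators 𝐤 {S = Lin} {M = Ĉ 𝐤}
        (ev u ∘ᴸ ρ ∘ᴸ product (Rules.δ p₂)) (act (Rules.δ p₂) ∘ᴸ ev u ∘ᴸ ρ)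
        (λ p₁ → agree-on-generators 𝐤 {S = objects} {M = Ĉ 𝐤}
          (act (⟦ product (Rules.δ p₂) ⟧ (Rules.δ p₁))) (act (Rules.δ p₂) ∘ᴸ act (Rules.δ p₁))
          (representation-⊙-generators p₂ p₁) u)
        R₁)
      R₂

    representation-isHomomorphism : IsUnitalAlgebraHomomorphism (ruleAlgebra 𝐤) (End (Ĉ 𝐤)) ⟦ ρ ⟧
    representation-isHomomorphism = record
      { isLeftModuleHomomorphism = isLeftModuleHomomorphism ρ
      ; 𝟙-homo = representation-𝟙
      ; ⊙-homo = representation-⊙
      }

mainTheorem4 :
    ∀ {o ℓ e} (𝐂 : Category o ℓ e)
    (adhesive : CategoryTheory.Adhesive 𝐂)
    (finitary : CategoryTheory.Finitary 𝐂)
    (finiteMonos : CategoryTheory.FiniteMonos 𝐂)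
    (initial : CategoryTheory.StrictInitial 𝐂)
    (fpcs : CategoryTheory.FPCsAlongMonos 𝐂) →
    let open SqPO adhesive finitary finiteMonos initial fpcs
        open Modules ℝ-commutativeRing
    in IsUnitalAlgebraHomomorphism
         (ruleAlgebra ℝ-commutativeRing)
         (End (Ĉ ℝ-commutativeRing))
         (LinearMap.⟦ representation ℝ-commutativeRing ⟧)
mainTheorem4 𝐂 adhesive finitary finiteMonos initial fpcs =
  representation-isHomomorphism adhesive finitary finiteMonos initial fpcs ℝ-commutativeRing
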